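{- For all sufficiently large integers $n$, \[ r_{1,1}(n) > r_{2,1}(n) \quad\text{and}\quad r_{1,2}(n) < r_{2,2}(n). \]
   Context: A partition $\lambda=(\lambda_1\ge \lambda_2\ge\cdots\ge\lambda_k)$ of $n$ is a weakly decreasing sequence of positive integers summing to $n$; its conjugate is $\lambda'$ with $\lambda'_j=\#\{i:\lambda_i\ge j\}$. For the cell in row $i$ and column $j$ of the Young diagram of $\lambda$ (so $1\le j\le \lambda_i$), its hook length is $h(i,j)=\lambda_i+\lambda'_j-i-j+1$. A $t$-hook of $\lambda$ is a cell with hook length $t$. For a positive integer $t$, $r_{1,t}(n)$ denotes the total number of $t$-hooks, summed over all partitions of $n$ whose consecutive parts differ by at least $2$ (i.e. $\lambda_i-\lambda_{i+1}\ge 2$ for all $1\le i<k$), and $r_{2,t}(n)$ denotes the total number of $t$-hooks, summed over all partitions of $n$ all of whose parts are congruent to $1$ or $4$ modulo $5$. -}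

module Defs where

open import Data.Nat using (ℕ; zero; suc; _+_; _∸_; _≤ᵇ_; _≡ᵇ_; _<ᵇ_)
open import Data.Nat.DivMod using (_%_)
open import Data.Bool using (Bool; true; false; _∧_; _∨_; if_then_else_)
open import Data.Nat.ListAction using (sum)
open import Data.List using (List; []; _∷_; map; concatMap; filter; length; upTo; applyUpTo; lookup)
import Data.List as L
open import Relation.Nullary.Decidable using (does)
open import Function using (_∘_)
open import Relation.Binary.PropositionalEquality using (_≡_)

-- A partition is represented as a weakly decreasing list of positive parts.

-- pts fuel n m : all partitions of n whose largest part is ≤ m
-- (fuel ≥ n guarantees completeness, since each part is ≥ 1).
pts : ℕ → ℕ → ℕ → List (List ℕ)
pts _ zero _ = [] ∷ []
pts zero (suc _) _ = []
pts (suc f) n@(suc _) m =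
  concatMap (λ k → map (λ rest → suc k ∷ rest) (pts f (n ∸ suc k) (suc k)))
            (filter (λ k → Data.Nat._≤?_ (suc k) m) (upTo n))

partitions : ℕ → List (List ℕ)
partitions n = pts n n n

conj : List ℕ → ℕ → ℕ
conj λs j = length (filter (λ p → Data.Nat._≤?_ j p) λs)

-- hook length h(i,j) = λ_i + λ'_j - i - j + 1, with 1-based i,j.
-- For a cell, λ_i ≥ j and λ'_j ≥ i, so this equals (λ_i ∸ j) + (λ'_j ∸ i) + 1.
-- hooksFrom i λs : list of hook lengths of cells in rows i, i+1, ... (λs is the
-- list of rows from row i on), with full partition `full` used for conjugates.
hooksRows : List ℕ → ℕ → List ℕ → List ℕ
hooksRows full i [] = []
hooksRows full i (r ∷ rs) =
  map (λ j → (r ∸ j) + (conj full j ∸ i) + 1) (applyUpTo suc r)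
  L.++ hooksRows full (suc i) rs

hooks : List ℕ → List ℕ
hooks λs = hooksRows λs 1 λs

numHooks : ℕ → List ℕ → ℕ
numHooks t λs = length (filter (λ h → Data.Nat._≟_ h t) (hooks λs))

gap2 : List ℕ → Bool
gap2 [] = true
gap2 (a ∷ []) = true
gap2 (a ∷ b@(_) ∷ rs) = (b + 2 ≤ᵇ a) ∧ gap2 (b ∷ rs)

mod14 : List ℕ → Bool
mod14 [] = true
mod14 (a ∷ rs) = (((a % 5) ≡ᵇ 1) ∨ ((a % 5) ≡ᵇ 4)) ∧ mod14 rs

r₁ : ℕ → ℕ → ℕ
r₁ t n = sum (map (numHooks t) (filter (λ p → Data.Bool._≟_ (gap2 p) true) (partitions n)))

r₂ : ℕ → ℕ → ℕ
r₂ t n = sum (map (numHooks t) (filter (λ p → Data.Bool._≟_ (mod14 p) true) (partitions n)))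

{-# OPTIONS --safe #-}
module Submission where

-- Let G be the generating function of the partitions with gaps ≥ 2, and L the same with each
-- partition weighted by its number of parts. Such a partition has one 1-hook and at most one
-- 2-hook per part, so L counts its 1-hooks and bounds its 2-hooks. For parts ≡ ±1 mod 5 the
-- number of 1-hooks is the number of distinct parts, and the number of 2-hooks is at least the
-- number of distinct parts ≥ 2 plus the number of repeated parts; by Rogers–Ramanujan these
-- have generating functions G σ̂ and G τ̂, where the coefficients of σ̂ and τ̂ have means 2/5 and
-- 3/5. So it suffices to place L strictly between (2/5) S and (3/5) S, S being the partial sums
-- of G.
-- Write G i for the partitions with parts > i, so that G i = G (i+1) + q^(i+1) G (i+2), and
-- u = q^m for m parts. From m = Σ_j (1 − q^m) ⋯ (1 − q^(m−j+1)) / (1 − q^j) the terms j = 1, 2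
-- give L ≥ q G 2 / (1 − q) + q^4 G 4 / (1 − q²), which is about 0.45 S; and from
-- 2 m (1 − q) ≤ u⁻¹ − u comes 2 L ≤ S + 2 G. All errors are bounded multiples of G, and these are
-- negligible because the mean number of parts L / G tends to infinity.

-- No asymptotics enter: every estimate is an inequality between all coefficients. Such an
-- inequality for `G 0` and `L 0` alone offers no induction, so it is embedded in a family over the
-- lower bound i of the parts. The family satisfies the recurrence of `G i` up to a source term, and
-- it is nonnegative as soon as the source is. The coefficients of `G 0` do not decrease; hence
-- replacing a power q^k by 1 inside `S` changes it by at most k times `G 0`, which is how all
-- errors become multiples of `G 0`. How sharp the bounds must be is seen heuristically from the
-- dominant value of u: with `G (i+1)` close to u `G i` and q close to 1, the recurrence becomes 1 =
-- u + u². So `L` should be about -log u = 0.481 times `S`. The first term 1 - u = 0.382 of the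
-- logarithmic series would miss 2/5, while two terms give 0.455; on the other side (u⁻¹ - u) / 2 =
-- 1/2 is safely below 3/5.

open import Algebra.Bundles using (CommutativeRing)
open import Algebra.Structures using (IsCommutativeRing)
open import Data.Bool as Bool using (Bool; true; false; if_then_else_; _∧_; _∨_)
open import Data.Empty using (⊥; ⊥-elim)
open import Data.Integer as ℤ using (ℤ; +_; 0ℤ; 1ℤ)
import Data.Integer.Properties as ℤ
open import Data.Integer.Solver using () renaming (module +-*-Solver to ℤS)
open import Data.List as List using (List; []; _∷_; _++_; _∷ʳ_; map; filter; length; upTo; applyUpTo; concatMap)
import Data.List.Properties as List
open import Data.List.Relation.Unary.All as All using (All; []; _∷_)
import Data.List.Relation.Unary.All.Properties as All
open import Data.Maybe using (nothing)
open import Data.Nat as ℕ using (ℕ; zero; suc; _<_; _>_; _≥_)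
import Data.Nat.DivMod as ℕ
open import Data.Nat.ListAction using (sum)
open import Data.Nat.ListAction.Properties using (sum-++)
import Data.Nat.Properties as ℕ
open import Data.Nat.Solver using () renaming (module +-*-Solver to ℕS)
open import Data.Product using (_×_; _,_; ∃-syntax; proj₁; proj₂)
import Data.Sum as Sum
open import Data.Vec as Vec using (Vec)
open import Data.Vec.N-ary using (N-ary; Eq; curryⁿ; curryⁿ-cong; _$ⁿ_)
open import Defs
open import Function using (_∘_)
open import Level using (0ℓ)
open import Relation.Binary.PropositionalEquality
  using (_≡_; _≢_; refl; sym; trans; cong; cong₂; subst; module ≡-Reasoning)
open import Relation.Binary.Structures using (IsEquivalence)
open import Relation.Nullary.Decidable using (yes; no; toWitness; isYes)
open import Tactic.RingSolver.Core.AlmostCommutativeRing using (fromCommutativeRing)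
open import Tactic.RingSolver.Core.Expression using (Expr; Ι; module Eval)
  renaming (Κ to con; _⊕_ to _:+_; _⊗_ to _:*_; ⊝_ to :-_; _⊛_ to _:^_)
import Tactic.RingSolver.Core.Polynomial.Base as Polynomial
import Tactic.RingSolver.Core.Polynomial.Homomorphism as PolynomialHomomorphism
open import Tactic.RingSolver.Core.Polynomial.Parameters using (Homomorphism)
import Tactic.RingSolver.Core.Polynomial.Semantics as PolynomialSemantics

-- Formal power series

record Series : Set where
  no-eta-equality
  field at : ℕ → ℤ

open Series

infix 4 _≈_ _≈[_]_

record _≈_ (f g : Series) : Set where
  constructor ext
  field _‼_ : ∀ n → at f n ≡ at g n

open _≈_

private
  conv : (ℕ → ℤ) → (ℕ → ℤ) → ℕ → ℤ
  conv f g zero    = f 0 ℤ.* g 0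
  conv f g (suc n) = f 0 ℤ.* g (suc n) ℤ.+ conv (f ∘ suc) g n

  conv-cong : ∀ {f f′ g g′} n → (∀ k → k ℕ.≤ n → f k ≡ f′ k) → (∀ k → k ℕ.≤ n → g k ≡ g′ k) →
              conv f g n ≡ conv f′ g′ n
  conv-cong zero    p q = cong₂ ℤ._*_ (p 0 ℕ.≤-refl) (q 0 ℕ.≤-refl)
  conv-cong (suc n) p q = cong₂ ℤ._+_ (cong₂ ℤ._*_ (p 0 ℕ.z≤n) (q (suc n) ℕ.≤-refl))
    (conv-cong n (λ k k≤n → p (suc k) (ℕ.s≤s k≤n)) (λ k k≤n → q k (ℕ.m≤n⇒m≤1+n k≤n)))

  open ℤS using () renaming (solve to solveℤ; _:+_ to _+′_; _:*_ to _*′_; _:=_ to _≔_)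

  conv-distribʳ : ∀ f g h n → conv (λ k → f k ℤ.+ g k) h n ≡ conv f h n ℤ.+ conv g h n
  conv-distribʳ f g h zero    = ℤ.*-distribʳ-+ (h 0) (f 0) (g 0)
  conv-distribʳ f g h (suc n) rewrite conv-distribʳ (f ∘ suc) (g ∘ suc) h n =
    solveℤ 5 (λ a b c x y → (a +′ b) *′ c +′ (x +′ y) ≔ (a *′ c +′ x) +′ (b *′ c +′ y)) refl
      (f 0) (g 0) (h (suc n)) (conv (f ∘ suc) h n) (conv (g ∘ suc) h n)

  conv-scaleˡ : ∀ c f g n → conv (λ k → c ℤ.* f k) g n ≡ c ℤ.* conv f g n
  conv-scaleˡ c f g zero    = ℤ.*-assoc c (f 0) (g 0)
  conv-scaleˡ c f g (suc n) rewrite conv-scaleˡ c (f ∘ suc) g n =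
    solveℤ 4 (λ c a b x → c *′ a *′ b +′ c *′ x ≔ c *′ (a *′ b +′ x)) refl
      c (f 0) (g (suc n)) (conv (f ∘ suc) g n)

  conv-sucʳ : ∀ f g n → conv f g (suc n) ≡ f (suc n) ℤ.* g 0 ℤ.+ conv f (g ∘ suc) n
  conv-sucʳ f g zero    = ℤ.+-comm (f 0 ℤ.* g 1) (f 1 ℤ.* g 0)
  conv-sucʳ f g (suc n) rewrite conv-sucʳ (f ∘ suc) g n =
    solveℤ 3 (λ a b c → a +′ (b +′ c) ≔ b +′ (a +′ c)) refl
      (f 0 ℤ.* g (suc (suc n))) (f (suc (suc n)) ℤ.* g 0) (conv (f ∘ suc) (g ∘ suc) n)

  conv-comm : ∀ f g n → conv f g n ≡ conv g f n
  conv-comm f g zero    = ℤ.*-comm (f 0) (g 0)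
  conv-comm f g (suc n) rewrite conv-sucʳ g f n | conv-comm (f ∘ suc) g n =
    cong (ℤ._+ conv g (f ∘ suc) n) (ℤ.*-comm (f 0) (g (suc n)))

  conv-assoc : ∀ f g h n → conv (conv f g) h n ≡ conv f (conv g h) n
  conv-assoc f g h zero    = ℤ.*-assoc (f 0) (g 0) (h 0)
  conv-assoc f g h (suc n)
    rewrite conv-distribʳ (λ k → f 0 ℤ.* g (suc k)) (conv (f ∘ suc) g) h n
          | conv-scaleˡ (f 0) (g ∘ suc) h n
          | conv-assoc (f ∘ suc) g h n =
    solveℤ 5 (λ a b c x y → a *′ b *′ c +′ (a *′ x +′ y) ≔ a *′ (b *′ c +′ x) +′ y) refl
      (f 0) (g 0) (h (suc n)) (conv (g ∘ suc) h n) (conv (f ∘ suc) (conv g h) n)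

  conv-zeroˡ : ∀ g n → conv (λ _ → 0ℤ) g n ≡ 0ℤ
  conv-zeroˡ g zero    = refl
  conv-zeroˡ g (suc n) rewrite conv-zeroˡ g n = refl

infixl 6 _⊕_
infixl 7 _⊛_
infix  8 ⊝_

_⊕_ _⊛_ : Series → Series → Series
at (f ⊕ g) n = at f n ℤ.+ at g n
at (f ⊛ g) n = conv (at f) (at g) n

⊝_ : Series → Series
at (⊝ f) n = ℤ.- at f n

⟪_⟫ : ℤ → Series
at ⟪ c ⟫ zero    = c
at ⟪ c ⟫ (suc n) = 0ℤ

private
  conv-const : ∀ c g n → conv (at ⟪ c ⟫) g n ≡ c ℤ.* g n
  conv-const c g zero    = refl
  conv-const c g (suc n) rewrite conv-zeroˡ g n = ℤ.+-identityʳ _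

  ≈-isEquivalence : IsEquivalence _≈_
  ≈-isEquivalence = record
    { refl  = ext λ n → refl
    ; sym   = λ p → ext λ n → sym (p ‼ n)
    ; trans = λ p q → ext λ n → trans (p ‼ n) (q ‼ n)
    }

  ⊛-comm : ∀ f g → f ⊛ g ≈ g ⊛ f
  ⊛-comm f g = ext (conv-comm (at f) (at g))

  ⊛-identityˡ : ∀ f → ⟪ 1ℤ ⟫ ⊛ f ≈ f
  ⊛-identityˡ f = ext λ n → trans (conv-const 1ℤ (at f) n) (ℤ.*-identityˡ (at f n))

  ⊛-distribʳ : ∀ h f g → (f ⊕ g) ⊛ h ≈ f ⊛ h ⊕ g ⊛ h
  ⊛-distribʳ h f g = ext (conv-distribʳ (at f) (at g) (at h))

  open IsEquivalence ≈-isEquivalence using () renaming (trans to ≈-tr)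

  ⊕-cong : ∀ {f f′ g g′} → f ≈ f′ → g ≈ g′ → f ⊕ g ≈ f′ ⊕ g′
  ⊕-cong p q = ext λ n → cong₂ ℤ._+_ (p ‼ n) (q ‼ n)

  isCommutativeRing : IsCommutativeRing _≈_ _⊕_ _⊛_ ⊝_ ⟪ 0ℤ ⟫ ⟪ 1ℤ ⟫
  isCommutativeRing = record
    { isRing = record
      { +-isAbelianGroup = record
        { isGroup = record
          { isMonoid = record
            { isSemigroup = record
              { isMagma = record
                { isEquivalence = ≈-isEquivalence
                ; ∙-cong        = ⊕-cong
                }
              ; assoc = λ f g h → ext λ n → ℤ.+-assoc (at f n) (at g n) (at h n)
              }
            ; identity = (λ f → ext λ { zero → ℤ.+-identityˡ _ ; (suc n) → ℤ.+-identityˡ _ })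
                       , (λ f → ext λ { zero → ℤ.+-identityʳ _ ; (suc n) → ℤ.+-identityʳ _ })
            }
          ; inverse = (λ f → ext λ { zero → ℤ.+-inverseˡ (at f 0) ; (suc n) → ℤ.+-inverseˡ (at f (suc n)) })
                    , (λ f → ext λ { zero → ℤ.+-inverseʳ (at f 0) ; (suc n) → ℤ.+-inverseʳ (at f (suc n)) })
          ; ⁻¹-cong = λ p → ext λ n → cong ℤ.-_ (p ‼ n)
          }
        ; comm = λ f g → ext λ n → ℤ.+-comm (at f n) (at g n)
        }
      ; *-cong     = λ p q → ext λ n → conv-cong n (λ k _ → p ‼ k) (λ k _ → q ‼ k)
      ; *-assoc    = λ f g h → ext (conv-assoc (at f) (at g) (at h))
      ; *-identity = ⊛-identityˡ , λ f → ≈-tr (⊛-comm f _) (⊛-identityˡ f)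
      ; distrib    = (λ f g h → ≈-tr (⊛-comm f (g ⊕ h))
                       (≈-tr (⊛-distribʳ f g h) (⊕-cong (⊛-comm g f) (⊛-comm h f))))
                   , ⊛-distribʳ
      }
    ; *-comm = ⊛-comm
    }

𝕊 : CommutativeRing 0ℓ 0ℓ
𝕊 = record { isCommutativeRing = isCommutativeRing }

open CommutativeRing 𝕊
  using (zeroˡ; *-cong; *-congˡ; *-congʳ; +-cong; +-congˡ; +-congʳ; *-identityˡ; *-identityʳ;
         *-assoc; *-comm; +-comm; +-identityˡ; +-identityʳ; semiring; -‿cong)
  renaming (reflexive to ≈-reflexive; refl to ≈-refl; sym to ≈-sym; trans to ≈-trans; _-_ to _⊖_)

open import Algebra.Properties.Group (CommutativeRing.+-group 𝕊) using () renaming (x∙y⁻¹≈ε⇒x≈y to difference-zero)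
open import Algebra.Properties.Semiring.Exp.TCOptimised semiring using (^-congˡ)

infixl 6 _:-_

_:-_ : ∀ {n} → Expr ℤ n → Expr ℤ n → Expr ℤ n
x :- y = x :+ :- y

-- The library's ring solver with integer coefficients instead of coefficients from the ring
-- itself, in which equality could not be decided.
module _ where
  private
    homomorphism : Homomorphism 0ℓ 0ℓ 0ℓ 0ℓ
    homomorphism = record
      { from = record
        { rawRing = CommutativeRing.rawRing ℤ.+-*-commutativeRing
        ; isZero  = λ a → isYes (0ℤ ℤ.≟ a)
        }
      ; to = fromCommutativeRing 𝕊 (λ _ → nothing)
      ; morphism = record
        { ⟦_⟧    = ⟪_⟫
        ; +-homo = λ a b → ext λ { zero → refl ; (suc n) → refl }
        ; *-homo = λ a b → ext λ { zero → refl ; (suc n) → sym (trans (conv-const a (at ⟪ b ⟫) (suc n)) (ℤ.*-zeroʳ a)) }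
        ; -‿homo = λ a → ext λ { zero → refl ; (suc n) → refl }
        ; 0-homo = ext λ n → refl
        ; 1-homo = ext λ n → refl
        }
      ; Zero-C⟶Zero-R = λ a a≟0 → ext λ n → cong (λ a → at ⟪ a ⟫ n) (toWitness a≟0)
      }

    open Polynomial (Homomorphism.from homomorphism)
    open PolynomialHomomorphism homomorphism
    open PolynomialSemantics homomorphism renaming (⟦_⟧ to ⟦_⟧ₚ)
    open Eval (CommutativeRing.rawRing 𝕊) ⟪_⟫ using (⟦_⟧)

    normalise : ∀ {n} → Expr ℤ n → Poly n
    normalise (con x)   = κ x
    normalise (Ι x)   = ι x
    normalise (x :+ y) = normalise x ⊞ normalise y
    normalise (x :* y) = normalise x ⊠ normalise y
    normalise (:- x)   = ⊟ normalise x
    normalise (x :^ i) = normalise x ⊡ i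

    normalise-correct : ∀ {n} (e : Expr ℤ n) ρ → ⟦ normalise e ⟧ₚ ρ ≈ ⟦ e ⟧ ρ
    normalise-correct (con x)   ρ = κ-hom x ρ
    normalise-correct (Ι x)   ρ = ι-hom x ρ
    normalise-correct (x :+ y) ρ = ≈-trans (⊞-hom (normalise x) (normalise y) ρ) (+-cong (normalise-correct x ρ) (normalise-correct y ρ))
    normalise-correct (x :* y) ρ = ≈-trans (⊠-hom (normalise x) (normalise y) ρ) (*-cong (normalise-correct x ρ) (normalise-correct y ρ))
    normalise-correct (:- x)   ρ = ≈-trans (⊟-hom (normalise x) ρ) (-‿cong (normalise-correct x ρ))
    normalise-correct (x :^ i) ρ = ≈-trans (⊡-hom (normalise x) i ρ) (^-congˡ i (normalise-correct x ρ))

    equation : ∀ n → N-ary n (Expr ℤ n) (Expr ℤ n × Expr ℤ n) → Expr ℤ n × Expr ℤ n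
    equation n f = f $ⁿ Vec.map Ι (Vec.allFin n)

  -- Only the difference of the two sides is normalised. For a true identity its normal form is the
  -- closed zero polynomial, so `refl` proves the hypothesis by evaluation.
  solve : ∀ n (f : N-ary n (Expr ℤ n) (Expr ℤ n × Expr ℤ n)) →
          let e = proj₁ (equation n f); e′ = proj₂ (equation n f) in
          normalise (e :- e′) ≡ κ 0ℤ →
          Eq n _≈_ (curryⁿ ⟦ e ⟧) (curryⁿ ⟦ e′ ⟧)
  solve n f z = curryⁿ-cong _≈_ ⟦ e ⟧ ⟦ e′ ⟧ λ ρ → difference-zero _ _
    (≈-trans (≈-sym (normalise-correct (e :- e′) ρ))
      (≈-trans (≈-reflexive (cong (λ p → ⟦ p ⟧ₚ ρ) z)) (κ-hom 0ℤ ρ)))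
    where
    e  = proj₁ (equation n f)
    e′ = proj₂ (equation n f)

infix 4 _:=_

_:=_ : ∀ {n} → Expr ℤ n → Expr ℤ n → Expr ℤ n × Expr ℤ n
_:=_ = _,_

-- Agreement of series up to a degree

record _≈[_]_ (f : Series) (n : ℕ) (g : Series) : Set where
  constructor ext[]
  field _‼[] : ∀ k → k ℕ.≤ n → at f k ≡ at g k

open _≈[_]_

⊛-cong[] : ∀ n {f f′ g g′} → f ≈[ n ] f′ → g ≈[ n ] g′ → f ⊛ g ≈[ n ] f′ ⊛ g′
⊛-cong[] n p q = ext[] λ k k≤n → conv-cong k (λ i i≤k → (p ‼[]) i (ℕ.≤-trans i≤k k≤n)) (λ i i≤k → (q ‼[]) i (ℕ.≤-trans i≤k k≤n))

⊕-cong[] : ∀ n {f f′ g g′} → f ≈[ n ] f′ → g ≈[ n ] g′ → f ⊕ g ≈[ n ] f′ ⊕ g′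
⊕-cong[] n p q = ext[] λ k k≤n → cong₂ ℤ._+_ ((p ‼[]) k k≤n) ((q ‼[]) k k≤n)

q : Series
at q zero          = 0ℤ
at q (suc zero)    = 1ℤ
at q (suc (suc n)) = 0ℤ

open import Algebra.Properties.Semiring.Exp semiring using (_^_; ^-homo-*; ^-assocʳ)

private
  q⊛-zero : ∀ f → at (q ⊛ f) 0 ≡ 0ℤ
  q⊛-zero f = refl

  q⊛-suc : ∀ f n → at (q ⊛ f) (suc n) ≡ at f n
  q⊛-suc f n = begin
    0ℤ ℤ.* at f (suc n) ℤ.+ conv (at q ∘ suc) (at f) n ≡⟨ ℤ.+-identityˡ _ ⟩
    conv (at q ∘ suc) (at f) n  ≡⟨ conv-cong n (λ { zero _ → refl ; (suc k) _ → refl }) (λ _ _ → refl) ⟩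
    conv (at ⟪ 1ℤ ⟫) (at f) n   ≡⟨ conv-const 1ℤ (at f) n ⟩
    1ℤ ℤ.* at f n               ≡⟨ ℤ.*-identityˡ (at f n) ⟩
    at f n                      ∎
    where open ≡-Reasoning

q^⊛-< : ∀ m f {k} → k ℕ.< m → at (q ^ m ⊛ f) k ≡ 0ℤ
q^⊛-< (suc m) f {k} k<m = trans (*-assoc q (q ^ m) f ‼ k) (lower k k<m)
  where
  lower : ∀ k → k ℕ.< suc m → at (q ⊛ (q ^ m ⊛ f)) k ≡ 0ℤ
  lower zero    _           = q⊛-zero (q ^ m ⊛ f)
  lower (suc k) (ℕ.s≤s k<m) = trans (q⊛-suc (q ^ m ⊛ f) k) (q^⊛-< m f k<m)

q^⊛-+ : ∀ m f k → at (q ^ m ⊛ f) (m ℕ.+ k) ≡ at f k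
q^⊛-+ zero    f k = *-identityˡ f ‼ k
q^⊛-+ (suc m) f k = trans (*-assoc q (q ^ m) f ‼ suc (m ℕ.+ k))
  (trans (q⊛-suc (q ^ m ⊛ f) (m ℕ.+ k)) (q^⊛-+ m f k))

const-⊛ : ∀ c f n → at (⟪ c ⟫ ⊛ f) n ≡ c ℤ.* at f n
const-⊛ c f = conv-const c (at f)

-- Coefficientwise nonnegativity and geometric series

record Pos (f : Series) : Set where
  constructor pos
  field _≥0 : ∀ n → 0ℤ ℤ.≤ at f n

open Pos

private
  0≤+ : ∀ {i j} → 0ℤ ℤ.≤ i → 0ℤ ℤ.≤ j → 0ℤ ℤ.≤ i ℤ.+ j
  0≤+ = ℤ.+-mono-≤

  0≤* : ∀ {i j} → 0ℤ ℤ.≤ i → 0ℤ ℤ.≤ j → 0ℤ ℤ.≤ i ℤ.* j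
  0≤* {+ m} {+ n} _ _ = subst (0ℤ ℤ.≤_) (ℤ.pos-* m n) (ℤ.+≤+ ℕ.z≤n)

  conv-pos : ∀ f g → (∀ n → 0ℤ ℤ.≤ f n) → (∀ n → 0ℤ ℤ.≤ g n) → ∀ n → 0ℤ ℤ.≤ conv f g n
  conv-pos f g p r zero    = 0≤* (p 0) (r 0)
  conv-pos f g p r (suc n) = 0≤+ (0≤* (p 0) (r (suc n))) (conv-pos (f ∘ suc) g (p ∘ suc) r n)

Pos-⊕ : ∀ {f g} → Pos f → Pos g → Pos (f ⊕ g)
Pos-⊕ p r = pos λ n → 0≤+ ((p ≥0) n) ((r ≥0) n)

Pos-⊛ : ∀ {f g} → Pos f → Pos g → Pos (f ⊛ g)
Pos-⊛ {f} {g} p r = pos (conv-pos (at f) (at g) (p ≥0) (r ≥0))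

Pos-resp : ∀ {f g} → f ≈ g → Pos f → Pos g
Pos-resp e p = pos λ n → subst (0ℤ ℤ.≤_) (e ‼ n) ((p ≥0) n)

Pos-const : ∀ n → Pos ⟪ + n ⟫
Pos-const n = pos λ { zero → ℤ.+≤+ ℕ.z≤n ; (suc _) → ℤ.+≤+ ℕ.z≤n }

Pos-q : Pos q
Pos-q = pos λ { zero → ℤ.+≤+ ℕ.z≤n ; (suc zero) → ℤ.+≤+ ℕ.z≤n ; (suc (suc _)) → ℤ.+≤+ ℕ.z≤n }

Pos-^ : ∀ {f} → Pos f → ∀ n → Pos (f ^ n)
Pos-^ p zero    = Pos-const 1
Pos-^ p (suc n) = Pos-⊛ p (Pos-^ p n)

private
  -- The second argument counts down to the next multiple of d + 1 and is then reset to d; this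
  -- makes the coefficients structurally recursive, without division.
  geoAux : ℕ → ℕ → ℕ → ℤ
  geoAux d zero    zero    = 1ℤ
  geoAux d zero    (suc n) = geoAux d d n
  geoAux d (suc c) zero    = 0ℤ
  geoAux d (suc c) (suc n) = geoAux d c n

  geoAux-<  : ∀ d c n → n ℕ.< c → geoAux d c n ≡ 0ℤ
  geoAux-< d (suc c) zero    _           = refl
  geoAux-< d (suc c) (suc n) (ℕ.s≤s n<c) = geoAux-< d c n n<c

  geoAux-+ : ∀ d c n → geoAux d c (c ℕ.+ n) ≡ geoAux d zero n
  geoAux-+ d zero    n = refl
  geoAux-+ d (suc c) n = geoAux-+ d c n

  geoAux-pos : ∀ d c n → 0ℤ ℤ.≤ geoAux d c n
  geoAux-pos d zero    zero    = ℤ.+≤+ ℕ.z≤n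
  geoAux-pos d zero    (suc n) = geoAux-pos d d n
  geoAux-pos d (suc c) zero    = ℤ.+≤+ ℕ.z≤n
  geoAux-pos d (suc c) (suc n) = geoAux-pos d c n

-- geo d is 1 / (1 − q^(d+1)).
geo : ℕ → Series
at (geo d) = geoAux d zero

geo-rec : ∀ d → geo d ≈ ⟪ 1ℤ ⟫ ⊕ q ^ suc d ⊛ geo d
geo-rec d = ext go
  where
  go : ∀ n → at (geo d) n ≡ at (⟪ 1ℤ ⟫ ⊕ q ^ suc d ⊛ geo d) n
  go zero = sym (cong (λ z → 1ℤ ℤ.+ z) (q^⊛-< (suc d) (geo d) (ℕ.s≤s ℕ.z≤n)))
  go (suc n) with n ℕ.<? d
  ... | yes n<d = trans (geoAux-< d d n n<d)
                    (sym (trans (ℤ.+-identityˡ _) (q^⊛-< (suc d) (geo d) (ℕ.s≤s n<d))))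
  ... | no  n≮d = trans (subst (λ m → geoAux d d m ≡ geoAux d zero (n ℕ.∸ d)) d+ (geoAux-+ d d (n ℕ.∸ d)))
                    (sym (trans (ℤ.+-identityˡ _)
                      (subst (λ m → at (q ^ suc d ⊛ geo d) (suc m) ≡ geoAux d zero (n ℕ.∸ d)) d+ (q^⊛-+ (suc d) (geo d) (n ℕ.∸ d)))))
    where
    d+ : d ℕ.+ (n ℕ.∸ d) ≡ n
    d+ = ℕ.m+[n∸m]≡n (ℕ.≮⇒≥ n≮d)

Pos-geo : ∀ d → Pos (geo d)
Pos-geo d = pos (geoAux-pos d zero)

-- Meaningful if the terms from the m-th on agree up to q^m.
limit : (ℕ → Series) → Series
at (limit F) n = at (F n) n

limit-agrees : ∀ F → (∀ m → F m ≈[ m ] F (suc m)) → ∀ m → F m ≈[ m ] limit F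
limit-agrees F step m = ext[] λ k k≤m → subst (λ m → at (F m) k ≡ at (F k) k) (ℕ.m+[n∸m]≡n k≤m) (go k (m ℕ.∸ k))
  where
  go : ∀ k d → at (F (k ℕ.+ d)) k ≡ at (F k) k
  go k zero    = cong (λ m → at (F m) k) (ℕ.+-identityʳ k)
  go k (suc d) = trans (cong (λ m → at (F m) k) (ℕ.+-suc k d))
    (trans (sym ((step (k ℕ.+ d) ‼[]) k (ℕ.m≤m+n k d))) (go k d))

≈⇒≈[] : ∀ n {f g} → f ≈ g → f ≈[ n ] g
≈⇒≈[] n e = ext[] λ k _ → e ‼ k

≈[]-refl : ∀ n {f} → f ≈[ n ] f
≈[]-refl n = ext[] λ k _ → refl

≈[]-sym : ∀ n {f g} → f ≈[ n ] g → g ≈[ n ] f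
≈[]-sym n e = ext[] λ k k≤n → sym ((e ‼[]) k k≤n)

≈[]-trans : ∀ n {f g h} → f ≈[ n ] g → g ≈[ n ] h → f ≈[ n ] h
≈[]-trans n e e′ = ext[] λ k k≤n → trans ((e ‼[]) k k≤n) ((e′ ‼[]) k k≤n)

≈[]-mono : ∀ {m n f g} → m ℕ.≤ n → f ≈[ n ] g → f ≈[ m ] g
≈[]-mono m≤n e = ext[] λ k k≤m → (e ‼[]) k (ℕ.≤-trans k≤m m≤n)

stable : ∀ (F : ℕ → Series) → (∀ m → F (suc m) ≈[ m ] F m) → ∀ {n m} → n ℕ.≤ m → F m ≈[ n ] F n
stable F step {n} {m} n≤m = subst (λ m → F m ≈[ n ] F n) (ℕ.m∸n+n≡m n≤m) (go (m ℕ.∸ n))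
  where
  go : ∀ d → F (d ℕ.+ n) ≈[ n ] F n
  go zero    = ≈[]-refl n
  go (suc d) = ≈[]-trans n (≈[]-mono (ℕ.m≤n+m n d) (step (d ℕ.+ n))) (go d)

shift-agrees : ∀ m n {f g} → f ≈[ n ] g → q ^ m ⊛ f ≈[ m ℕ.+ n ] q ^ m ⊛ g
shift-agrees m n {f} {g} e = ext[] go
  where
  go : ∀ k → k ℕ.≤ m ℕ.+ n → at (q ^ m ⊛ f) k ≡ at (q ^ m ⊛ g) k
  go k k≤ with k ℕ.<? m
  ... | yes k<m = trans (q^⊛-< m f k<m) (sym (q^⊛-< m g k<m))
  ... | no  k≮m = subst (λ k → at (q ^ m ⊛ f) k ≡ at (q ^ m ⊛ g) k) m+
      (trans (q^⊛-+ m f _) (trans ((e ‼[]) (k ℕ.∸ m) k∸m≤n) (sym (q^⊛-+ m g _))))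
    where
    m+ : m ℕ.+ (k ℕ.∸ m) ≡ k
    m+ = ℕ.m+[n∸m]≡n (ℕ.≮⇒≥ k≮m)
    k∸m≤n : k ℕ.∸ m ℕ.≤ n
    k∸m≤n = ℕ.+-cancelˡ-≤ m _ n (subst (ℕ._≤ m ℕ.+ n) (sym m+) k≤)

at-0 : ∀ k → at ⟪ 0ℤ ⟫ k ≡ 0ℤ
at-0 zero    = refl
at-0 (suc k) = refl

shift-vanishes : ∀ m f → q ^ suc m ⊛ f ≈[ m ] ⟪ 0ℤ ⟫
shift-vanishes m f = ext[] λ k k≤m → trans (q^⊛-< (suc m) f (ℕ.s≤s k≤m)) (sym (at-0 k))

vanishing-factor : ∀ m f → f ≈[ m ] ⟪ 0ℤ ⟫ → ∃[ g ] f ≈ q ^ suc m ⊛ g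
vanishing-factor m f e = g , ext go
  where
  g : Series
  at g n = at f (suc m ℕ.+ n)
  go : ∀ n → at f n ≡ at (q ^ suc m ⊛ g) n
  go n with n ℕ.≤? m
  ... | yes n≤m = trans (trans ((e ‼[]) n n≤m) (at-0 n)) (sym (q^⊛-< (suc m) g (ℕ.s≤s n≤m)))
  ... | no  n≰m = subst (λ n → at f n ≡ at (q ^ suc m ⊛ g) n) (ℕ.m+[n∸m]≡n (ℕ.≰⇒> n≰m))
                    (sym (q^⊛-+ (suc m) g (n ℕ.∸ suc m)))

-- The recurrence of `G` reaches two indices ahead, so the downward induction carries the pair
-- `X i`, `X (suc i)`.
descend : ∀ (X : ℕ → Set) n → (∀ i → n ℕ.≤ i → X i) → (∀ i → X (suc i) → X (suc (suc i)) → X i) → ∀ i → X i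
descend X n base step i = proj₁ (go n i (ℕ.m≤n+m n i))
  where
  go : ∀ d i → n ℕ.≤ i ℕ.+ d → X i × X (suc i)
  go zero    i n≤ = base i n≤i , base (suc i) (ℕ.m≤n⇒m≤1+n n≤i)
    where n≤i = subst (n ℕ.≤_) (ℕ.+-identityʳ i) n≤
  go (suc d) i n≤ with go d (suc i) (subst (n ℕ.≤_) (ℕ.+-suc i d) n≤)
  ... | x , x′ = step i x x′ , x

private
  Pos[_] : ℕ → Series → Set
  Pos[ n ] f = ∀ k → k ℕ.≤ n → 0ℤ ℤ.≤ at f k

  Pos[]-shift : ∀ n m f → Pos[ n ] f → Pos[ n ] (q ^ m ⊛ f)
  Pos[]-shift n m f p k k≤n with k ℕ.<? m
  ... | yes k<m = ℤ.≤-reflexive (sym (q^⊛-< m f k<m))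
  ... | no  k≮m = subst (λ k → 0ℤ ℤ.≤ at (q ^ m ⊛ f) k) (ℕ.m+[n∸m]≡n (ℕ.≮⇒≥ k≮m))
      (subst (0ℤ ℤ.≤_) (sym (q^⊛-+ m f (k ℕ.∸ m))) (p (k ℕ.∸ m) (ℕ.≤-trans (ℕ.m∸n≤m k m) k≤n)))

  -- It suffices to look at one coefficient at a time: the n-th one of X i is settled directly
  -- for i ≥ n, and then downwards in i.
  Pos-descend : ∀ (X : ℕ → Series) →
    (∀ i → ∃[ Z ] ∃[ Z′ ] Pos Z × X i ≈ Z ⊕ q ^ suc i ⊛ Z′) →
    (∀ n i → Pos[ n ] (X (suc i)) → Pos[ n ] (X (suc (suc i))) → Pos[ n ] (X i)) →
    ∀ i → Pos (X i)
  Pos-descend X lead step i = pos λ n → descend (λ i → Pos[ n ] (X i)) n (base n) (step n) i n ℕ.≤-refl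
    where
    base : ∀ n i → n ℕ.≤ i → Pos[ n ] (X i)
    base n i n≤i k k≤n with lead i
    ... | Z , Z′ , posZ , e = subst (0ℤ ℤ.≤_)
      (sym (trans (e ‼ k) (trans (cong (λ z → at Z k ℤ.+ z) (q^⊛-< (suc i) Z′ (ℕ.s≤s (ℕ.≤-trans k≤n n≤i)))) (ℤ.+-identityʳ _))))
      ((posZ ≥0) k)

Pos-telescope : ∀ (X S : ℕ → Series) →
  (∀ i → ∃[ Z ] ∃[ Z′ ] Pos Z × X i ≈ Z ⊕ q ^ suc i ⊛ Z′) →
  (∀ i → X i ≈ X (suc i) ⊕ S i) → (∀ i → Pos (S i)) → ∀ i → Pos (X i)
Pos-telescope X S lead rec posS = Pos-descend X lead λ n i p _ k k≤n →
  subst (0ℤ ℤ.≤_) (sym (rec i ‼ k)) (ℤ.+-mono-≤ (p k k≤n) ((posS i ≥0) k))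

-- `S` is the amount by which a candidate `X` exceeds the recurrence of `G`. The decomposition of
-- `X i` starts the induction: up to q^i only the nonnegative series Z contributes.
Pos-family : ∀ (X S : ℕ → Series) →
  (∀ i → ∃[ Z ] ∃[ Z′ ] Pos Z × X i ≈ Z ⊕ q ^ suc i ⊛ Z′) →
  (∀ i → X i ≈ X (suc i) ⊕ q ^ suc i ⊛ X (suc (suc i)) ⊕ S i) → (∀ i → Pos (S i)) → ∀ i → Pos (X i)
Pos-family X S lead rec posS = Pos-descend X lead λ n i p p′ k k≤n →
  subst (0ℤ ℤ.≤_) (sym (rec i ‼ k))
    (ℤ.+-mono-≤ (ℤ.+-mono-≤ (p k k≤n) (Pos[]-shift n (suc i) (X (suc (suc i))) p′ k k≤n)) ((posS i ≥0) k))

≈[]⇒≈ : ∀ {f g} → (∀ n → f ≈[ n ] g) → f ≈ g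
≈[]⇒≈ e = ext λ n → (e n ‼[]) n ℕ.≤-refl

-- c · h ∔ hs stands for c times the equation h plus hs; a goal is proved by exhibiting it as such
-- a combination.
infixr 4 _·_∔_

data Hypotheses : Set where
  none  : Hypotheses
  _·_∔_ : ∀ (c : Series) {A B} → A ≈ B → Hypotheses → Hypotheses

combination : Hypotheses → Series
combination none                 = ⟪ 0ℤ ⟫
combination (_·_∔_ c {A} {B} _ hs) = c ⊛ (A ⊖ B) ⊕ combination hs

private
  combination-zero : ∀ hs → combination hs ≈ ⟪ 0ℤ ⟫
  combination-zero none = ≈-refl
  combination-zero (_·_∔_ c {A} {B} h hs) =
    ≈-trans (+-cong (*-congˡ {c} (+-congʳ {⊝ B} h)) (combination-zero hs))
      (solve 2 (λ c B → c :* (B :- B) :+ con 0ℤ := con 0ℤ) refl c B)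

by-combination : ∀ hs {C D} → C ⊖ D ≈ combination hs → C ≈ D
by-combination hs {C} {D} e = ≈-trans (solve 2 (λ C D → C := (C :- D) :+ D) refl C D)
  (≈-trans (+-congʳ {D} (≈-trans e (combination-zero hs))) (+-identityˡ D))

-- Partitions with gaps at least 2

-- The solution F of F i = F (i+1) + q^(i+1) F (i+2) + S i whose terms tend to the constant c.
module Family (c : ℤ) (S : ℕ → Series) (S-vanishes : ∀ i → S i ≈[ i ] ⟪ 0ℤ ⟫) where
  private
    approx : ℕ → ℕ → Series
    approx zero    i = ⟪ c ⟫
    approx (suc m) i = approx m (suc i) ⊕ q ^ suc i ⊛ approx m (suc (suc i)) ⊕ S i

    tail-vanishes : ∀ n i {f g} → n ℕ.≤ i → f ≈[ n ] ⟪ c ⟫ → f ⊕ q ^ suc i ⊛ g ⊕ S i ≈[ n ] ⟪ c ⟫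
    tail-vanishes n i {f} {g} n≤i e = ≈[]-trans n
      (⊕-cong[] n (⊕-cong[] n e (≈[]-mono n≤i (shift-vanishes i g))) (≈[]-mono n≤i (S-vanishes i)))
      (≈⇒≈[] n (solve 1 (λ c → c :+ con 0ℤ :+ con 0ℤ := c) refl ⟪ c ⟫))

    approx-lead : ∀ m i n → n ℕ.≤ i → approx m i ≈[ n ] ⟪ c ⟫
    approx-lead zero    i n _   = ≈[]-refl n
    approx-lead (suc m) i n n≤i = tail-vanishes n i n≤i (approx-lead m (suc i) n (ℕ.m≤n⇒m≤1+n n≤i))

    -- One more unfolding changes only the innermost constants. These sit at indices at least m + i,
    -- where the change is a multiple of q^(m+i+1).
    approx-agrees : ∀ m i → approx m i ≈[ m ℕ.+ i ] approx (suc m) i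
    approx-agrees zero    i = ≈[]-sym i (tail-vanishes i i ℕ.≤-refl (≈[]-refl i))
    approx-agrees (suc m) i =
      ⊕-cong[] (suc m ℕ.+ i)
        (⊕-cong[] (suc m ℕ.+ i)
          (subst (λ n → approx m (suc i) ≈[ n ] approx (suc m) (suc i)) (ℕ.+-suc m i) (approx-agrees m (suc i)))
          (≈[]-mono bound (shift-agrees (suc i) (m ℕ.+ suc (suc i)) (approx-agrees m (suc (suc i))))))
        (≈[]-refl (suc m ℕ.+ i))
      where
      bound : suc m ℕ.+ i ℕ.≤ suc i ℕ.+ (m ℕ.+ suc (suc i))
      bound = ℕ.s≤s (ℕ.≤-trans (ℕ.≤-reflexive (ℕ.+-comm m i)) (ℕ.+-monoʳ-≤ i (ℕ.m≤m+n m (suc (suc i)))))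

    agrees : ∀ i n → approx n i ≈[ n ] limit (λ m → approx m i)
    agrees i = limit-agrees (λ m → approx m i) (λ m → ≈[]-mono (ℕ.m≤m+n m i) (approx-agrees m i))

  F : ℕ → Series
  F i = limit (λ m → approx m i)

  F-rec : ∀ i → F i ≈ F (suc i) ⊕ q ^ suc i ⊛ F (suc (suc i)) ⊕ S i
  F-rec i = ≈[]⇒≈ λ n → ≈[]-trans n (≈[]-sym n (≈[]-mono (ℕ.n≤1+n n) (agrees i (suc n))))
    (⊕-cong[] n (⊕-cong[] n (agrees (suc i) n) (⊛-cong[] n (≈[]-refl n) (agrees (suc (suc i)) n))) (≈[]-refl n))

  F-lead : ∀ i n → n ℕ.≤ i → F i ≈[ n ] ⟪ c ⟫
  F-lead i n n≤i = ≈[]-trans n (≈[]-sym n (agrees i n)) (approx-lead n i n n≤i)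

  F-factor : ∀ i → ∃[ H ] F i ≈ ⟪ c ⟫ ⊕ q ^ suc i ⊛ H
  F-factor i with vanishing-factor i (F i ⊖ ⟪ c ⟫)
    (≈[]-trans i (⊕-cong[] i (F-lead i i ℕ.≤-refl) (≈[]-refl i))
      (≈⇒≈[] i (solve 1 (λ c → c :- c := con 0ℤ) refl ⟪ c ⟫)))
  ... | H , e = H , by-combination (⟪ 1ℤ ⟫ · e ∔ none)
    (solve 3 (λ F c y → F :- (c :+ y) := con 1ℤ :* ((F :- c) :- y) :+ con 0ℤ) refl (F i) ⟪ c ⟫ (q ^ suc i ⊛ H))

-- G i counts the partitions with parts > i in which consecutive parts differ by at least 2,
-- L i the same partitions weighted by their number of parts.
private
  module 𝔾 = Family 1ℤ (λ _ → ⟪ 0ℤ ⟫) (λ i → ≈[]-refl i)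

G : ℕ → Series
G = 𝔾.F

private
  module 𝕃 = Family 0ℤ (λ i → q ^ suc i ⊛ G (suc (suc i))) (λ i → shift-vanishes i (G (suc (suc i))))

L : ℕ → Series
L = 𝕃.F

G-rec : ∀ i → G i ≈ G (suc i) ⊕ q ^ suc i ⊛ G (suc (suc i))
G-rec i = ≈-trans (𝔾.F-rec i) (+-identityʳ _)

L-rec : ∀ i → L i ≈ L (suc i) ⊕ q ^ suc i ⊛ L (suc (suc i)) ⊕ q ^ suc i ⊛ G (suc (suc i))
L-rec = 𝕃.F-rec

G-lead : ∀ i n → n ℕ.≤ i → G i ≈[ n ] ⟪ 1ℤ ⟫
G-lead = 𝔾.F-lead

L-lead : ∀ i n → n ℕ.≤ i → L i ≈[ n ] ⟪ 0ℤ ⟫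
L-lead = 𝕃.F-lead

G-factor : ∀ i → ∃[ H ] G i ≈ ⟪ 1ℤ ⟫ ⊕ q ^ suc i ⊛ H
G-factor = 𝔾.F-factor

L-factor : ∀ i → ∃[ H ] L i ≈ ⟪ 0ℤ ⟫ ⊕ q ^ suc i ⊛ H
L-factor = 𝕃.F-factor

Pos-x : ∀ i → Pos (q ^ i)
Pos-x = Pos-^ Pos-q

Pos-G : ∀ i → Pos (G i)
Pos-G = Pos-family G (λ _ → ⟪ 0ℤ ⟫) (λ i → _ , _ , Pos-const 1 , proj₂ (G-factor i)) 𝔾.F-rec (λ _ → Pos-const 0)

Pos-L : ∀ i → Pos (L i)
Pos-L = Pos-family L _ (λ i → _ , _ , Pos-const 0 , proj₂ (L-factor i)) L-rec
  (λ i → Pos-⊛ (Pos-x (suc i)) (Pos-G (suc (suc i))))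

one : Series
one = ⟪ 1ℤ ⟫

-- Counts the partitions of at least two parts whose two largest parts differ by exactly 2;
-- all others arise by adding 1 to the largest part.

gap : ℕ → Series
gap i = (one ⊖ q) ⊛ (G i ⊖ one) ⊖ q ^ suc i

-- Adjoining the part i + 1 to a partition counted by `gap (i+2)` keeps its two largest parts. The
-- source is the one partition not obtained so, with the parts i + 3 and i + 1. At i = 0 the result
-- says that the coefficients of `G 0` do not decrease.
Pos-gap : ∀ i → Pos (gap i)
Pos-gap = Pos-family gap (λ i → q ^ suc i ⊛ q ^ suc (suc (suc i))) lead rec
  (λ i → Pos-⊛ (Pos-x (suc i)) (Pos-x (suc (suc (suc i)))))
  where
  lead : ∀ i → ∃[ Z ] ∃[ Z′ ] Pos Z × gap i ≈ Z ⊕ q ^ suc i ⊛ Z′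
  lead i = let H , e = G-factor i in ⟪ 0ℤ ⟫ , (one ⊖ q) ⊛ H ⊖ one , Pos-const 0 , by-combination (one ⊖ q · e ∔ none)
    (solve 4 (λ q x G H → (con 1ℤ :- q) :* (G :- con 1ℤ) :- q :* x :- (con 0ℤ :+ q :* x :* ((con 1ℤ :- q) :* H :- con 1ℤ))
                       := (con 1ℤ :- q) :* (G :- (con 1ℤ :+ q :* x :* H)) :+ con 0ℤ)
      refl q (q ^ i) (G i) H)
  rec : ∀ i → gap i ≈ gap (suc i) ⊕ q ^ suc i ⊛ gap (suc (suc i)) ⊕ q ^ suc i ⊛ q ^ suc (suc (suc i))
  rec i = by-combination (one ⊖ q · G-rec i ∔ none)
    (solve 5 (λ q x g g₁ g₂ → let Y = λ x g → (con 1ℤ :- q) :* (g :- con 1ℤ) :- q :* x in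
         Y x g :- (Y (q :* x) g₁ :+ q :* x :* Y (q :* (q :* x)) g₂ :+ q :* x :* (q :* (q :* (q :* x))))
      := (con 1ℤ :- q) :* (g :- (g₁ :+ q :* x :* g₂)) :+ con 0ℤ)
      refl q (q ^ i) (G i) (G (suc i)) (G (suc (suc i))))

s₁ s₂ : Series
s₁ = geo 0
s₂ = geo 1

s₁-rec : s₁ ≈ one ⊕ q ⊛ s₁
s₁-rec = ≈-trans (geo-rec 0) (solve 2 (λ q s → con 1ℤ :+ q :* con 1ℤ :* s := con 1ℤ :+ q :* s) refl q s₁)

s₂-rec : s₂ ≈ one ⊕ q ⊛ q ⊛ s₂
s₂-rec = ≈-trans (geo-rec 1) (solve 2 (λ q s → con 1ℤ :+ q :* (q :* con 1ℤ) :* s := con 1ℤ :+ q :* q :* s) refl q s₂)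

-- The terms j = 1, 2 of m = Σ_j (1 − q^m) ⋯ (1 − q^(m−j+1)) / (1 − q^j).
excess : ℕ → Series
excess i = L i ⊖ q ^ suc i ⊛ (s₁ ⊛ G (2 ℕ.+ i)) ⊖ q ^ (2 ℕ.+ i) ⊛ q ^ (2 ℕ.+ i) ⊛ (s₂ ⊛ G (4 ℕ.+ i))

-- The weight 1 - q^m on partitions with m parts turns `G i` into q^(i+1) `G (i+2)`, because it
-- cancels the last factor of the denominator. Applied twice this gives the two subtracted series;
-- applied three times it gives the source, the numerator of the first omitted term j = 3.
Pos-excess : ∀ i → Pos (excess i)
Pos-excess = Pos-family excess (λ i → q ^ (3 ℕ.+ i) ⊛ q ^ (3 ℕ.+ i) ⊛ q ^ (3 ℕ.+ i) ⊛ G (6 ℕ.+ i)) lead rec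
  (λ i → Pos-⊛ (Pos-⊛ (Pos-⊛ (Pos-x (3 ℕ.+ i)) (Pos-x (3 ℕ.+ i))) (Pos-x (3 ℕ.+ i))) (Pos-G (6 ℕ.+ i)))
  where
  lead : ∀ i → ∃[ Z ] ∃[ Z′ ] Pos Z × excess i ≈ Z ⊕ q ^ suc i ⊛ Z′
  lead i = let M , e = L-factor i in ⟪ 0ℤ ⟫ , M ⊖ s₁ ⊛ G (2 ℕ.+ i) ⊖ q ⊛ q ^ (2 ℕ.+ i) ⊛ (s₂ ⊛ G (4 ℕ.+ i)) , Pos-const 0 ,
    by-combination (one · e ∔ none)
      (solve 6 (λ q x l M s t → l :- q :* x :* s :- q :* (q :* x) :* (q :* (q :* x)) :* t
                                :- (con 0ℤ :+ q :* x :* (M :- s :- q :* (q :* (q :* x)) :* t))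
                         := con 1ℤ :* (l :- (con 0ℤ :+ q :* x :* M)) :+ con 0ℤ)
        refl q (q ^ i) (L i) M (s₁ ⊛ G (2 ℕ.+ i)) (s₂ ⊛ G (4 ℕ.+ i)))
  rec : ∀ i → excess i ≈ excess (suc i) ⊕ q ^ suc i ⊛ excess (suc (suc i))
                       ⊕ q ^ (3 ℕ.+ i) ⊛ q ^ (3 ℕ.+ i) ⊛ q ^ (3 ℕ.+ i) ⊛ G (6 ℕ.+ i)
  rec i = by-combination
      ( one · L-rec i
      ∔ q ⊛ x ⊖ q ⊛ x ⊛ s₁ · G-rec (2 ℕ.+ i)
      ∔ ⊝ (q ⊛ x ⊛ G (3 ℕ.+ i)) · s₁-rec
      ∔ y ⊖ y ⊛ s₂ · G-rec (4 ℕ.+ i)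
      ∔ ⊝ (y ⊛ G (5 ℕ.+ i)) · s₂-rec
      ∔ none)
    (solve 12 (λ q x s₁ s₂ l₀ l₁ l₂ g₂ g₃ g₄ g₅ g₆ →
        let X = λ x l g h → l :- q :* x :* (s₁ :* g) :- q :* (q :* x) :* (q :* (q :* x)) :* (s₂ :* h)
            z = q :* (q :* (q :* x))
            y = q :* (q :* x) :* (q :* (q :* x)) in
        X x l₀ g₂ g₄ :- (X (q :* x) l₁ g₃ g₅ :+ q :* x :* X (q :* (q :* x)) l₂ g₄ g₆ :+ z :* z :* z :* g₆)
      := con 1ℤ :* (l₀ :- (l₁ :+ q :* x :* l₂ :+ q :* x :* g₂))
         :+ ((q :* x :- q :* x :* s₁) :* (g₂ :- (g₃ :+ z :* g₄))
         :+ (:- (q :* x :* g₃) :* (s₁ :- (con 1ℤ :+ q :* s₁))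
         :+ ((y :- y :* s₂) :* (g₄ :- (g₅ :+ q :* (q :* z) :* g₆))
         :+ (:- (y :* g₅) :* (s₂ :- (con 1ℤ :+ q :* q :* s₂))
         :+ con 0ℤ)))))
      refl q x s₁ s₂ (L i) (L (suc i)) (L (2 ℕ.+ i)) (G (2 ℕ.+ i)) (G (3 ℕ.+ i)) (G (4 ℕ.+ i)) (G (5 ℕ.+ i)) (G (6 ℕ.+ i)))
    where
    x = q ^ i
    y = q ^ (2 ℕ.+ i) ⊛ q ^ (2 ℕ.+ i)

two : Series
two = ⟪ + 2 ⟫

-- From 2 m (1 − q) ≤ u⁻¹ − u with u = q^m for m parts: the sum of u⁻¹ would be G (i − 1),
-- which is G i + q^i G (i + 1).
slack : ℕ → Series
slack i = s₁ ⊛ (G i ⊖ (one ⊖ q ^ i) ⊛ G (suc i)) ⊕ two ⊛ (G i ⊖ one) ⊖ q ^ suc i ⊖ two ⊛ L i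

-- The sum of u is `G (i+1)`, so that of u⁻¹ - u is `G i` - (1 - q^i) `G (i+1)`. The remaining terms
-- of `slack` are an allowance of the order of `G i`, with which the source becomes a sum of visibly
-- nonnegative series.
Pos-slack : ∀ i → Pos (slack i)
Pos-slack = Pos-family slack S lead rec posS
  where
  S : ℕ → Series
  S i = x ⊛ gap (2 ℕ.+ i) ⊕ x ⊕ q ⊛ y ⊛ x ⊕ y ⊛ x ⊛ (one ⊕ q) ⊛ gap (4 ℕ.+ i) ⊕ y ⊛ x
        ⊕ y ⊛ x ⊛ (one ⊕ q) ⊛ q ^ (5 ℕ.+ i) ⊕ y ⊛ x ⊛ q ^ (4 ℕ.+ i) ⊛ G (5 ℕ.+ i) ⊕ y
    where
    x = q ^ i
    y = q ^ (2 ℕ.+ i)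
  posS : ∀ i → Pos (S i)
  posS i = Pos-⊕ (Pos-⊕ (Pos-⊕ (Pos-⊕ (Pos-⊕ (Pos-⊕ (Pos-⊕ (Pos-⊛ px (Pos-gap (2 ℕ.+ i))) px)
      (Pos-⊛ (Pos-⊛ Pos-q py) px)) (Pos-⊛ pxy (Pos-gap (4 ℕ.+ i)))) (Pos-⊛ py px))
      (Pos-⊛ pxy (Pos-x (5 ℕ.+ i)))) (Pos-⊛ (Pos-⊛ (Pos-⊛ py px) (Pos-x (4 ℕ.+ i))) (Pos-G (5 ℕ.+ i)))) py
    where
    px = Pos-x i
    py = Pos-x (2 ℕ.+ i)
    pxy = Pos-⊛ (Pos-⊛ py px) (Pos-⊕ (Pos-const 1) Pos-q)
  lead : ∀ i → ∃[ Z ] ∃[ Z′ ] Pos Z × slack i ≈ Z ⊕ q ^ suc i ⊛ Z′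
  lead i = let H₀ , e₀ = G-factor i; H₁ , e₁ = G-factor (suc i); M , e = L-factor i; x = q ^ i in
    -- The constant terms of `G i` and `G (suc i)` contribute 1 - (1 - q^i) = q^i. This has degree i
    -- only, so it cannot go into the multiple of q^(i+1) and forms the nonnegative part.
    s₁ ⊛ x , s₁ ⊛ (H₀ ⊖ q ⊛ (one ⊖ x) ⊛ H₁) ⊕ two ⊛ H₀ ⊖ one ⊖ two ⊛ M , Pos-⊛ (Pos-geo 0) (Pos-x i) ,
    by-combination (s₁ ⊕ two · e₀ ∔ ⊝ (s₁ ⊛ (one ⊖ x)) · e₁ ∔ ⊝ two · e ∔ none)
      (solve 9 (λ q x s g h l H₀ H₁ M →
          let one = con 1ℤ; two = con (+ 2) in
          s :* (g :- (one :- x) :* h) :+ two :* (g :- one) :- q :* x :- two :* l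
            :- (s :* x :+ q :* x :* (s :* (H₀ :- q :* (one :- x) :* H₁) :+ two :* H₀ :- one :- two :* M))
        := (s :+ two) :* (g :- (one :+ q :* x :* H₀)) :+ (:- (s :* (one :- x)) :* (h :- (one :+ q :* (q :* x) :* H₁))
           :+ (:- two :* (l :- (con 0ℤ :+ q :* x :* M)) :+ con 0ℤ)))
        refl q x s₁ (G i) (G (suc i)) (L i) H₀ H₁ M)
  rec : ∀ i → slack i ≈ slack (suc i) ⊕ q ^ suc i ⊛ slack (suc (suc i)) ⊕ S i
  rec i = by-combination
      ( ⊝ two · L-rec i
      ∔ s₁ ⊕ two · G-rec i
      ∔ s₁ ⊛ (q ⊛ x ⊖ one) ⊕ x · G-rec (1 ℕ.+ i)
      ∔ ⊝ (q ⊛ x) · G-rec (2 ℕ.+ i)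
      ∔ q ⊛ q ⊛ x ⊛ x · G-rec (3 ℕ.+ i)
      ∔ x ⊛ G (1 ℕ.+ i) ⊕ q ⊛ x ⊛ G (3 ℕ.+ i) · s₁-rec
      ∔ none)
    (solve 12 (λ q x s l₀ l₁ l₂ g₀ g₁ g₂ g₃ g₄ g₅ →
        let one = con 1ℤ; two = con (+ 2)
            X = λ x l g h → s :* (g :- (one :- x) :* h) :+ two :* (g :- one) :- q :* x :- two :* l
            Y = λ x g → (one :- q) :* (g :- one) :- q :* x
            y = q :* (q :* x); z = q :* (q :* y) in
        X x l₀ g₀ g₁ :- (X (q :* x) l₁ g₁ g₂ :+ q :* x :* X y l₂ g₂ g₃
          :+ (x :* Y y g₂ :+ x :+ q :* y :* x :+ y :* x :* (one :+ q) :* Y z g₄ :+ y :* x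
              :+ y :* x :* (one :+ q) :* (q :* z) :+ y :* x :* z :* g₅ :+ y))
      := :- two :* (l₀ :- (l₁ :+ q :* x :* l₂ :+ q :* x :* g₂))
         :+ ((s :+ two) :* (g₀ :- (g₁ :+ q :* x :* g₂))
         :+ ((s :* (q :* x :- one) :+ x) :* (g₁ :- (g₂ :+ y :* g₃))
         :+ (:- (q :* x) :* (g₂ :- (g₃ :+ q :* y :* g₄))
         :+ (q :* q :* x :* x :* (g₃ :- (g₄ :+ z :* g₅))
         :+ ((x :* g₁ :+ q :* x :* g₃) :* (s :- (one :+ q :* s))
         :+ con 0ℤ))))))
      refl q x s₁ (L i) (L (1 ℕ.+ i)) (L (2 ℕ.+ i)) (G i) (G (1 ℕ.+ i)) (G (2 ℕ.+ i)) (G (3 ℕ.+ i)) (G (4 ℕ.+ i)) (G (5 ℕ.+ i)))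
    where
    x = q ^ i

-- The number of parts is large on average

-- General in the exponents, so as to give 1 / ((1 - q) ⋯ (1 - q^j)) as `a` and the same with q^5
-- for q as `aQ`.
recip : (ℕ → ℕ) → ℕ → Series
recip d zero    = one
recip d (suc j) = recip d j ⊛ geo (d j)

Pos-recip : ∀ d j → Pos (recip d j)
Pos-recip d zero    = Pos-const 1
Pos-recip d (suc j) = Pos-⊛ (Pos-recip d j) (Pos-geo (d j))

recip-rec : ∀ d j → recip d (suc j) ≈ recip d j ⊕ q ^ suc (d j) ⊛ recip d (suc j)
recip-rec d j = by-combination (recip d j · geo-rec (d j) ∔ none)
  (solve 3 (λ a x g → a :* g :- (a :+ x :* (a :* g)) := a :* (g :- (con 1ℤ :+ x :* g)) :+ con 0ℤ)
    refl (recip d j) (q ^ suc (d j)) (geo (d j)))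

a : ℕ → Series
a = recip (λ j → j)

deg : ℕ → ℕ → ℕ
deg zero    i = 0
deg (suc j) i = suc i ℕ.+ deg j (2 ℕ.+ i)

deg-suc : ∀ j i → deg j (suc i) ≡ j ℕ.+ deg j i
deg-suc zero    i = refl
deg-suc (suc j) i = cong suc (begin
  suc i ℕ.+ deg j (3 ℕ.+ i)         ≡⟨ cong (suc i ℕ.+_) (deg-suc j (2 ℕ.+ i)) ⟩
  suc i ℕ.+ (j ℕ.+ deg j (2 ℕ.+ i)) ≡⟨ ℕ.+-assoc (suc i) j _ ⟨
  suc i ℕ.+ j ℕ.+ deg j (2 ℕ.+ i)   ≡⟨ cong (ℕ._+ deg j (2 ℕ.+ i)) (ℕ.+-comm (suc i) j) ⟩
  j ℕ.+ suc i ℕ.+ deg j (2 ℕ.+ i)   ≡⟨ ℕ.+-assoc j (suc i) _ ⟩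
  j ℕ.+ deg (suc j) i               ∎)
  where open ≡-Reasoning

-- term j i = q^(j² + ij) / ((1 − q) ⋯ (1 − q^j)) is the part of G i with exactly j parts.
term : ℕ → ℕ → Series
term j i = q ^ deg j i ⊛ a j

term-step : ∀ j i → term (suc j) i ≈ q ^ suc i ⊛ (q ^ deg j (2 ℕ.+ i) ⊛ a (suc j))
term-step j i = ≈-trans (*-congʳ {a (suc j)} (^-homo-* q (suc i) (deg j (2 ℕ.+ i))))
  (*-assoc (q ^ suc i) (q ^ deg j (2 ℕ.+ i)) (a (suc j)))

term-rec : ∀ j i → term (suc j) i ≈ term (suc j) (suc i) ⊕ q ^ suc i ⊛ term j (2 ℕ.+ i)
term-rec j i = by-combination
    ( one · term-step j i
    ∔ w · recip-rec (λ j → j) j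
    ∔ ⊝ a (suc j) · ≈-trans (≈-reflexive (cong (q ^_) (deg-suc (suc j) i)))
        (≈-trans (^-homo-* q (suc j) (deg (suc j) i)) (*-congˡ {q ^ suc j} (^-homo-* q (suc i) (deg j (2 ℕ.+ i)))))
    ∔ none)
  (solve 7 (λ x u v t′ p b c →
      t′ :- (v :* c :+ x :* (u :* b))
    := con 1ℤ :* (t′ :- x :* (u :* c)) :+ (x :* u :* (c :- (b :+ p :* c))
       :+ (:- c :* (v :- p :* (x :* u)) :+ con 0ℤ)))
    refl (q ^ suc i) (q ^ deg j (2 ℕ.+ i)) (q ^ deg (suc j) (suc i)) (term (suc j) i) (q ^ suc j) (a j) (a (suc j)))
  where
  w = q ^ suc i ⊛ q ^ deg j (2 ℕ.+ i)

Pos-G⊖term : ∀ j i → Pos (G i ⊖ term j i)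
Pos-G⊖term zero = Pos-telescope (λ i → G i ⊖ term 0 i) (λ i → q ^ suc i ⊛ G (2 ℕ.+ i))
  (λ i → let H , e = G-factor i in ⟪ 0ℤ ⟫ , H , Pos-const 0 , by-combination (one · e ∔ none)
    (solve 3 (λ g x h → g :- con 1ℤ :* con 1ℤ :- (con 0ℤ :+ x :* h) := con 1ℤ :* (g :- (con 1ℤ :+ x :* h)) :+ con 0ℤ)
      refl (G i) (q ^ suc i) H))
  (λ i → by-combination (one · G-rec i ∔ none)
    (solve 4 (λ g g₁ x g₂ → g :- con 1ℤ :* con 1ℤ :- (g₁ :- con 1ℤ :* con 1ℤ :+ x :* g₂)
                         := con 1ℤ :* (g :- (g₁ :+ x :* g₂)) :+ con 0ℤ)
      refl (G i) (G (suc i)) (q ^ suc i) (G (2 ℕ.+ i))))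
  (λ i → Pos-⊛ (Pos-x (suc i)) (Pos-G (2 ℕ.+ i)))
Pos-G⊖term (suc j) = Pos-telescope (λ i → G i ⊖ term (suc j) i) (λ i → q ^ suc i ⊛ (G (2 ℕ.+ i) ⊖ term j (2 ℕ.+ i)))
  (λ i → let H , e = G-factor i in one , H ⊖ q ^ deg j (2 ℕ.+ i) ⊛ a (suc j) , Pos-const 1 ,
    by-combination (one · e ∔ ⊝ one · term-step j i ∔ none)
    (solve 5 (λ g x h t u → g :- t :- (con 1ℤ :+ x :* (h :- u))
        := con 1ℤ :* (g :- (con 1ℤ :+ x :* h)) :+ (:- con 1ℤ :* (t :- x :* u) :+ con 0ℤ))
      refl (G i) (q ^ suc i) H (term (suc j) i) (q ^ deg j (2 ℕ.+ i) ⊛ a (suc j))))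
  (λ i → by-combination (one · G-rec i ∔ ⊝ one · term-rec j i ∔ none)
    (solve 7 (λ g g₁ x g₂ t t₁ t₂ → g :- t :- (g₁ :- t₁ :+ x :* (g₂ :- t₂))
        := con 1ℤ :* (g :- (g₁ :+ x :* g₂)) :+ (:- con 1ℤ :* (t :- (t₁ :+ x :* t₂)) :+ con 0ℤ))
      refl (G i) (G (suc i)) (q ^ suc i) (G (2 ℕ.+ i)) (term (suc j) i) (term (suc j) (suc i)) (term j (2 ℕ.+ i))))
  (λ i → Pos-⊛ (Pos-x (suc i)) (Pos-G⊖term j (2 ℕ.+ i)))

terms-below : ℕ → ℕ → Series
terms-below zero    i = ⟪ 0ℤ ⟫
terms-below (suc C) i = terms-below C i ⊕ term C i

terms-below-rec : ∀ C i → terms-below (suc C) i ≈ terms-below (suc C) (suc i) ⊕ q ^ suc i ⊛ terms-below C (2 ℕ.+ i)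
terms-below-rec zero    i = solve 1 (λ x → con 0ℤ :+ con 1ℤ :* con 1ℤ := con 0ℤ :+ con 1ℤ :* con 1ℤ :+ x :* con 0ℤ) refl (q ^ suc i)
terms-below-rec (suc C) i = by-combination (one · terms-below-rec C i ∔ one · term-rec C i ∔ none)
  (solve 7 (λ s s₁ s₂ x t t₁ t₂ → s :+ t :- (s₁ :+ t₁ :+ x :* (s₂ :+ t₂))
      := con 1ℤ :* (s :- (s₁ :+ x :* s₂)) :+ (con 1ℤ :* (t :- (t₁ :+ x :* t₂)) :+ con 0ℤ))
    refl (terms-below (suc C) i) (terms-below (suc C) (suc i)) (terms-below C (2 ℕ.+ i)) (q ^ suc i)
    (term (suc C) i) (term (suc C) (suc i)) (term C (2 ℕ.+ i)))

terms-below-factor : ∀ C i → ∃[ R ] terms-below (suc C) i ≈ one ⊕ q ^ suc i ⊛ R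
terms-below-factor zero    i = ⟪ 0ℤ ⟫ , solve 1 (λ x → con 0ℤ :+ con 1ℤ :* con 1ℤ := con 1ℤ :+ x :* con 0ℤ) refl (q ^ suc i)
terms-below-factor (suc C) i = let R , e = terms-below-factor C i; u = q ^ deg C (2 ℕ.+ i) ⊛ a (suc C) in
  R ⊕ u , by-combination (one · e ∔ one · term-step C i ∔ none)
    (solve 5 (λ s x r t u → s :+ t :- (con 1ℤ :+ x :* (r :+ u))
        := con 1ℤ :* (s :- (con 1ℤ :+ x :* r)) :+ (con 1ℤ :* (t :- x :* u) :+ con 0ℤ))
      refl (terms-below (suc C) i) (q ^ suc i) R (term (suc C) i) u)

-- C ≤ j + K [j < C] for every number j of parts, if C ≤ K.
few-parts : ∀ C d i → Pos (L i ⊕ ⟪ + (C ℕ.+ d) ⟫ ⊛ terms-below C i ⊖ ⟪ + C ⟫ ⊛ G i)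
few-parts C d = subst (λ K → ∀ i → Pos (X K C i)) refl (go C d refl)
  where
  X : ℕ → ℕ → ℕ → Series
  X K C i = L i ⊕ ⟪ + K ⟫ ⊛ terms-below C i ⊖ ⟪ + C ⟫ ⊛ G i
  const-+ : ∀ m n → ⟪ + (m ℕ.+ n) ⟫ ≈ ⟪ + m ⟫ ⊕ ⟪ + n ⟫
  const-+ m n = ext λ { zero → refl ; (suc _) → refl }
  go : ∀ C d {K} → K ≡ C ℕ.+ d → ∀ i → Pos (X K C i)
  go zero    d {K} e i = Pos-resp (solve 3 (λ l k g → l := l :+ k :* con 0ℤ :- con 0ℤ :* g) refl (L i) ⟪ + K ⟫ (G i)) (Pos-L i)
  go (suc C) d {K} e = Pos-telescope (X K (suc C)) (λ i → q ^ suc i ⊛ X K C (2 ℕ.+ i))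
    (λ i → let H , eH = G-factor i; M , eM = L-factor i; R , eR = terms-below-factor C i in
      ⟪ + d ⟫ , M ⊕ ⟪ + K ⟫ ⊛ R ⊖ ⟪ + suc C ⟫ ⊛ H , Pos-const d ,
      by-combination (one · eM ∔ ⟪ + K ⟫ · eR ∔ ⊝ ⟪ + suc C ⟫ · eH ∔
          one · ≈-trans (≈-reflexive (cong (λ K → ⟪ + K ⟫) e)) (const-+ (suc C) d) ∔ none)
        (solve 10 (λ l k s c g d x M R H → l :+ k :* s :- c :* g :- (d :+ x :* (M :+ k :* R :- c :* H))
            := con 1ℤ :* (l :- (con 0ℤ :+ x :* M)) :+ (k :* (s :- (con 1ℤ :+ x :* R))
               :+ (:- c :* (g :- (con 1ℤ :+ x :* H)) :+ (con 1ℤ :* (k :- (c :+ d)) :+ con 0ℤ))))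
          refl (L i) ⟪ + K ⟫ (terms-below (suc C) i) ⟪ + suc C ⟫ (G i) ⟪ + d ⟫ (q ^ suc i) M R H))
    (λ i → by-combination (one · L-rec i ∔ ⟪ + K ⟫ · terms-below-rec C i ∔ ⊝ ⟪ + suc C ⟫ · G-rec i
          ∔ ⊝ (q ^ suc i ⊛ G (2 ℕ.+ i)) · const-+ 1 C ∔ none)
        (solve 13 (λ x k c c′ l l₁ l₂ s s₁ s₂ g g₁ g₂ →
            l :+ k :* s :- c :* g :- (l₁ :+ k :* s₁ :- c :* g₁ :+ x :* (l₂ :+ k :* s₂ :- c′ :* g₂))
          := con 1ℤ :* (l :- (l₁ :+ x :* l₂ :+ x :* g₂)) :+ (k :* (s :- (s₁ :+ x :* s₂))
             :+ (:- c :* (g :- (g₁ :+ x :* g₂)) :+ (:- (x :* g₂) :* (c :- (con 1ℤ :+ c′)) :+ con 0ℤ))))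
          refl (q ^ suc i) ⟪ + K ⟫ ⟪ + suc C ⟫ ⟪ + C ⟫ (L i) (L (suc i)) (L (2 ℕ.+ i))
          (terms-below (suc C) i) (terms-below (suc C) (suc i)) (terms-below C (2 ℕ.+ i)) (G i) (G (suc i)) (G (2 ℕ.+ i))))
    -- Without the smallest part the target falls to C while K stays, so the surplus of K over the
    -- target grows by one.
    (λ i → Pos-⊛ (Pos-x (suc i)) (go C (suc d) (trans e (sym (ℕ.+-suc C d))) (2 ℕ.+ i)))

-- Growth of the coefficients of 1 / ((1 - q) ⋯ (1 - q^j))

Mono : Series → Set
Mono f = ∀ {m n} → m ℕ.≤ n → at f m ℤ.≤ at f n

≤-by : ∀ {x y z} → 0ℤ ℤ.≤ z → y ℤ.- x ≡ z → x ℤ.≤ y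
≤-by {x} {y} p e = ℤ.0≤i-j⇒j≤i (subst (0ℤ ℤ.≤_) (sym e) p)

Mono-step : ∀ {f} → (∀ n → at f n ℤ.≤ at f (suc n)) → Mono f
Mono-step {f} step {m} {n} m≤n = subst (λ n → at f m ℤ.≤ at f n) (ℕ.m+[n∸m]≡n m≤n) (go (n ℕ.∸ m))
  where
  go : ∀ d → at f m ℤ.≤ at f (m ℕ.+ d)
  go zero    = ℤ.≤-reflexive (cong (at f) (sym (ℕ.+-identityʳ m)))
  go (suc d) = ℤ.≤-trans (go d) (subst (λ n → at f (m ℕ.+ d) ℤ.≤ at f n) (sym (ℕ.+-suc m d)) (step (m ℕ.+ d)))

difference-Mono : ∀ {f} → Pos ((one ⊖ q) ⊛ f) → Mono f
difference-Mono {f} p = Mono-step {f} λ n → ≤-by ((p ≥0) (suc n)) (sym (trans (e ‼ suc n)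
    (cong (λ z → at f (suc n) ℤ.+ ℤ.- z) (q^⊛-+ 1 f n))))
  where
  e : (one ⊖ q) ⊛ f ≈ f ⊖ q ^ 1 ⊛ f
  e = solve 2 (λ q f → (con 1ℤ :- q) :* f := f :- q :* con 1ℤ :* f) refl q f

-- Multiplication by 1 - q cancels the first geometric factor, and the product of the others is
-- nonnegative.
Mono-a : ∀ j → Mono (a (suc j))
Mono-a j = difference-Mono (go j)
  where
  go : ∀ j → Pos ((one ⊖ q) ⊛ a (suc j))
  go zero    = Pos-resp (by-combination (⊝ one · s₁-rec ∔ none)
    (solve 2 (λ q s → con 1ℤ :- (con 1ℤ :- q) :* (con 1ℤ :* s) := :- con 1ℤ :* (s :- (con 1ℤ :+ q :* s)) :+ con 0ℤ) refl q s₁))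
    (Pos-const 1)
  go (suc j) = Pos-resp (*-assoc (one ⊖ q) (a (suc j)) (geo (suc j))) (Pos-⊛ (go j) (Pos-geo (suc j)))

private
  α : ℕ → ℕ → ℤ
  α j n = at (a j) n

  α≥0 : ∀ j n → 0ℤ ℤ.≤ α j n
  α≥0 j n = (Pos-recip (λ j → j) j ≥0) n

  α-rec : ∀ j n → α (suc j) (suc j ℕ.+ n) ≡ α j (suc j ℕ.+ n) ℤ.+ α (suc j) n
  α-rec j n = trans (recip-rec (λ j → j) j ‼ (suc j ℕ.+ n))
    (cong (λ z → α j (suc j ℕ.+ n) ℤ.+ z) (q^⊛-+ (suc j) (a (suc j)) n))

  +*-mono : ∀ k {x y} → x ℤ.≤ y → + k ℤ.* x ℤ.≤ + k ℤ.* y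
  +*-mono k = ℤ.*-monoˡ-≤-nonNeg (+ k)

-- The coefficients of `a j` grow like n^(j-1) for j ≥ 1. These two properties are what is used of
-- that growth, and they follow from `α-rec` and monotonicity by an alternating induction:
-- `Dominated j` gives `Slow (suc j)`, which gives `Dominated (suc j)`.
Dominated Slow : ℕ → Set
Dominated j = ∀ k c → ∃[ N ] (∀ n → N ℕ.≤ n → + k ℤ.* at (a j) (c ℕ.+ n) ℤ.≤ at (a (suc j)) n)
Slow j = ∀ c → ∃[ N ] (∀ n → N ℕ.≤ n → at (a j) (c ℕ.+ n) ℤ.≤ + 2 ℤ.* at (a j) n)

-- A step of length p = j + 1 increases a coefficient of `a p` by one of `a j`, which is eventually
-- at most a k-th of the starting value. So k steps at most double it, and k = c + 1 of them lead
-- beyond the shift c.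
dominated⇒slow : ∀ j → Dominated j → Slow (suc j)
dominated⇒slow j dom c = let k = suc c; N , bound = climb k k in N , λ n N≤n →
    ℤ.≤-trans (Mono-a j (ℕ.+-monoˡ-≤ n (c≤ c)))
      (ℤ.*-cancelˡ-≤-pos _ _ (+ k) (ℤ.≤-trans (bound n N≤n)
        (ℤ.≤-reflexive (ℤS.solve 2 (λ k x → (k ℤS.:+ k) ℤS.:* x ℤS.:= k ℤS.:* (ℤS.con (+ 2) ℤS.:* x)) refl (+ k) (α p n)))))
  where
  p = suc j
  c≤ : ∀ c → c ℕ.≤ suc c ℕ.* p
  c≤ c = ℕ.≤-trans (ℕ.n≤1+n c) (ℕ.m≤m*n (suc c) p)
  climb : ∀ k m → ∃[ N ] (∀ n → N ℕ.≤ n → + k ℤ.* α p (m ℕ.* p ℕ.+ n) ℤ.≤ (+ k ℤ.+ + m) ℤ.* α p n)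
  climb k zero    = 0 , λ n _ → ℤ.≤-reflexive (cong (ℤ._* α p n) (sym (ℤ.+-identityʳ (+ k))))
  climb k (suc m) = let N , dom′ = dom k (suc m ℕ.* p); N′ , ih = climb k m in
    N ℕ.⊔ N′ , λ n N≤n → ℤ.≤-trans (ℤ.≤-reflexive (trans
        (cong (λ z → + k ℤ.* z) (trans (cong (α p) (ℕ.+-assoc p (m ℕ.* p) n)) (trans (α-rec j (m ℕ.* p ℕ.+ n))
          (cong (λ i → α j i ℤ.+ α p (m ℕ.* p ℕ.+ n)) (sym (ℕ.+-assoc p (m ℕ.* p) n))))))
        (ℤ.*-distribˡ-+ (+ k) (α j (suc m ℕ.* p ℕ.+ n)) _)))
      (ℤ.≤-trans (ℤ.+-mono-≤ (dom′ n (ℕ.≤-trans (ℕ.m≤m⊔n N N′) N≤n)) (ih n (ℕ.≤-trans (ℕ.m≤n⊔m N N′) N≤n)))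
        (ℤ.≤-reflexive (ℤS.solve 3 (λ k m x → x ℤS.:+ (k ℤS.:+ m) ℤS.:* x ℤS.:= (k ℤS.:+ (ℤS.con 1ℤ ℤS.:+ m)) ℤS.:* x)
          refl (+ k) (+ m) (α p n))))

-- In M steps of length p = j + 2 a coefficient of `a p` gains M coefficients of `a (suc j)`, each
-- at least the one at the start. M = 2k pays for the multiple k and for the factor 2 that slowness
-- allows on the shift by c + M p.
slow⇒dominated : ∀ j → Slow (suc j) → Dominated (suc j)
slow⇒dominated j slow k c = let M = k ℕ.* 2; N , bound = slow (c ℕ.+ M ℕ.* p) in
    M ℕ.* p ℕ.+ N , λ n ≤n → split (M ℕ.* p) N n ≤n (λ n → + k ℤ.* α (suc j) (c ℕ.+ n) ℤ.≤ α p n) λ m N≤m →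
      ℤ.≤-trans (ℤ.≤-reflexive (cong (λ i → + k ℤ.* α (suc j) i) (sym (ℕ.+-assoc c (M ℕ.* p) m))))
      (ℤ.≤-trans (+*-mono k (bound m N≤m))
      (ℤ.≤-trans (ℤ.≤-reflexive (trans (sym (ℤ.*-assoc (+ k) (+ 2) (α (suc j) m))) (cong (ℤ._* α (suc j) m) (sym (ℤ.pos-* k 2)))))
        (climb m M)))
  where
  p = suc (suc j)
  split : ∀ s N n → s ℕ.+ N ℕ.≤ n → (P : ℕ → Set) → (∀ m → N ℕ.≤ m → P (s ℕ.+ m)) → P n
  split s N n ≤n P f = subst P (ℕ.m+[n∸m]≡n (ℕ.≤-trans (ℕ.m≤m+n s N) ≤n))
    (f (n ℕ.∸ s) (ℕ.≤-trans (ℕ.≤-reflexive (sym (ℕ.m+n∸m≡n s N))) (ℕ.∸-monoˡ-≤ s ≤n)))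
  climb : ∀ n m → + m ℤ.* α (suc j) n ℤ.≤ α p (m ℕ.* p ℕ.+ n)
  climb n zero    = α≥0 p n
  climb n (suc m) = ℤ.≤-trans (ℤ.≤-reflexive (ℤS.solve 2 (λ m x → (ℤS.con 1ℤ ℤS.:+ m) ℤS.:* x ℤS.:= x ℤS.:+ m ℤS.:* x) refl (+ m) (α (suc j) n)))
    (ℤ.≤-trans (ℤ.+-mono-≤ (Mono-a j (ℕ.≤-trans (ℕ.m≤n+m n (m ℕ.* p)) (ℕ.m≤n+m _ p))) (climb n m))
      (ℤ.≤-reflexive (sym (trans (cong (α p) (ℕ.+-assoc p (m ℕ.* p) n)) (α-rec (suc j) (m ℕ.* p ℕ.+ n))))))

dominated : ∀ j → Dominated j
dominated zero k c = 1 , λ n 1≤n → ℤ.≤-trans (ℤ.≤-reflexive (lemma n 1≤n)) (α≥0 1 n)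
  where
  lemma : ∀ n → 1 ℕ.≤ n → + k ℤ.* α 0 (c ℕ.+ n) ≡ 0ℤ
  lemma (suc n) _ = trans (cong (λ i → + k ℤ.* α 0 i) (ℕ.+-suc c n)) (ℤ.*-zeroʳ (+ k))
dominated (suc j) = slow⇒dominated j (dominated⇒slow j (dominated j))

deg-mono : ∀ j {i i′} → i ℕ.≤ i′ → deg j i ℕ.≤ deg (suc j) i′
deg-mono zero    _ = ℕ.z≤n
deg-mono (suc j) i≤i′ = ℕ.+-mono-≤ (ℕ.s≤s i≤i′) (deg-mono j (ℕ.+-monoʳ-≤ 2 i≤i′))

-- The comparison is with `term (suc j) 0`, which is itself a part of `G 0`; the shift c accounts
-- for the different leading powers of q.
term-negligible : ∀ k j → ∃[ N ] (∀ n → N ℕ.≤ n → + k ℤ.* at (term j 0) n ℤ.≤ at (G 0) n)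
term-negligible k j = let N , bound = dominated j k c in
    d′ ℕ.+ N , λ n ≤n → subst (λ n → + k ℤ.* at (term j 0) n ℤ.≤ at (G 0) n)
      (ℕ.m+[n∸m]≡n (ℕ.≤-trans (ℕ.m≤m+n d′ N) ≤n))
      (go (n ℕ.∸ d′) (bound (n ℕ.∸ d′) (ℕ.≤-trans (ℕ.≤-reflexive (sym (ℕ.m+n∸m≡n d′ N))) (ℕ.∸-monoˡ-≤ d′ ≤n))))
  where
  d = deg j 0
  d′ = deg (suc j) 0
  c = d′ ℕ.∸ d
  d′≡ : d ℕ.+ c ≡ d′
  d′≡ = ℕ.m+[n∸m]≡n (deg-mono j ℕ.≤-refl)
  go : ∀ m → + k ℤ.* α j (c ℕ.+ m) ℤ.≤ α (suc j) m → + k ℤ.* at (term j 0) (d′ ℕ.+ m) ℤ.≤ at (G 0) (d′ ℕ.+ m)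
  go m h = begin
    + k ℤ.* at (term j 0) (d′ ℕ.+ m) ≡⟨ cong (λ z → + k ℤ.* z) (trans
        (cong (at (term j 0)) (trans (cong (ℕ._+ m) (sym d′≡)) (ℕ.+-assoc d c m))) (q^⊛-+ d (a j) (c ℕ.+ m))) ⟩
    + k ℤ.* α j (c ℕ.+ m)            ≤⟨ h ⟩
    α (suc j) m                      ≡⟨ q^⊛-+ d′ (a (suc j)) m ⟨
    at (term (suc j) 0) (d′ ℕ.+ m)   ≤⟨ ℤ.0≤i-j⇒j≤i ((Pos-G⊖term (suc j) 0 ≥0) (d′ ℕ.+ m)) ⟩
    at (G 0) (d′ ℕ.+ m)              ∎
    where open ℤ.≤-Reasoning

terms-below-negligible : ∀ k C → ∃[ N ] (∀ n → N ℕ.≤ n → + k ℤ.* at (terms-below C 0) n ℤ.≤ + C ℤ.* at (G 0) n)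
terms-below-negligible k zero = 0 , λ n _ → ℤ.≤-reflexive (trans (cong (λ z → + k ℤ.* z) (at-0 n)) (ℤ.*-zeroʳ (+ k)))
terms-below-negligible k (suc C) = let N , h = terms-below-negligible k C; N′ , h′ = term-negligible k C in
  N ℕ.⊔ N′ , λ n N≤n → ℤ.≤-trans (ℤ.≤-reflexive (ℤ.*-distribˡ-+ (+ k) (at (terms-below C 0) n) (at (term C 0) n)))
    (ℤ.≤-trans (ℤ.+-mono-≤ (h n (ℕ.≤-trans (ℕ.m≤m⊔n N N′) N≤n)) (h′ n (ℕ.≤-trans (ℕ.m≤n⊔m N N′) N≤n)))
      (ℤ.≤-reflexive (ℤS.solve 2 (λ c x → c ℤS.:* x ℤS.:+ x ℤS.:= (ℤS.con 1ℤ ℤS.:+ c) ℤS.:* x) refl (+ C) (at (G 0) n))))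

-- With k = C + 1, `few-parts` gives L ≥ k G - k t, where t counts the partitions with fewer than k
-- parts. Eventually k² t ≤ k G, so the loss k t is at most one G.
many-parts : ∀ C → ∃[ N ] (∀ n → N ℕ.≤ n → + C ℤ.* at (G 0) n ℤ.≤ at (L 0) n)
many-parts C = let N , h = terms-below-negligible (k ℕ.* k) k in N , λ n N≤n →
  let g = at (G 0) n; l = at (L 0) n; t = at (terms-below k 0) n
      kt≤g : + k ℤ.* t ℤ.≤ g
      kt≤g = ℤ.*-cancelˡ-≤-pos _ _ (+ k) (ℤ.≤-trans (ℤ.≤-reflexive (trans (sym (ℤ.*-assoc (+ k) (+ k) t))
               (cong (ℤ._* t) (sym (ℤ.pos-* k k))))) (h n N≤n))
      few : 0ℤ ℤ.≤ l ℤ.+ + k ℤ.* t ℤ.+ ℤ.- (+ k ℤ.* g)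
      few = subst (0ℤ ℤ.≤_) (cong₂ (λ x y → l ℤ.+ x ℤ.+ ℤ.- y)
              (trans (const-⊛ (+ (k ℕ.+ 0)) (terms-below k 0) n) (cong (λ k → + k ℤ.* t) (ℕ.+-identityʳ k)))
              (const-⊛ (+ k) (G 0) n)) ((few-parts k 0 0 ≥0) n)
  in ≤-by (ℤ.+-mono-≤ few (ℤ.i≤j⇒0≤j-i kt≤g))
       (ℤS.solve 4 (λ c g l x → l ℤS.:- c ℤS.:* g ℤS.:= (l ℤS.:+ x ℤS.:+ ℤS.:- ((ℤS.con 1ℤ ℤS.:+ c) ℤS.:* g)) ℤS.:+ (g ℤS.:- x))
         refl (+ C) g l (+ k ℤ.* t))
  where
  k = suc C

-- The Rogers–Ramanujan identity

infixr 8 _^ₑ_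

-- Unfolds exactly as `_^_` does, so that evaluated expressions agree with the goals by computation.
_^ₑ_ : ∀ {n} → Expr ℤ n → ℕ → Expr ℤ n
x ^ₑ zero  = con 1ℤ
x ^ₑ suc n = x :* x ^ₑ n

-- (q^(m+1); q)_i
poch : ℕ → ℕ → Series
poch zero    m = one
poch (suc i) m = poch i m ⊛ (one ⊖ q ⊛ (q ^ i ⊛ q ^ m))

poch-shift : ∀ i m → (one ⊖ q ⊛ q ^ m) ⊛ poch i (suc m) ≈ poch i m ⊛ (one ⊖ q ⊛ (q ^ i ⊛ q ^ m))
poch-shift zero    m = solve 2 (λ q u → (con 1ℤ :- q :* u) :* con 1ℤ := con 1ℤ :* (con 1ℤ :- q :* (con 1ℤ :* u))) refl q (q ^ m)
poch-shift (suc i) m = by-combination (one ⊖ q ⊛ (q ⊛ q ^ i ⊛ q ^ m) · poch-shift i m ∔ none)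
  (solve 5 (λ q x u p p′ → let one = con 1ℤ in
      (one :- q :* u) :* (p′ :* (one :- q :* (x :* (q :* u)))) :- p :* (one :- q :* (x :* u)) :* (one :- q :* (q :* x :* u))
    := (one :- q :* (q :* x :* u)) :* ((one :- q :* u) :* p′ :- p :* (one :- q :* (x :* u))) :+ con 0ℤ)
    refl q (q ^ i) (q ^ m) (poch i m) (poch i (suc m)))

-- (−1)^m q^(2im + m(5m+1)/2)
sgn : ℕ → ℕ → Series
sgn i zero    = one
sgn i (suc m) = ⊝ (sgn i m ⊛ ((q ^ i) ^ 2 ⊛ (q ^ m) ^ 5 ⊛ q ^ 3))

sgn-suc : ∀ i m → sgn (suc i) m ≈ sgn i m ⊛ (q ^ m) ^ 2
sgn-suc i zero    = solve 0 (con 1ℤ := con 1ℤ :* con 1ℤ ^ₑ 2) refl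
sgn-suc i (suc m) = by-combination (⊝ ((q ⊛ q ^ i) ^ 2 ⊛ (q ^ m) ^ 5 ⊛ q ^ 3) · sgn-suc i m ∔ none)
  (solve 5 (λ q x u e e′ →
      :- (e′ :* ((q :* x) ^ₑ 2 :* u ^ₑ 5 :* q ^ₑ 3)) :- (:- (e :* (x ^ₑ 2 :* u ^ₑ 5 :* q ^ₑ 3))) :* (q :* u) ^ₑ 2
    := :- ((q :* x) ^ₑ 2 :* u ^ₑ 5 :* q ^ₑ 3) :* (e′ :- e :* u ^ₑ 2) :+ con 0ℤ)
    refl q (q ^ i) (q ^ m) (sgn i m) (sgn (suc i) m))

-- The terms of the Rogers-Selberg expansion of (q; q)_∞ `G i`. For i = 0 they are (-1)^m
-- q^(m(5m+1)/2) (1 - q^(4m+2)).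
summand : ℕ → ℕ → Series
summand i m = sgn i m ⊛ poch i m ⊛ (one ⊖ (q ^ i) ^ 2 ⊛ (q ^ m) ^ 4 ⊛ q ^ 2)

-- The last factor, a polynomial in q^m, comes from comparing coefficients in summand-rec.
certificate : ℕ → ℕ → Series
certificate i m = sgn i m ⊛ ((one ⊖ q ^ m) ⊛ poch i m)
  ⊛ ((q ^ i) ^ 2 ⊛ q ^ 2 ⊛ (q ^ m) ^ 4 ⊖ q ^ i ⊛ q ⊛ (q ^ m) ^ 3 ⊖ one ⊖ q ^ m)

-- Creative telescoping: the summands satisfy the recurrence of `G i` up to a difference in m, hence
-- their partial sums satisfy it up to boundary terms.
summand-rec : ∀ i m → summand i m ⊖ summand (suc i) m ⊖ q ^ suc i ⊛ summand (2 ℕ.+ i) m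
                    ≈ certificate i (suc m) ⊖ certificate i m
summand-rec i m = by-combination
    ( ⊝ (w₁ ⊛ c₁) · sgn-suc i m
    ∔ ⊝ (q ⊛ x ⊛ (w₂ ⊛ c₂)) · ≈-trans (sgn-suc (suc i) m) (*-congʳ {u ^ 2} (sgn-suc i m))
    ∔ ⊝ (sgn i (suc m) ⊛ r) · poch-shift i m
    ∔ none)
  (solve 8 (λ q x u e e₁ e₂ w w′ →
      let one = con 1ℤ
          c = λ x u → one :- x ^ₑ 2 :* u ^ₑ 4 :* q ^ₑ 2
          w₁ = w :* (one :- q :* (x :* u))
          w₂ = w₁ :* (one :- q :* (q :* x :* u))
          r = λ u → x ^ₑ 2 :* q ^ₑ 2 :* u ^ₑ 4 :- x :* q :* u ^ₑ 3 :- one :- u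
          e′ = :- (e :* (x ^ₑ 2 :* u ^ₑ 5 :* q ^ₑ 3)) in
      e :* w :* c x u :- e₁ :* w₁ :* c (q :* x) u :- q :* x :* (e₂ :* w₂ :* c (q :* (q :* x)) u)
        :- (e′ :* ((one :- q :* u) :* w′) :* r (q :* u) :- e :* ((one :- u) :* w) :* r u)
    := :- (w₁ :* c (q :* x) u) :* (e₁ :- e :* u ^ₑ 2)
       :+ (:- (q :* x :* (w₂ :* c (q :* (q :* x)) u)) :* (e₂ :- e :* u ^ₑ 2 :* u ^ₑ 2)
       :+ (:- (e′ :* r (q :* u)) :* ((one :- q :* u) :* w′ :- w :* (one :- q :* (x :* u)))
       :+ con 0ℤ)))
    refl q x u (sgn i m) (sgn (suc i) m) (sgn (2 ℕ.+ i) m) (poch i m) (poch i (suc m)))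
  where
  x = q ^ i
  u = q ^ m
  w₁ = poch (suc i) m
  w₂ = poch (2 ℕ.+ i) m
  c₁ = one ⊖ (q ^ suc i) ^ 2 ⊛ u ^ 4 ⊛ q ^ 2
  c₂ = one ⊖ (q ^ (2 ℕ.+ i)) ^ 2 ⊛ u ^ 4 ⊛ q ^ 2
  r = (q ^ i) ^ 2 ⊛ q ^ 2 ⊛ (q ^ suc m) ^ 4 ⊖ q ^ i ⊛ q ⊛ (q ^ suc m) ^ 3 ⊖ one ⊖ q ^ suc m

Σ< : ℕ → (ℕ → Series) → Series
Σ< zero    f = ⟪ 0ℤ ⟫
Σ< (suc M) f = Σ< M f ⊕ f M

alternating : ℕ → ℕ → Series
alternating i M = Σ< M (summand i)

alternating-rec : ∀ i M → alternating i M ≈ alternating (suc i) M ⊕ q ^ suc i ⊛ alternating (2 ℕ.+ i) M ⊕ certificate i M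
-- The factor 1 - q^m of `certificate` vanishes at m = 0, so there is no lower boundary term.
alternating-rec i zero = solve 4 (λ x w c z → con 0ℤ :=
    con 0ℤ :+ x :* con 0ℤ :+ con 1ℤ :* ((con 1ℤ :- con 1ℤ) :* w) :* c) refl
  (q ^ suc i) (poch i 0) ((q ^ i) ^ 2 ⊛ q ^ 2 ⊛ (q ^ 0) ^ 4 ⊖ q ^ i ⊛ q ⊛ (q ^ 0) ^ 3 ⊖ one ⊖ q ^ 0) one
alternating-rec i (suc M) = by-combination (one · alternating-rec i M ∔ one · summand-rec i M ∔ none)
  (solve 9 (λ x s s₁ s₂ t t₁ t₂ g g′ →
      s :+ t :- (s₁ :+ t₁ :+ x :* (s₂ :+ t₂) :+ g′)
    := con 1ℤ :* (s :- (s₁ :+ x :* s₂ :+ g)) :+ (con 1ℤ :* (t :- t₁ :- x :* t₂ :- (g′ :- g)) :+ con 0ℤ))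
    refl (q ^ suc i) (alternating i M) (alternating (suc i) M) (alternating (2 ℕ.+ i) M)
    (summand i M) (summand (suc i) M) (summand (2 ℕ.+ i) M) (certificate i M) (certificate i (suc M)))

multiple-vanishes : ∀ m f {g} → g ≈ q ^ suc m ⊛ f → g ≈[ m ] ⟪ 0ℤ ⟫
multiple-vanishes m f e = ≈[]-trans m (≈⇒≈[] m e) (shift-vanishes m f)

certificate-vanishes : ∀ i m → certificate i (suc m) ≈[ m ] ⟪ 0ℤ ⟫
certificate-vanishes i m = multiple-vanishes m (⊝ (e ⊛ ((q ^ i) ^ 2 ⊛ (q ^ m) ^ 4 ⊛ q ^ 2)) ⊛ w ⊛ r)
  (solve 6 (λ q x u e w r → :- (e :* (x ^ₑ 2 :* u ^ₑ 5 :* q ^ₑ 3)) :* w :* r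
      := q :* u :* (:- (e :* (x ^ₑ 2 :* u ^ₑ 4 :* q ^ₑ 2)) :* w :* r))
    refl q (q ^ i) (q ^ m) e w r)
  where
  e = sgn i m
  w = (one ⊖ q ^ suc m) ⊛ poch i (suc m)
  r = (q ^ i) ^ 2 ⊛ q ^ 2 ⊛ (q ^ suc m) ^ 4 ⊖ q ^ i ⊛ q ⊛ (q ^ suc m) ^ 3 ⊖ one ⊖ q ^ suc m

euler : ℕ → Series
euler i = poch i 0

alternating-lead : ∀ i M → alternating i (suc M) ≈[ i ] euler i
alternating-lead i zero = ≈[]-trans i
  (≈⇒≈[] i (solve 3 (λ q x w → con 0ℤ :+ con 1ℤ :* w :* (con 1ℤ :- x ^ₑ 2 :* con 1ℤ ^ₑ 4 :* q ^ₑ 2)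
      := w :+ q :* x :* :- (w :* x :* q)) refl q (q ^ i) (euler i)))
  (≈[]-trans i (⊕-cong[] i (≈[]-refl i) (shift-vanishes i (⊝ (euler i ⊛ q ^ i ⊛ q)))) (≈⇒≈[] i (+-identityʳ (euler i))))
alternating-lead i (suc M) = ≈[]-trans i
  (⊕-cong[] i (alternating-lead i M) (multiple-vanishes i (⊝ (sgn i M ⊛ (q ^ i ⊛ (q ^ M) ^ 5 ⊛ q ^ 2)) ⊛ w ⊛ c)
    (solve 6 (λ q x u e w c → :- (e :* (x ^ₑ 2 :* u ^ₑ 5 :* q ^ₑ 3)) :* w :* c
        := q :* x :* (:- (e :* (x :* u ^ₑ 5 :* q ^ₑ 2)) :* w :* c))
      refl q (q ^ i) (q ^ M) (sgn i M) w c)))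
  (≈⇒≈[] i (+-identityʳ (euler i)))
  where
  w = poch i (suc M)
  c = one ⊖ (q ^ i) ^ 2 ⊛ (q ^ suc M) ^ 4 ⊛ q ^ 2

euler-agrees : ∀ {n i} → n ℕ.≤ i → euler i ≈[ n ] euler n
euler-agrees = stable euler λ m → ≈[]-trans m
  (≈⇒≈[] m (solve 3 (λ p q x → p :* (con 1ℤ :- q :* (x :* con 1ℤ)) := p :+ q :* x :* :- p) refl (euler m) q (q ^ m)))
  (≈[]-trans m (⊕-cong[] m (≈[]-refl m) (shift-vanishes m (⊝ euler m))) (≈⇒≈[] m (+-identityʳ (euler m))))

-- Both sides satisfy X i = X (i+1) + q^(i+1) X (i+2) up to q^n, and they agree for i ≥ n.
euler⊛G : ∀ n K M → n ℕ.≤ K → n ℕ.< M → ∀ i → euler K ⊛ G i ≈[ n ] alternating i M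
euler⊛G n K (suc M) n≤K (ℕ.s≤s n≤M) = descend (λ i → euler K ⊛ G i ≈[ n ] alternating i (suc M)) n base step
  where
  base : ∀ i → n ℕ.≤ i → euler K ⊛ G i ≈[ n ] alternating i (suc M)
  base i n≤i = ≈[]-trans n (⊛-cong[] n (euler-agrees n≤K) (G-lead i n n≤i))
    (≈[]-trans n (≈⇒≈[] n (*-identityʳ (euler n)))
    (≈[]-sym n (≈[]-trans n (≈[]-mono n≤i (alternating-lead i M)) (euler-agrees n≤i))))
  step : ∀ i → euler K ⊛ G (suc i) ≈[ n ] alternating (suc i) (suc M) →
         euler K ⊛ G (2 ℕ.+ i) ≈[ n ] alternating (2 ℕ.+ i) (suc M) → euler K ⊛ G i ≈[ n ] alternating i (suc M)
  step i h h′ = ≈[]-trans n (≈⇒≈[] n (by-combination (euler K · G-rec i ∔ none)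
      (solve 5 (λ p x g g₁ g₂ → p :* g :- (p :* g₁ :+ x :* (p :* g₂)) := p :* (g :- (g₁ :+ x :* g₂)) :+ con 0ℤ)
        refl (euler K) (q ^ suc i) (G i) (G (suc i)) (G (2 ℕ.+ i)))))
    (≈[]-trans n (⊕-cong[] n h (⊛-cong[] n (≈[]-refl n {q ^ suc i}) h′))
    (≈[]-trans n (≈[]-sym n (≈[]-trans n (⊕-cong[] n (≈[]-refl n) (≈[]-mono n≤M (certificate-vanishes i M))) (≈⇒≈[] n (+-identityʳ _))))
      (≈⇒≈[] n (≈-sym (alternating-rec i (suc M))))))

-- Jacobi's triple product

Q : Series
Q = q ^ 5

-- f⁺ s and f⁻ s are (−1)^s q^(s(5s+1)/2) and (−1)^s q^(s(5s−1)/2).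
f⁺ f⁻ : ℕ → Series
f⁺ zero    = one
f⁺ (suc s) = ⊝ (q ^ 3 ⊛ Q ^ s ⊛ f⁺ s)
f⁻ zero    = one
f⁻ (suc s) = ⊝ (q ^ 2 ⊛ Q ^ s ⊛ f⁻ s)

-- weight i j = (−1)^s q^(s(5s+1)/2) with s = ⌊(i − j)/2⌋, possibly negative.
weight : ℕ → ℕ → Series
weight i       zero    = f⁺ ℕ.⌊ i /2⌋
weight zero    (suc j) = f⁻ ℕ.⌈ suc j /2⌉
weight (suc i) (suc j) = weight i j

⌊2n/2⌋ : ∀ n → ℕ.⌊ n ℕ.+ n /2⌋ ≡ n
⌊2n/2⌋ n = sym (ℕ.n≡⌊n+n/2⌋ n)

⌊1+2n/2⌋ : ∀ n → ℕ.⌊ suc (n ℕ.+ n) /2⌋ ≡ n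
⌊1+2n/2⌋ n = sym (ℕ.n≡⌈n+n/2⌉ n)

Q^-double : ∀ n → Q ^ (n ℕ.+ n) ≈ Q ^ n ⊛ Q ^ n
Q^-double n = ^-homo-* Q n n

f⁺-cong : ∀ {m n} → m ≡ n → f⁺ m ≈ f⁺ n
f⁺-cong e = ≈-reflexive (cong f⁺ e)

f⁻-cong : ∀ {m n} → m ≡ n → f⁻ m ≈ f⁻ n
f⁻-cong e = ≈-reflexive (cong f⁻ e)

suc-double : ∀ i j n → suc (suc (i ℕ.+ j)) ≡ suc n ℕ.+ suc n → i ℕ.+ j ≡ n ℕ.+ n
suc-double i j n e = ℕ.suc-injective (ℕ.suc-injective (trans e (cong suc (ℕ.+-suc n n))))

-- Write i = n + s and j = n - s. Raising i leaves ⌊(i - j)/2⌋ = s. Raising j lowers it to s - 1 and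
-- the exponent s(5s+1)/2 by 5s - 2, which together with Q^i = q^(5n+5s) leaves q^(5n+2).
weight-even : ∀ n i j → i ℕ.+ j ≡ n ℕ.+ n →
  (weight (suc i) j ≈ weight i j) × (Q ^ i ⊛ weight i (suc j) ≈ ⊝ (q ^ 2 ⊛ Q ^ n ⊛ weight i j))
weight-even n i zero e with trans (sym (ℕ.+-identityʳ i)) e
weight-even n .(n ℕ.+ n) zero e | refl =
  f⁺-cong (trans (⌊1+2n/2⌋ n) (sym (⌊2n/2⌋ n))) , base n
  where
  base : ∀ n → Q ^ (n ℕ.+ n) ⊛ weight (n ℕ.+ n) 1 ≈ ⊝ (q ^ 2 ⊛ Q ^ n ⊛ weight (n ℕ.+ n) 0)
  base zero    = solve 1 (λ q → let one = con 1ℤ in one :* (:- (q ^ₑ 2 :* one :* one)) := :- (q ^ₑ 2 :* one :* one)) refl q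
  base (suc m) = by-combination
      ( weight (m ℕ.+ suc m) 0 · Q^-double (suc m)
      ∔ Q ^ suc m ⊛ Q ^ suc m · f⁺-cong (trans (cong ℕ.⌊_/2⌋ (ℕ.+-suc m m)) (⌊1+2n/2⌋ m))
      ∔ q ^ 2 ⊛ Q ^ suc m · f⁺-cong (⌊2n/2⌋ (suc m))
      ∔ none)
    (solve 6 (λ q Qm Q2 w f v → let Q = q ^ₑ 5 in
        Q2 :* w :- :- (q ^ₑ 2 :* (Q :* Qm) :* v)
      := w :* (Q2 :- Q :* Qm :* (Q :* Qm)) :+ (Q :* Qm :* (Q :* Qm) :* (w :- f)
         :+ (q ^ₑ 2 :* (Q :* Qm) :* (v :- :- (q ^ₑ 3 :* Qm :* f)) :+ con 0ℤ)))
      refl q (Q ^ m) (Q ^ (suc m ℕ.+ suc m)) (weight (m ℕ.+ suc m) 0) (f⁺ m) (weight (suc m ℕ.+ suc m) 0))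
weight-even n zero (suc j) e = ≈-trans (first n e) (≈-sym (f⁻-cong (trans (cong ℕ.⌈_/2⌉ e) (⌊1+2n/2⌋ n)))) ,
  ≈-trans (*-identityˡ _) (≈-trans (f⁻-cong (trans (cong (λ k → ℕ.⌈ suc k /2⌉) e) (cong suc (⌊2n/2⌋ n))))
    (-‿cong (*-congˡ {q ^ 2 ⊛ Q ^ n} (≈-sym (f⁻-cong (trans (cong ℕ.⌈_/2⌉ e) (⌊1+2n/2⌋ n)))))))
  where
  first : ∀ n {j} → suc j ≡ n ℕ.+ n → weight 0 j ≈ f⁻ n
  first (suc n) {j} e with trans (ℕ.suc-injective e) (ℕ.+-suc n n)
  ... | refl = f⁻-cong (cong suc (⌊2n/2⌋ n))
weight-even (suc n) (suc i) (suc j) e =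
  let h , h′ = weight-even n i j (suc-double i j n (trans (cong suc (sym (ℕ.+-suc i j))) e)) in
  h , by-combination (Q · h′ ∔ none)
    (solve 6 (λ q Q x y w w′ → Q :* x :* w′ :- :- (q ^ₑ 2 :* (Q :* y) :* w) := Q :* (x :* w′ :- :- (q ^ₑ 2 :* y :* w)) :+ con 0ℤ)
      refl q Q (Q ^ i) (Q ^ n) (weight i j) (weight i (suc j)))

-- Write i = n + s + 1 and j = n - s. Now raising j keeps s, whereas raising i leads to s + 1 and
-- increases the exponent by 5s + 3, which together with Q^j = q^(5n-5s) gives q^(5n+3).
weight-odd : ∀ n i j → i ℕ.+ j ≡ suc (n ℕ.+ n) →
  (weight i (suc j) ≈ weight i j) × (Q ^ j ⊛ weight (suc i) j ≈ ⊝ (q ^ 3 ⊛ Q ^ n ⊛ weight i j))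
weight-odd n i zero e with trans (sym (ℕ.+-identityʳ i)) e
... | refl = f⁺-cong (trans (⌊2n/2⌋ n) (sym (⌊1+2n/2⌋ n))) ,
  ≈-trans (*-identityˡ _) (≈-trans (f⁺-cong (cong suc (⌊2n/2⌋ n)))
    (-‿cong (*-congˡ {q ^ 3 ⊛ Q ^ n} (≈-sym (f⁺-cong (⌊1+2n/2⌋ n))))))
weight-odd n zero (suc j) e with ℕ.suc-injective e
... | refl = f⁻-cong (cong suc (trans (⌊1+2n/2⌋ n) (sym (⌊2n/2⌋ n)))) ,
  by-combination
      ( weight 0 (n ℕ.+ n) · *-congˡ {Q} (Q^-double n)
      ∔ Q ⊛ (Q ^ n ⊛ Q ^ n) · second n
      ∔ q ^ 3 ⊛ Q ^ n · f⁻-cong (cong suc (⌊2n/2⌋ n))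
      ∔ none)
    (solve 6 (λ q Qn Q2 w f v → let Q = q ^ₑ 5 in
        Q :* Q2 :* w :- :- (q ^ₑ 3 :* Qn :* v)
      := w :* (Q :* Q2 :- Q :* (Qn :* Qn)) :+ (Q :* (Qn :* Qn) :* (w :- f)
         :+ (q ^ₑ 3 :* Qn :* (v :- :- (q ^ₑ 2 :* Qn :* f)) :+ con 0ℤ)))
      refl q (Q ^ n) (Q ^ (n ℕ.+ n)) (weight 0 (n ℕ.+ n)) (f⁻ n) (weight 0 (suc (n ℕ.+ n))))
  where
  second : ∀ n → weight 0 (n ℕ.+ n) ≈ f⁻ n
  second zero    = ≈-refl
  second (suc n) = f⁻-cong (⌊1+2n/2⌋ (suc n))
weight-odd zero    (suc i) (suc j) e with () ← trans (sym (ℕ.+-suc i j)) (ℕ.suc-injective e)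
weight-odd (suc n) (suc i) (suc j) e =
  let h , h′ = weight-odd n i j (ℕ.suc-injective (ℕ.suc-injective (trans (cong suc (sym (ℕ.+-suc i j))) (trans e (cong (λ k → suc (suc k)) (ℕ.+-suc n n)))))) in
  h , by-combination (Q · h′ ∔ none)
    (solve 6 (λ q Q x y w w′ → Q :* x :* w′ :- :- (q ^ₑ 3 :* (Q :* y) :* w) := Q :* (x :* w′ :- :- (q ^ₑ 3 :* y :* w)) :+ con 0ℤ)
      refl q Q (Q ^ j) (Q ^ n) (weight i j) (weight (suc i) j))

antidiagonal : ℕ → (ℕ → ℕ → Series) → Series
antidiagonal zero    h = h 0 0
antidiagonal (suc N) h = h 0 (suc N) ⊕ antidiagonal N (λ i j → h (suc i) j)

antidiagonal-cong : ∀ N {g h} → (∀ i j → i ℕ.+ j ≡ N → g i j ≈ h i j) → antidiagonal N g ≈ antidiagonal N h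
antidiagonal-cong zero    e = e 0 0 refl
antidiagonal-cong (suc N) e = +-cong (e 0 (suc N) refl) (antidiagonal-cong N (λ i j i+j → e (suc i) j (cong suc i+j)))

antidiagonal-cong[] : ∀ n N {g h} → (∀ i j → i ℕ.+ j ≡ N → g i j ≈[ n ] h i j) → antidiagonal N g ≈[ n ] antidiagonal N h
antidiagonal-cong[] n zero    e = e 0 0 refl
antidiagonal-cong[] n (suc N) e = ⊕-cong[] n (e 0 (suc N) refl) (antidiagonal-cong[] n N (λ i j i+j → e (suc i) j (cong suc i+j)))

antidiagonal-⊕ : ∀ N g h → antidiagonal N (λ i j → g i j ⊕ h i j) ≈ antidiagonal N g ⊕ antidiagonal N h
antidiagonal-⊕ zero    g h = ≈-refl
antidiagonal-⊕ (suc N) g h = ≈-trans (+-congˡ {g 0 (suc N) ⊕ h 0 (suc N)} (antidiagonal-⊕ N (λ i j → g (suc i) j) (λ i j → h (suc i) j)))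
  (solve 4 (λ a b c d → a :+ b :+ (c :+ d) := a :+ c :+ (b :+ d)) refl (g 0 (suc N)) (h 0 (suc N)) _ _)

antidiagonal-⊛ : ∀ N c h → antidiagonal N (λ i j → c ⊛ h i j) ≈ c ⊛ antidiagonal N h
antidiagonal-⊛ zero    c h = ≈-refl
antidiagonal-⊛ (suc N) c h = ≈-trans (+-congˡ {c ⊛ h 0 (suc N)} (antidiagonal-⊛ N c (λ i j → h (suc i) j)))
  (solve 3 (λ c a b → c :* a :+ c :* b := c :* (a :+ b)) refl c (h 0 (suc N)) _)

antidiagonal-last : ∀ N h → antidiagonal (suc N) h ≈ antidiagonal N (λ i j → h i (suc j)) ⊕ h (suc N) 0
antidiagonal-last zero    h = ≈-refl
antidiagonal-last (suc N) h = ≈-trans (+-congˡ {h 0 (2 ℕ.+ N)} (antidiagonal-last N (λ i j → h (suc i) j)))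
  (solve 3 (λ a b c → a :+ (b :+ c) := a :+ b :+ c) refl (h 0 (2 ℕ.+ N)) _ (h (2 ℕ.+ N) 0))

aQ : ℕ → Series
aQ = recip (λ j → 4 ℕ.+ 5 ℕ.* j)

Q^≈ : ∀ j → Q ^ j ≈ q ^ (5 ℕ.* j)
Q^≈ j = ^-assocʳ q 5 j

aQ-step : ∀ j → (one ⊖ Q ^ suc j) ⊛ aQ (suc j) ≈ aQ j
aQ-step j = by-combination
    ( ⊝ aQ (suc j) · ≈-trans (Q^≈ (suc j)) (≈-reflexive (cong (q ^_) (ℕ.*-suc 5 j)))
    ∔ one · recip-rec (λ j → 4 ℕ.+ 5 ℕ.* j) j ∔ none)
  (solve 4 (λ x y a b → (con 1ℤ :- x) :* a :- b := :- a :* (x :- y) :+ (con 1ℤ :* (a :- (b :+ y :* a)) :+ con 0ℤ))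
    refl (Q ^ suc j) (q ^ (5 ℕ.+ 5 ℕ.* j)) (aQ (suc j)) (aQ j))

-- Up to the factor (Q; Q)_N this is the finite form of Jacobi's triple product.
T : ℕ → Series
T N = antidiagonal N (λ i j → weight i j ⊛ (aQ i ⊛ aQ j))

private
  lowerˡ lowerʳ loweredˡ loweredʳ : (ℕ → ℕ → Series) → ℕ → ℕ → Series
  lowerˡ   h i j = h i j ⊛ ((one ⊖ Q ^ i) ⊛ aQ i ⊛ aQ j)
  lowerʳ   h i j = h i j ⊛ ((one ⊖ Q ^ j) ⊛ aQ j ⊛ aQ i)
  loweredˡ h i j = h (suc i) j ⊛ (aQ i ⊛ aQ j)
  loweredʳ h i j = h i (suc j) ⊛ (aQ j ⊛ aQ i)

  first-part : ∀ N h → antidiagonal (suc N) (lowerˡ h) ≈ antidiagonal N (loweredˡ h)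
  first-part N h = ≈-trans
    (+-cong (solve 3 (λ h a b → h :* ((con 1ℤ :- con 1ℤ) :* a :* b) := con 0ℤ) refl (h 0 (suc N)) (aQ 0) (aQ (suc N)))
      (antidiagonal-cong N (λ i j _ → *-congˡ {h (suc i) j} (*-congʳ {aQ j} (aQ-step i)))))
    (+-identityˡ _)

  second-part : ∀ N h → antidiagonal (suc N) (lowerʳ h) ≈ antidiagonal N (loweredʳ h)
  second-part N h = ≈-trans (antidiagonal-last N (lowerʳ h)) (≈-trans
    (+-cong (antidiagonal-cong N (λ i j _ → *-congˡ {h i (suc j)} (*-congʳ {aQ i} (aQ-step j))))
      (solve 3 (λ h a b → h :* ((con 1ℤ :- con 1ℤ) :* b :* a) := con 0ℤ) refl (h (suc N) 0) (aQ (suc N)) (aQ 0)))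
    (+-identityʳ _))

  Q^-split : ∀ N {i j} → i ℕ.+ j ≡ N → Q ^ N ≈ Q ^ i ⊛ Q ^ j
  Q^-split N {i} {j} refl = ^-homo-* Q i j

-- A q-Pascal rule: on i + j = N + 1 the factor 1 - Q^(N+1) is (1 - Q^i) + Q^i (1 - Q^j). Each
-- summand cancels the last factor of one `aQ` and so moves to the antidiagonal i + j = N, where
-- `weight-even` recombines the two.
T-odd : ∀ n → (one ⊖ Q ^ suc (n ℕ.+ n)) ⊛ T (suc (n ℕ.+ n)) ≈ (one ⊖ q ^ 2 ⊛ Q ^ n) ⊛ T (n ℕ.+ n)
T-odd n = ≈-trans (≈-sym (antidiagonal-⊛ (suc N) (one ⊖ Q ^ suc N) (λ i j → weight i j ⊛ (aQ i ⊛ aQ j)))) (≈-trans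
    (antidiagonal-cong (suc N) (λ i j i+j → by-combination (⊝ (weight i j ⊛ (aQ i ⊛ aQ j)) · Q^-split (suc N) {i} {j} i+j ∔ none)
      (solve 6 (λ w a b x y z → let one = con 1ℤ in
          (one :- z) :* (w :* (a :* b)) :- (w :* ((one :- x) :* a :* b) :+ x :* w :* ((one :- y) :* b :* a))
        := :- (w :* (a :* b)) :* (z :- x :* y) :+ con 0ℤ) refl (weight i j) (aQ i) (aQ j) (Q ^ i) (Q ^ j) (Q ^ suc N))))
  (≈-trans (antidiagonal-⊕ (suc N) (lowerˡ weight) (lowerʳ h′))
  (≈-trans (+-cong (first-part N weight) (second-part N h′))
  (≈-trans (≈-sym (antidiagonal-⊕ N (loweredˡ weight) (loweredʳ h′)))
  (≈-trans (antidiagonal-cong N (λ i j i+j → let e , e′ = weight-even n i j i+j in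
      by-combination (aQ i ⊛ aQ j · e ∔ aQ i ⊛ aQ j · e′ ∔ none)
        (solve 7 (λ a b w w₁ x w₂ c → let one = con 1ℤ in
            w₁ :* (a :* b) :+ x :* w₂ :* (b :* a) :- (one :- c) :* (w :* (a :* b))
          := a :* b :* (w₁ :- w) :+ (a :* b :* (x :* w₂ :- :- (c :* w)) :+ con 0ℤ))
          refl (aQ i) (aQ j) (weight i j) (weight (suc i) j) (Q ^ i) (weight i (suc j)) (q ^ 2 ⊛ Q ^ n))))
    (antidiagonal-⊛ N (one ⊖ q ^ 2 ⊛ Q ^ n) (λ i j → weight i j ⊛ (aQ i ⊛ aQ j))))))))
  where
  N = n ℕ.+ n
  h′ : ℕ → ℕ → Series
  h′ i j = Q ^ i ⊛ weight i j

-- The other q-Pascal rule, 1 - Q^(N+1) = (1 - Q^j) + Q^j (1 - Q^i). The two rules alternate because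
-- on an odd antidiagonal it is raising j, not i, that keeps ⌊(i - j)/2⌋.
T-even : ∀ n → (one ⊖ Q ^ (2 ℕ.+ (n ℕ.+ n))) ⊛ T (2 ℕ.+ (n ℕ.+ n)) ≈ (one ⊖ q ^ 3 ⊛ Q ^ n) ⊛ T (suc (n ℕ.+ n))
T-even n = ≈-trans (≈-sym (antidiagonal-⊛ (suc N) (one ⊖ Q ^ suc N) (λ i j → weight i j ⊛ (aQ i ⊛ aQ j)))) (≈-trans
    (antidiagonal-cong (suc N) (λ i j i+j → by-combination (⊝ (weight i j ⊛ (aQ i ⊛ aQ j)) · Q^-split (suc N) {i} {j} i+j ∔ none)
      (solve 6 (λ w a b x y z → let one = con 1ℤ in
          (one :- z) :* (w :* (a :* b)) :- (w :* ((one :- y) :* b :* a) :+ y :* w :* ((one :- x) :* a :* b))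
        := :- (w :* (a :* b)) :* (z :- x :* y) :+ con 0ℤ) refl (weight i j) (aQ i) (aQ j) (Q ^ i) (Q ^ j) (Q ^ suc N))))
  (≈-trans (antidiagonal-⊕ (suc N) (lowerʳ weight) (lowerˡ h′))
  (≈-trans (+-cong (second-part N weight) (first-part N h′))
  (≈-trans (≈-sym (antidiagonal-⊕ N (loweredʳ weight) (loweredˡ h′)))
  (≈-trans (antidiagonal-cong N (λ i j i+j → let e , e′ = weight-odd n i j i+j in
      by-combination (aQ i ⊛ aQ j · e ∔ aQ i ⊛ aQ j · e′ ∔ none)
        (solve 7 (λ a b w w₁ x w₂ c → let one = con 1ℤ in
            w₁ :* (b :* a) :+ x :* w₂ :* (a :* b) :- (one :- c) :* (w :* (a :* b))
          := a :* b :* (w₁ :- w) :+ (a :* b :* (x :* w₂ :- :- (c :* w)) :+ con 0ℤ))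
          refl (aQ i) (aQ j) (weight i j) (weight i (suc j)) (Q ^ j) (weight (suc i) j) (q ^ 3 ⊛ Q ^ n))))
    (antidiagonal-⊛ N (one ⊖ q ^ 3 ⊛ Q ^ n) (λ i j → weight i j ⊛ (aQ i ⊛ aQ j))))))))
  where
  N = suc (n ℕ.+ n)
  h′ : ℕ → ℕ → Series
  h′ i j = Q ^ j ⊛ weight i j

eulerQ : ℕ → Series
eulerQ zero    = one
eulerQ (suc n) = eulerQ n ⊛ (one ⊖ Q ^ suc n)

product₂₃ product₁₄ : ℕ → Series
product₂₃ zero    = one
product₂₃ (suc n) = product₂₃ n ⊛ ((one ⊖ q ^ 2 ⊛ Q ^ n) ⊛ (one ⊖ q ^ 3 ⊛ Q ^ n))
product₁₄ zero    = one
product₁₄ (suc n) = product₁₄ n ⊛ ((one ⊖ q ⊛ Q ^ n) ⊛ (one ⊖ q ^ 4 ⊛ Q ^ n))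

finite-triple-product : ∀ n → eulerQ (n ℕ.+ n) ⊛ T (n ℕ.+ n) ≈ product₂₃ n
finite-triple-product zero    = solve 0 (con 1ℤ :* (con 1ℤ :* (con 1ℤ :* con 1ℤ)) := con 1ℤ) refl
finite-triple-product (suc n) = ≈-trans (≈-reflexive (cong (λ k → eulerQ k ⊛ T k) (cong suc (ℕ.+-suc n n))))
  (by-combination
    ( E ⊛ (one ⊖ Q ^ suc N) · T-even n
    ∔ E ⊛ (one ⊖ q ^ 3 ⊛ Q ^ n) · T-odd n
    ∔ (one ⊖ q ^ 2 ⊛ Q ^ n) ⊛ (one ⊖ q ^ 3 ⊛ Q ^ n) · finite-triple-product n
    ∔ none)
    (solve 9 (λ E x₁ x₂ y z t₀ t₁ t₂ p → let one = con 1ℤ in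
        E :* (one :- x₁) :* (one :- x₂) :* t₂ :- p :* ((one :- y) :* (one :- z))
      := E :* (one :- x₁) :* ((one :- x₂) :* t₂ :- (one :- z) :* t₁)
         :+ (E :* (one :- z) :* ((one :- x₁) :* t₁ :- (one :- y) :* t₀)
         :+ ((one :- y) :* (one :- z) :* (E :* t₀ :- p) :+ con 0ℤ)))
      refl E (Q ^ suc N) (Q ^ suc (suc N)) (q ^ 2 ⊛ Q ^ n) (q ^ 3 ⊛ Q ^ n) (T N) (T (suc N)) (T (suc (suc N))) (product₂₃ n)))
  where
  N = n ℕ.+ n
  E = eulerQ N

Q^-factor : ∀ j → Q ^ j ≈ q ^ j ⊛ q ^ (4 ℕ.* j)
Q^-factor j = ≈-trans (Q^≈ j) (^-homo-* q j (4 ℕ.* j))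

eulerQ-step : ∀ n → eulerQ (suc n) ≈[ n ] eulerQ n
eulerQ-step n = ≈[]-trans n (≈⇒≈[] n (solve 2 (λ e x → e :* (con 1ℤ :- x) := e :+ :- e :* x) refl (eulerQ n) (Q ^ suc n)))
  (≈[]-trans n (⊕-cong[] n (≈[]-refl n) (multiple-vanishes n (⊝ eulerQ n ⊛ q ^ (4 ℕ.* suc n))
    (by-combination (⊝ eulerQ n · Q^-factor (suc n) ∔ none)
      (solve 4 (λ e Q x y → :- e :* Q :- x :* (:- e :* y) := :- e :* (Q :- x :* y) :+ con 0ℤ)
        refl (eulerQ n) (Q ^ suc n) (q ^ suc n) (q ^ (4 ℕ.* suc n))))))
    (≈⇒≈[] n (+-identityʳ (eulerQ n))))

eulerQ-agrees : ∀ {n m} → n ℕ.≤ m → eulerQ m ≈[ n ] eulerQ n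
eulerQ-agrees = stable eulerQ eulerQ-step

eulerQ⊛aQ : ∀ i d → eulerQ (d ℕ.+ i) ⊛ aQ i ≈[ i ] one
eulerQ⊛aQ i d = ≈[]-trans i (⊛-cong[] i (eulerQ-agrees (ℕ.m≤n+m i d)) (≈[]-refl i)) (≈⇒≈[] i (exact i))
  where
  exact : ∀ i → eulerQ i ⊛ aQ i ≈ one
  exact zero    = *-identityˡ one
  exact (suc i) = by-combination (eulerQ i · aQ-step i ∔ one · exact i ∔ none)
    (solve 4 (λ e x a a′ → let one = con 1ℤ in e :* (one :- x) :* a′ :- one
        := e :* ((one :- x) :* a′ :- a) :+ (one :* (e :* a :- one) :+ con 0ℤ)) refl (eulerQ i) (Q ^ suc i) (aQ i) (aQ (suc i)))

f⁺-vanishes : ∀ {K s} → K ℕ.< s → f⁺ s ≈[ K ] ⟪ 0ℤ ⟫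
f⁺-vanishes {K} {suc s} (ℕ.s≤s K≤s) = ≈[]-mono K≤s (multiple-vanishes s (⊝ (q ^ 2 ⊛ q ^ (4 ℕ.* s) ⊛ f⁺ s))
  (by-combination (⊝ (q ^ 3 ⊛ f⁺ s) · Q^-factor s ∔ none)
    (solve 5 (λ q Q x y f → :- (q ^ₑ 3 :* Q :* f) :- q :* x :* :- (q ^ₑ 2 :* y :* f) := :- (q ^ₑ 3 :* f) :* (Q :- x :* y) :+ con 0ℤ)
      refl q (Q ^ s) (q ^ s) (q ^ (4 ℕ.* s)) (f⁺ s))))

f⁻-vanishes : ∀ {K s} → K ℕ.< s → f⁻ s ≈[ K ] ⟪ 0ℤ ⟫
f⁻-vanishes {K} {suc s} (ℕ.s≤s K≤s) = ≈[]-mono K≤s (multiple-vanishes s (⊝ (q ⊛ q ^ (4 ℕ.* s) ⊛ f⁻ s))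
  (by-combination (⊝ (q ^ 2 ⊛ f⁻ s) · Q^-factor s ∔ none)
    (solve 5 (λ q Q x y f → :- (q ^ₑ 2 :* Q :* f) :- q :* x :* :- (q :* y :* f) := :- (q ^ₑ 2 :* f) :* (Q :- x :* y) :+ con 0ℤ)
      refl q (Q ^ s) (q ^ s) (q ^ (4 ℕ.* s)) (f⁻ s))))

weight-vanishesˡ : ∀ K i j → suc K ℕ.+ suc K ℕ.+ j ℕ.≤ i → weight i j ≈[ K ] ⟪ 0ℤ ⟫
weight-vanishesˡ K i zero le = f⁺-vanishes (subst (ℕ._≤ ℕ.⌊ i /2⌋) (sym (ℕ.n≡⌊n+n/2⌋ (suc K)))
  (ℕ.⌊n/2⌋-mono (subst (ℕ._≤ i) (ℕ.+-identityʳ _) le)))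
weight-vanishesˡ K (suc i) (suc j) le = weight-vanishesˡ K i j (ℕ.s≤s⁻¹ (subst (ℕ._≤ suc i) (ℕ.+-suc (suc K ℕ.+ suc K) j) le))

weight-vanishesʳ : ∀ K i j → suc K ℕ.+ suc K ℕ.+ i ℕ.≤ j → weight i j ≈[ K ] ⟪ 0ℤ ⟫
weight-vanishesʳ K zero (suc j) le = f⁻-vanishes (subst (ℕ._≤ ℕ.⌈ suc j /2⌉) (sym (ℕ.n≡⌈n+n/2⌉ (suc K)))
  (ℕ.⌈n/2⌉-mono (subst (ℕ._≤ suc j) (ℕ.+-identityʳ _) le)))
weight-vanishesʳ K (suc i) (suc j) le = weight-vanishesʳ K i j (ℕ.s≤s⁻¹ (subst (ℕ._≤ suc j) (ℕ.+-suc (suc K ℕ.+ suc K) i) le))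

-- Each term of T tends to its weight; those with i or j small do not contribute.
T-limit : ∀ K → let n = suc K ℕ.+ suc K; E = eulerQ (n ℕ.+ n) in
          E ⊛ E ⊛ T (n ℕ.+ n) ≈[ K ] antidiagonal (n ℕ.+ n) weight
T-limit K = ≈[]-trans K (≈⇒≈[] K (≈-sym (antidiagonal-⊛ N (E ⊛ E) (λ i j → weight i j ⊛ (aQ i ⊛ aQ j)))))
    (antidiagonal-cong[] K N summands)
  where
  n = suc K ℕ.+ suc K
  N = n ℕ.+ n
  E = eulerQ N
  -- The length n = 2 (K + 1) is chosen for this: on i + j = 2n, an index i ≤ K forces j - i ≥ n,
  -- and there s is below -K, so that the weight has no terms up to q^K.
  far : ∀ {i j} → i ℕ.+ j ≡ N → i ℕ.≤ K → n ℕ.+ i ℕ.≤ j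
  far {i} {j} i+j i≤K = ℕ.+-cancelʳ-≤ i (n ℕ.+ i) j (begin
    n ℕ.+ i ℕ.+ i   ≡⟨ ℕ.+-assoc n i i ⟩
    n ℕ.+ (i ℕ.+ i) ≤⟨ ℕ.+-monoʳ-≤ n (ℕ.+-mono-≤ (ℕ.m≤n⇒m≤1+n i≤K) (ℕ.m≤n⇒m≤1+n i≤K)) ⟩
    N               ≡⟨ i+j ⟨
    i ℕ.+ j         ≡⟨ ℕ.+-comm i j ⟩
    j ℕ.+ i         ∎)
    where open ℕ.≤-Reasoning
  negligible : ∀ {i j} → weight i j ≈[ K ] ⟪ 0ℤ ⟫ → E ⊛ E ⊛ (weight i j ⊛ (aQ i ⊛ aQ j)) ≈[ K ] weight i j
  negligible {i} {j} z = ≈[]-trans K (⊛-cong[] K (≈[]-refl K) (⊛-cong[] K z (≈[]-refl K)))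
    (≈[]-trans K (≈⇒≈[] K (solve 2 (λ e a → e :* (con 0ℤ :* a) := con 0ℤ) refl (E ⊛ E) (aQ i ⊛ aQ j))) (≈[]-sym K z))
  near : ∀ {i j} → i ℕ.+ j ≡ N → K ℕ.≤ j → E ⊛ aQ j ≈[ K ] one
  near {i} {j} i+j K≤j = ≈[]-mono K≤j (subst (λ N → eulerQ N ⊛ aQ j ≈[ j ] one) i+j (eulerQ⊛aQ j i))
  summands : ∀ i j → i ℕ.+ j ≡ N → E ⊛ E ⊛ (weight i j ⊛ (aQ i ⊛ aQ j)) ≈[ K ] weight i j
  summands i j i+j with ℕ.≤-total i K | ℕ.≤-total j K
  ... | Sum.inj₁ i≤K | _            = negligible {i} {j} (weight-vanishesʳ K i j (far {i} {j} i+j i≤K))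
  ... | Sum.inj₂ _   | Sum.inj₁ j≤K = negligible {i} {j} (weight-vanishesˡ K i j (far {j} {i} (trans (ℕ.+-comm j i) i+j) j≤K))
  ... | Sum.inj₂ K≤i | Sum.inj₂ K≤j = ≈[]-trans K
    (≈⇒≈[] K (solve 4 (λ e w a b → e :* e :* (w :* (a :* b)) := w :* ((e :* a) :* (e :* b))) refl E (weight i j) (aQ i) (aQ j)))
    (≈[]-trans K (⊛-cong[] K (≈[]-refl K) (⊛-cong[] K (near {j} {i} (trans (ℕ.+-comm j i) i+j) K≤i) (near {i} {j} i+j K≤j)))
      (≈⇒≈[] K (solve 1 (λ w → w :* (con 1ℤ :* con 1ℤ) := w) refl (weight i j))))

-- On i + j = 2n each s from -n to n occurs once. Pairing m with -(m + 1) leaves over s = n and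
-- matches the two terms of `summand 0 m`.
antidiagonal-weight : ∀ n → antidiagonal (n ℕ.+ n) weight ≈ Σ< n (λ m → f⁺ m ⊕ f⁻ (suc m)) ⊕ f⁺ n
antidiagonal-weight zero    = ≈-sym (+-identityˡ one)
antidiagonal-weight (suc n) = ≈-trans (≈-reflexive (cong (λ k → antidiagonal k weight) (cong suc (ℕ.+-suc n n))))
  (by-combination
    ( one · antidiagonal-last N (λ i j → weight (suc i) j)
    ∔ one · antidiagonal-weight n
    ∔ one · f⁻-cong (cong suc (⌊1+2n/2⌋ n))
    ∔ one · f⁺-cong (cong suc (⌊2n/2⌋ n)) ∔ none)
    (solve 9 (λ w w′ a b s f g h k → let one = con 1ℤ in
        w :+ a :- (s :+ (f :+ g) :+ h)
      := one :* (a :- (b :+ w′)) :+ (one :* (b :- (s :+ f)) :+ (one :* (w :- g) :+ (one :* (w′ :- h) :+ con 0ℤ))))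
      refl (weight 0 (2 ℕ.+ N)) (weight (2 ℕ.+ N) 0) (antidiagonal (suc N) (λ i j → weight (suc i) j))
      (antidiagonal N weight) (Σ< n (λ m → f⁺ m ⊕ f⁻ (suc m))) (f⁺ n) (f⁻ (suc n)) (f⁺ (suc n)) one))
  where
  N = n ℕ.+ n

-- The second exponents agree since m(5m+1)/2 + 4m + 2 = (m+1)(5m+4)/2.
summand-weight : ∀ m → summand 0 m ≈ f⁺ m ⊕ f⁻ (suc m)
summand-weight m = by-combination (one ⊖ (q ^ m) ^ 4 ⊛ q ^ 2 · f⁺≈ m ∔ ⊝ one · f⁻≈ m ∔ none)
    (solve 5 (λ q u e f g → let one = con 1ℤ in
        e :* one :* (one :- one ^ₑ 2 :* u ^ₑ 4 :* q ^ₑ 2) :- (f :+ g)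
      := (one :- u ^ₑ 4 :* q ^ₑ 2) :* (e :- f) :+ (:- one :* (g :- :- (q ^ₑ 2 :* u ^ₑ 4 :* f)) :+ con 0ℤ))
      refl q (q ^ m) (sgn 0 m) (f⁺ m) (f⁻ (suc m)))
  where
  Q^m : ∀ m → Q ^ m ≈ (q ^ m) ^ 5
  Q^m m = ≈-trans (Q^≈ m) (≈-trans (≈-reflexive (cong (q ^_) (ℕ.*-comm 5 m))) (≈-sym (^-assocʳ q m 5)))
  f⁺≈ : ∀ m → sgn 0 m ≈ f⁺ m
  f⁺≈ zero    = ≈-refl
  f⁺≈ (suc m) = by-combination (⊝ ((q ^ m) ^ 5 ⊛ q ^ 3) · f⁺≈ m ∔ q ^ 3 ⊛ f⁺ m · Q^m m ∔ none)
    (solve 5 (λ q u Q e f → let one = con 1ℤ in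
        :- (e :* (one ^ₑ 2 :* u ^ₑ 5 :* q ^ₑ 3)) :- :- (q ^ₑ 3 :* Q :* f)
      := :- (u ^ₑ 5 :* q ^ₑ 3) :* (e :- f) :+ (q ^ₑ 3 :* f :* (Q :- u ^ₑ 5) :+ con 0ℤ))
      refl q (q ^ m) (Q ^ m) (sgn 0 m) (f⁺ m))
  f⁻≈ : ∀ m → f⁻ (suc m) ≈ ⊝ (q ^ 2 ⊛ (q ^ m) ^ 4 ⊛ f⁺ m)
  f⁻≈ zero    = solve 1 (λ q → let one = con 1ℤ in :- (q ^ₑ 2 :* one :* one) := :- (q ^ₑ 2 :* one ^ₑ 4 :* one)) refl q
  f⁻≈ (suc m) = by-combination (⊝ (q ^ 2 ⊛ Q ^ suc m) · f⁻≈ m ∔ none)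
    (solve 5 (λ q u Qm f g → let Q = q ^ₑ 5 in
        :- (q ^ₑ 2 :* (Q :* Qm) :* g) :- :- (q ^ₑ 2 :* (q :* u) ^ₑ 4 :* :- (q ^ₑ 3 :* Qm :* f))
      := :- (q ^ₑ 2 :* (Q :* Qm)) :* (g :- :- (q ^ₑ 2 :* u ^ₑ 4 :* f)) :+ con 0ℤ)
      refl q (q ^ m) (Q ^ m) (f⁺ m) (f⁻ (suc m)))

alternating-weight : ∀ M → alternating 0 M ≈ Σ< M (λ m → f⁺ m ⊕ f⁻ (suc m))
alternating-weight zero    = ≈-refl
alternating-weight (suc M) = +-cong (alternating-weight M) (summand-weight M)

q^5n≈ : ∀ n → q ^ (n ℕ.* 5) ≈ Q ^ n
q^5n≈ n = ≈-trans (≈-reflexive (cong (q ^_) (ℕ.*-comm n 5))) (≈-sym (Q^≈ n))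

euler-split : ∀ n → euler (n ℕ.* 5) ≈ eulerQ n ⊛ product₂₃ n ⊛ product₁₄ n
euler-split zero    = solve 0 (con 1ℤ := con 1ℤ :* con 1ℤ :* con 1ℤ) refl
euler-split (suc n) = ≈-trans (*-cong (*-cong (*-cong (*-cong (*-cong (euler-split n) (factor 0)) (factor 1)) (factor 2)) (factor 3)) (factor 4))
  (solve 5 (λ q e p r x → let one = con 1ℤ; c = λ k → one :- q :* (q ^ₑ k :* x) in
      e :* p :* r :* c 0 :* c 1 :* c 2 :* c 3 :* c 4
    := e :* (one :- q ^ₑ 5 :* x) :* (p :* ((one :- q ^ₑ 2 :* x) :* (one :- q ^ₑ 3 :* x))) :* (r :* ((one :- q :* x) :* (one :- q ^ₑ 4 :* x))))
    refl q (eulerQ n) (product₂₃ n) (product₁₄ n) (Q ^ n))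
  where
  factor : ∀ k → one ⊖ q ⊛ (q ^ (k ℕ.+ n ℕ.* 5) ⊛ one) ≈ one ⊖ q ⊛ (q ^ k ⊛ Q ^ n)
  factor k = by-combination (⊝ q · ^-homo-* q k (n ℕ.* 5) ∔ ⊝ (q ⊛ q ^ k) · q^5n≈ n ∔ none)
    (solve 5 (λ q x k y z → let one = con 1ℤ in
        one :- q :* (x :* one) :- (one :- q :* (k :* z)) := :- q :* (x :- k :* y) :+ (:- (q :* k) :* (y :- z) :+ con 0ℤ))
      refl q (q ^ (k ℕ.+ n ℕ.* 5)) (q ^ k) (q ^ (n ℕ.* 5)) (Q ^ n))

Unit : Series → Set
Unit u = ∃[ v ] u ⊛ v ≈ one

Unit-⊛ : ∀ {u u′} → Unit u → Unit u′ → Unit (u ⊛ u′)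
Unit-⊛ {u} {u′} (v , e) (v′ , e′) = v ⊛ v′ , by-combination (u′ ⊛ v′ · e ∔ one · e′ ∔ none)
  (solve 4 (λ u u′ v v′ → let one = con 1ℤ in u :* u′ :* (v :* v′) :- one
      := u′ :* v′ :* (u :* v :- one) :+ (one :* (u′ :* v′ :- one) :+ con 0ℤ)) refl u u′ v v′)

Unit-1-q : ∀ {f} k → f ≈ q ^ suc k → Unit (one ⊖ f)
Unit-1-q {f} k e = geo k , by-combination (⊝ geo k · e ∔ one · geo-rec k ∔ none)
  (solve 3 (λ f g x → let one = con 1ℤ in (one :- f) :* g :- one := :- g :* (f :- x) :+ (one :* (g :- (one :+ x :* g)) :+ con 0ℤ))
    refl f (geo k) (q ^ suc k))

Unit-cancel : ∀ n {u x y} → Unit u → u ⊛ x ≈[ n ] u ⊛ y → x ≈[ n ] y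
Unit-cancel n {u} {x} {y} (v , e) h = ≈[]-trans n (≈⇒≈[] n (≈-sym (absorb x)))
    (≈[]-trans n (⊛-cong[] n (≈[]-refl n) h) (≈⇒≈[] n (absorb y)))
  where
  absorb : ∀ x → v ⊛ (u ⊛ x) ≈ x
  absorb x = by-combination (x · e ∔ none) (solve 3 (λ u v x → v :* (u :* x) :- x := x :* (u :* v :- con 1ℤ) :+ con 0ℤ) refl u v x)

q⊛Q^ : ∀ k n → q ^ suc k ⊛ Q ^ n ≈ q ^ suc (k ℕ.+ 5 ℕ.* n)
q⊛Q^ k n = ≈-trans (*-congˡ {q ^ suc k} (Q^≈ n)) (≈-sym (^-homo-* q (suc k) (5 ℕ.* n)))

Unit-eulerQ : ∀ n → Unit (eulerQ n)
Unit-eulerQ zero    = one , *-identityˡ one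
Unit-eulerQ (suc n) = Unit-⊛ (Unit-eulerQ n) (Unit-1-q (4 ℕ.+ 5 ℕ.* n) (q⊛Q^ 4 n))

Unit-product₂₃ : ∀ n → Unit (product₂₃ n)
Unit-product₂₃ zero    = one , *-identityˡ one
Unit-product₂₃ (suc n) = Unit-⊛ (Unit-product₂₃ n) (Unit-⊛ (Unit-1-q (1 ℕ.+ 5 ℕ.* n) (q⊛Q^ 1 n)) (Unit-1-q (2 ℕ.+ 5 ℕ.* n) (q⊛Q^ 2 n)))

-- Both sides are multiplied by the invertible `eulerQ n ⊛ product₂₃ n`. On the left this completes
-- (q; q)_∞ and gives the alternating series; on the right the triple product gives the same series.
-- The value n = 2K + 2 keeps all truncation errors beyond q^K.
rogers-ramanujan : ∀ K → let n = suc K ℕ.+ suc K in product₁₄ n ⊛ G 0 ≈[ K ] one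
rogers-ramanujan K = Unit-cancel K (Unit-⊛ (Unit-eulerQ n) (Unit-product₂₃ n))
  (≈[]-trans K (≈⇒≈[] K (by-combination (⊝ G 0 · euler-split n ∔ none)
    (solve 5 (λ e p r f g → e :* p :* (r :* g) :- f :* g := :- g :* (f :- e :* p :* r) :+ con 0ℤ)
      refl (eulerQ n) (product₂₃ n) (product₁₄ n) (euler (n ℕ.* 5)) (G 0))))
  (≈[]-trans K (euler⊛G K (n ℕ.* 5) n (ℕ.≤-trans K≤n (ℕ.m≤m*n n 5)) K<n 0)
  (≈[]-trans K (≈⇒≈[] K (alternating-weight n))
  (≈[]-trans K (≈[]-sym K (≈[]-trans K (≈⇒≈[] K (antidiagonal-weight n))
    (≈[]-trans K (⊕-cong[] K (≈[]-refl K) (f⁺-vanishes K<n)) (≈⇒≈[] K (+-identityʳ _)))))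
  (≈[]-trans K (≈[]-sym K (T-limit K))
  (≈[]-trans K (≈⇒≈[] K (by-combination (E · finite-triple-product n ∔ none)
      (solve 3 (λ e t p → e :* e :* t :- e :* p := e :* (e :* t :- p) :+ con 0ℤ) refl E (T N) (product₂₃ n))))
  (≈[]-trans K (⊛-cong[] K (≈[]-mono K≤n (eulerQ-agrees (ℕ.m≤m+n n n))) (≈[]-refl K))
    (≈⇒≈[] K (≈-sym (*-identityʳ _))))))))))
  where
  n = suc K ℕ.+ suc K
  N = n ℕ.+ n
  E = eulerQ N
  K<n : K ℕ.< n
  K<n = ℕ.m≤m+n (suc K) (suc K)
  K≤n = ℕ.<⇒≤ K<n

-- Counting partitions by generating functions

total : (List ℕ → ℕ) → ℕ → ℕ → ℕ → ℕ
total ψ f n m = sum (map ψ (pts f n m))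

private
  sum-concatMap : ∀ {A B : Set} (g : B → ℕ) (F : A → List B) xs →
                  sum (map g (concatMap F xs)) ≡ sum (map (λ x → sum (map g (F x))) xs)
  sum-concatMap g F []       = refl
  sum-concatMap g F (x ∷ xs) = trans (cong sum (List.map-++ g (F x) (concatMap F xs)))
    (trans (sum-++ (map g (F x)) _) (cong (sum (map g (F x)) ℕ.+_) (sum-concatMap g F xs)))

  below : (ℕ → ℕ) → ℕ → ℕ → ℕ
  below g N m = sum (map g (filter (λ k → suc k ℕ.≤? m) (upTo N)))

  below-suc : ∀ g N m → below g (suc N) m ≡ below g N m ℕ.+ (if N ℕ.<ᵇ m then g N else 0)
  below-suc g N m = begin
    below g (suc N) m                                                ≡⟨ cong (λ ks → sum (map g (filter P? ks))) (List.upTo-∷ʳ N) ⟨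
    sum (map g (filter P? (upTo N ∷ʳ N)))                            ≡⟨ cong (λ ks → sum (map g ks)) (List.filter-++ P? (upTo N) _) ⟩
    sum (map g (filter P? (upTo N) ++ filter P? (N ∷ [])))           ≡⟨ cong sum (List.map-++ g (filter P? (upTo N)) _) ⟩
    sum (map g (filter P? (upTo N)) ++ map g (filter P? (N ∷ [])))   ≡⟨ sum-++ (map g (filter P? (upTo N))) _ ⟩
    below g N m ℕ.+ sum (map g (filter P? (N ∷ [])))                 ≡⟨ cong (below g N m ℕ.+_) last ⟩
    below g N m ℕ.+ (if N ℕ.<ᵇ m then g N else 0)         ∎
    where
    open ≡-Reasoning
    P? = λ k → suc k ℕ.≤? m
    last : sum (map g (filter P? (N ∷ []))) ≡ (if N ℕ.<ᵇ m then g N else 0)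
    last with N ℕ.<ᵇ m
    ... | true  = ℕ.+-identityʳ (g N)
    ... | false = refl

  swap : ∀ m N {x y : ℕ} → (m ≡ N → x ≡ y) →
         (if m ℕ.<ᵇ N then x else 0) ℕ.+ (if N ℕ.<ᵇ suc m then y else 0)
       ≡ (if N ℕ.<ᵇ m then y else 0) ℕ.+ (if m ℕ.<ᵇ suc N then x else 0)
  swap zero    zero    e = sym (e refl)
  swap zero    (suc N) e = ℕ.+-identityʳ _
  swap (suc m) zero    e = sym (ℕ.+-identityʳ _)
  swap (suc m) (suc N) e = swap m N (λ m≡N → e (cong suc m≡N))

  below-bound : ∀ g N m → below g N (suc m) ≡ below g N m ℕ.+ (if m ℕ.<ᵇ N then g m else 0)
  below-bound g zero    m = refl
  below-bound g (suc N) m = begin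
    below g (suc N) (suc m)                                                       ≡⟨ below-suc g N (suc m) ⟩
    below g N (suc m) ℕ.+ [ N < suc m ] g N                                       ≡⟨ cong (ℕ._+ [ N < suc m ] g N) (below-bound g N m) ⟩
    below g N m ℕ.+ [ m < N ] g m ℕ.+ [ N < suc m ] g N                           ≡⟨ ℕ.+-assoc (below g N m) _ _ ⟩
    below g N m ℕ.+ ([ m < N ] g m ℕ.+ [ N < suc m ] g N)                         ≡⟨ cong (below g N m ℕ.+_) (swap m N (cong g)) ⟩
    below g N m ℕ.+ ([ N < m ] g N ℕ.+ [ m < suc N ] g m)                         ≡⟨ ℕ.+-assoc (below g N m) _ _ ⟨
    below g N m ℕ.+ [ N < m ] g N ℕ.+ [ m < suc N ] g m                           ≡⟨ cong (ℕ._+ [ m < suc N ] g m) (below-suc g N m) ⟨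
    below g (suc N) m ℕ.+ [ m < suc N ] g m                                       ∎
    where
    open ≡-Reasoning
    [_<_]_ : ℕ → ℕ → ℕ → ℕ
    [ m < n ] x = if m ℕ.<ᵇ n then x else 0

  total-below : ∀ ψ f n m → total ψ (suc f) (suc n) m ≡ below (λ k → total (λ λs → ψ (suc k ∷ λs)) f (n ℕ.∸ k) (suc k)) (suc n) m
  total-below ψ f n m = trans (sum-concatMap ψ (λ k → map (suc k ∷_) (pts f (n ℕ.∸ k) (suc k))) (filter (λ k → suc k ℕ.≤? m) (upTo (suc n))))
    (cong sum (List.map-cong (λ k → cong sum (sym (List.map-∘ (pts f (n ℕ.∸ k) (suc k))))) (filter (λ k → suc k ℕ.≤? m) (upTo (suc n)))))

total-suc : ∀ ψ f n m → total ψ (suc f) (suc n) (suc m) ≡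
  total ψ (suc f) (suc n) m ℕ.+ (if m ℕ.<ᵇ suc n then total (λ λs → ψ (suc m ∷ λs)) f (n ℕ.∸ m) (suc m) else 0)
total-suc ψ f n m = trans (total-below ψ f n (suc m)) (trans (below-bound _ (suc n) m)
  (cong (ℕ._+ (if m ℕ.<ᵇ suc n then total (λ λs → ψ (suc m ∷ λs)) f (n ℕ.∸ m) (suc m) else 0)) (sym (total-below ψ f n m))))

total-0 : ∀ ψ f n → total ψ (suc f) (suc n) 0 ≡ 0
total-0 ψ f n = trans (total-below ψ f n 0) (go (suc n))
  where
  go : ∀ {g} N → below g N 0 ≡ 0
  go zero        = refl
  go {g} (suc N) = trans (below-suc g N 0) (trans (ℕ.+-identityʳ (below g N 0)) (go N))

pts-fuel : ∀ {f f′ n} m → n ℕ.≤ f → n ℕ.≤ f′ → pts f n m ≡ pts f′ n m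
pts-fuel {n = zero}  m _ _ = refl
pts-fuel {suc f} {suc f′} {suc n} m (ℕ.s≤s n≤f) (ℕ.s≤s n≤f′) =
  List.concatMap-cong (λ k → cong (map (suc k ∷_)) (pts-fuel (suc k) (ℕ.≤-trans (ℕ.m∸n≤m n k) n≤f) (ℕ.≤-trans (ℕ.m∸n≤m n k) n≤f′)))
    (filter (λ k → suc k ℕ.≤? m) (upTo (suc n)))

count : (List ℕ → ℕ) → ℕ → Series
at (count ψ m) n = + total ψ n n m

count-rec : ∀ ψ m → count ψ (suc m) ≈ count ψ m ⊕ q ^ suc m ⊛ count (λ λs → ψ (suc m ∷ λs)) (suc m)
count-rec ψ m = ext go
  where
  ψ′ = λ λs → ψ (suc m ∷ λs)
  Y  = q ^ suc m ⊛ count ψ′ (suc m)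
  go : ∀ n → at (count ψ (suc m)) n ≡ at (count ψ m ⊕ Y) n
  go zero    = sym (trans (cong (λ z → + total ψ 0 0 m ℤ.+ z) (q^⊛-< (suc m) (count ψ′ (suc m)) (ℕ.s≤s ℕ.z≤n))) (ℤ.+-identityʳ _))
  go (suc n) = trans (cong +_ (total-suc ψ n n m)) (cong (λ z → + total ψ (suc n) (suc n) m ℤ.+ z) last)
    where
    last : + (if m ℕ.<ᵇ suc n then total ψ′ n (n ℕ.∸ m) (suc m) else 0) ≡ at Y (suc n)
    last with m ℕ.<? suc n
    ... | yes (ℕ.s≤s m≤n) = trans (cong (λ b → + (if b then total ψ′ n (n ℕ.∸ m) (suc m) else 0)) (T⇒≡true (ℕ.<⇒<ᵇ (ℕ.s≤s m≤n))))
        (trans (cong (λ λss → + sum (map ψ′ λss)) (pts-fuel (suc m) (ℕ.m∸n≤m n m) ℕ.≤-refl))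
          (subst (λ k → at (count ψ′ (suc m)) (n ℕ.∸ m) ≡ at Y (suc k)) (ℕ.m+[n∸m]≡n m≤n) (sym (q^⊛-+ (suc m) (count ψ′ (suc m)) (n ℕ.∸ m)))))
      where
      T⇒≡true : ∀ {b} → Bool.T b → b ≡ true
      T⇒≡true {true} _ = refl
    ... | no m≮ = trans (cong (λ b → + (if b then total ψ′ n (n ℕ.∸ m) (suc m) else 0)) (¬T⇒≡false (λ t → m≮ (ℕ.<ᵇ⇒< m (suc n) t))))
        (sym (q^⊛-< (suc m) (count ψ′ (suc m)) (ℕ.s≤s (ℕ.≮⇒≥ m≮))))
      where
      ¬T⇒≡false : ∀ {b} → (Bool.T b → ⊥) → b ≡ false
      ¬T⇒≡false {false} _ = refl
      ¬T⇒≡false {true}  f with () ← f _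

count-0 : ∀ ψ → count ψ 0 ≈ ⟪ + ψ [] ⟫
count-0 ψ = ext λ { zero → cong +_ (ℕ.+-identityʳ (ψ [])) ; (suc n) → cong +_ (total-0 ψ n n) }

data Decreasing : ℕ → List ℕ → Set where
  []  : ∀ {m} → Decreasing m []
  _∷_ : ∀ {m k λs} → suc k ℕ.≤ m → Decreasing (suc k) λs → Decreasing m (suc k ∷ λs)

pts-Decreasing : ∀ f n m → All (Decreasing m) (pts f n m)
pts-Decreasing zero    zero    m = [] ∷ []
pts-Decreasing (suc f) zero    m = [] ∷ []
pts-Decreasing zero    (suc n) m = []
pts-Decreasing (suc f) (suc n) m = All.concat⁺ (All.map⁺ (All.map
  (λ {k} k<m → All.map⁺ (All.map (k<m ∷_) (pts-Decreasing f (n ℕ.∸ k) (suc k))))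
  (All.all-filter (λ k → suc k ℕ.≤? m) (upTo (suc n)))))

total-cong : ∀ {ψ χ} f n m → (∀ {λs} → Decreasing m λs → ψ λs ≡ χ λs) → total ψ f n m ≡ total χ f n m
total-cong f n m e = cong sum (List.map-cong-local (All.map e (pts-Decreasing f n m)))

count-cong : ∀ {ψ χ} m → (∀ {λs} → Decreasing m λs → ψ λs ≡ χ λs) → count ψ m ≈ count χ m
count-cong m e = ext λ n → cong +_ (total-cong n n m e)

total-mono : ∀ {ψ χ} f n m → (∀ {λs} → Decreasing m λs → ψ λs ℕ.≤ χ λs) → total ψ f n m ℕ.≤ total χ f n m
total-mono {ψ} {χ} f n m le = go (pts-Decreasing f n m)
  where
  go : ∀ {λss} → All (Decreasing m) λss → sum (map ψ λss) ℕ.≤ sum (map χ λss)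
  go []       = ℕ.z≤n
  go (d ∷ ds) = ℕ.+-mono-≤ (le d) (go ds)

count-+ : ∀ ψ χ m → count (λ λs → ψ λs ℕ.+ χ λs) m ≈ count ψ m ⊕ count χ m
count-+ ψ χ m = ext λ n → cong +_ (go (pts n n m))
  where
  go : ∀ λss → sum (map (λ λs → ψ λs ℕ.+ χ λs) λss) ≡ sum (map ψ λss) ℕ.+ sum (map χ λss)
  go []         = refl
  go (λs ∷ λss) = trans (cong (ψ λs ℕ.+ χ λs ℕ.+_) (go λss))
    (ℕS.solve 4 (λ a b c d → a ℕS.:+ b ℕS.:+ (c ℕS.:+ d) ℕS.:= a ℕS.:+ c ℕS.:+ (b ℕS.:+ d)) refl (ψ λs) (χ λs) (sum (map ψ λss)) (sum (map χ λss)))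

count-zero : ∀ m → count (λ _ → 0) m ≈ ⟪ 0ℤ ⟫
count-zero m = ext λ n → trans (cong +_ (go (pts n n m))) (sym (at-0 n))
  where
  go : ∀ λss → sum (map (λ _ → 0) λss) ≡ 0
  go []        = refl
  go (_ ∷ λss) = go λss

-- Hooks

rowCount : ℕ → ℕ → List ℕ → ℕ → ℕ
rowCount t r rest n = length (filter (ℕ._≟ t) (map (λ j → (r ℕ.∸ j) ℕ.+ conj rest j ℕ.+ 1) (applyUpTo suc n)))

hookCount : ℕ → List ℕ → ℕ
hookCount t []         = 0
hookCount t (r ∷ rest) = rowCount t r rest r ℕ.+ hookCount t rest

-- All rows above reach column j, so subtracting the row index from the column length leaves the
-- rows below. Hence the hooks of a row depend only on what follows it in the list.
numHooks-rows : ∀ t {m λs} → Decreasing m λs → numHooks t λs ≡ hookCount t λs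
numHooks-rows t {m} d = go [] [] d
  where
  leg : ∀ {m r j} pre rest → All (m ℕ.≤_) pre → r ℕ.≤ m → j ℕ.≤ r →
        conj (pre ++ r ∷ rest) j ℕ.∸ suc (length pre) ≡ conj rest j
  leg {m} {r} {j} pre rest ≥m r≤m j≤r = begin
    conj (pre ++ r ∷ rest) j ℕ.∸ suc (length pre)
      ≡⟨ cong (λ xs → length xs ℕ.∸ suc (length pre)) (List.filter-++ (j ℕ.≤?_) pre (r ∷ rest)) ⟩
    length (filter (j ℕ.≤?_) pre ++ filter (j ℕ.≤?_) (r ∷ rest)) ℕ.∸ suc (length pre)
      ≡⟨ cong₂ (λ xs ys → length (xs ++ ys) ℕ.∸ suc (length pre))
           (List.filter-all (j ℕ.≤?_) (All.map (ℕ.≤-trans (ℕ.≤-trans j≤r r≤m)) ≥m)) (List.filter-accept (j ℕ.≤?_) j≤r) ⟩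
    length (pre ++ r ∷ filter (j ℕ.≤?_) rest) ℕ.∸ suc (length pre)
      ≡⟨ cong (ℕ._∸ suc (length pre)) (List.length-++ pre) ⟩
    length pre ℕ.+ suc (conj rest j) ℕ.∸ suc (length pre)
      ≡⟨ cong (ℕ._∸ suc (length pre)) (ℕ.+-suc (length pre) (conj rest j)) ⟩
    length pre ℕ.+ conj rest j ℕ.∸ length pre
      ≡⟨ ℕ.m+n∸m≡n (length pre) (conj rest j) ⟩
    conj rest j ∎
    where open ≡-Reasoning
  go : ∀ {m} pre {λs} → All (m ℕ.≤_) pre → Decreasing m λs →
       length (filter (ℕ._≟ t) (hooksRows (pre ++ λs) (suc (length pre)) λs)) ≡ hookCount t λs
  go pre ≥m [] = refl
  go {m} pre ≥m (_∷_ {k = k} {λs = rest} k<m d) = begin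
    length (filter (ℕ._≟ t) (row ++ rows))
      ≡⟨ cong length (List.filter-++ (ℕ._≟ t) row rows) ⟩
    length (filter (ℕ._≟ t) row ++ filter (ℕ._≟ t) rows)
      ≡⟨ List.length-++ (filter (ℕ._≟ t) row) ⟩
    length (filter (ℕ._≟ t) row) ℕ.+ length (filter (ℕ._≟ t) rows)
      ≡⟨ cong₂ ℕ._+_ (cong (λ hs → length (filter (ℕ._≟ t) hs)) row≡)
           (trans (cong₂ (λ λs i → length (filter (ℕ._≟ t) (hooksRows λs i rest))) (sym (List.++-assoc pre (r ∷ []) rest))
                    (cong suc (sym (trans (List.length-++ pre) (ℕ.+-comm (length pre) 1)))))
             (go (pre ++ r ∷ []) (All.++⁺ (All.map (ℕ.≤-trans k<m) ≥m) (ℕ.≤-refl ∷ [])) d)) ⟩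
    rowCount t r rest r ℕ.+ hookCount t rest ∎
    where
    open ≡-Reasoning
    r    = suc k
    row  = map (λ j → (r ℕ.∸ j) ℕ.+ (conj (pre ++ r ∷ rest) j ℕ.∸ suc (length pre)) ℕ.+ 1) (applyUpTo suc r)
    rows = hooksRows (pre ++ r ∷ rest) (suc (suc (length pre))) rest
    hook : (ℕ → ℕ) → ℕ → ℕ
    hook leg j = (r ℕ.∸ j) ℕ.+ leg j ℕ.+ 1
    row≡ : row ≡ map (hook (conj rest)) (applyUpTo suc r)
    row≡ = List.map-cong-local {f = hook (λ j → conj (pre ++ r ∷ rest) j ℕ.∸ suc (length pre))} {g = hook (conj rest)}
      (All.applyUpTo⁺₁ suc r (λ {i} i<r → cong (λ l → (r ℕ.∸ suc i) ℕ.+ l ℕ.+ 1) (leg {j = suc i} pre rest ≥m k<m i<r)))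

module Row (t r : ℕ) (rest : List ℕ) where
  h : ℕ → ℕ
  h j = (r ℕ.∸ j) ℕ.+ conj rest j ℕ.+ 1

  private
    snoc : ∀ n → rowCount t r rest (suc n) ≡ rowCount t r rest n ℕ.+ length (filter (ℕ._≟ t) (h (suc n) ∷ []))
    snoc n = trans (cong (λ js → length (filter (ℕ._≟ t) (map h js))) (sym (List.applyUpTo-∷ʳ suc n)))
      (trans (cong (λ hs → length (filter (ℕ._≟ t) hs)) (List.map-++ h (applyUpTo suc n) (suc n ∷ [])))
      (trans (cong length (List.filter-++ (ℕ._≟ t) (map h (applyUpTo suc n)) (h (suc n) ∷ [])))
        (List.length-++ (filter (ℕ._≟ t) (map h (applyUpTo suc n))))))

  hit : ∀ n → h (suc n) ≡ t → rowCount t r rest (suc n) ≡ suc (rowCount t r rest n)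
  hit n e = trans (snoc n) (trans (cong (λ hs → rowCount t r rest n ℕ.+ length hs) (List.filter-accept (ℕ._≟ t) e)) (ℕ.+-comm _ 1))

  miss : ∀ n → h (suc n) ≢ t → rowCount t r rest (suc n) ≡ rowCount t r rest n
  miss n ne = trans (snoc n) (trans (cong (λ hs → rowCount t r rest n ℕ.+ length hs) (List.filter-reject (ℕ._≟ t) ne)) (ℕ.+-identityʳ _))

  step-≤ : ∀ n → rowCount t r rest (suc n) ℕ.≤ suc (rowCount t r rest n)
  step-≤ n with h (suc n) ℕ.≟ t
  ... | yes e = ℕ.≤-reflexive (hit n e)
  ... | no ne = ℕ.≤-trans (ℕ.≤-reflexive (miss n ne)) (ℕ.n≤1+n _)

  step-≥ : ∀ n → rowCount t r rest n ℕ.≤ rowCount t r rest (suc n)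
  step-≥ n with h (suc n) ℕ.≟ t
  ... | yes e = ℕ.≤-trans (ℕ.n≤1+n _) (ℕ.≤-reflexive (sym (hit n e)))
  ... | no ne = ℕ.≤-reflexive (sym (miss n ne))

  -- In these columns the arm alone has length at least t. Hence only the last t cells of a row can
  -- have hook length t, and for t = 1, 2 one or two cells are left to inspect.
  no-hits : ∀ n → n ℕ.+ t ℕ.≤ r → rowCount t r rest n ≡ 0
  no-hits zero    _    = refl
  no-hits (suc n) n+t≤ = trans (miss n λ e → ℕ.<⇒≢ (bound) (sym e)) (no-hits n (ℕ.≤-trans (ℕ.n≤1+n _) n+t≤))
    where
    bound : t ℕ.< h (suc n)
    bound = ℕ.≤-trans (ℕ.s≤s (ℕ.≤-trans (ℕ.≤-trans (ℕ.≤-reflexive (sym (ℕ.m+n∸m≡n (suc n) t))) (ℕ.∸-monoˡ-≤ (suc n) n+t≤))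
      (ℕ.m≤m+n (r ℕ.∸ suc n) (conj rest (suc n))))) (ℕ.≤-reflexive (ℕ.+-comm 1 _))

conj-beyond : ∀ {m j λs} → Decreasing m λs → m ℕ.< j → conj λs j ≡ 0
conj-beyond []                          _   = refl
conj-beyond {j = j} (_∷_ {k = k} k<m d) m<j =
  trans (cong length (List.filter-reject (j ℕ.≤?_) (λ j≤ → ℕ.<⇒≱ m<j (ℕ.≤-trans j≤ k<m))))
    (conj-beyond d (ℕ.≤-trans (ℕ.s≤s k<m) m<j))

conj-within : ∀ {s j} μ → j ℕ.≤ s → conj (s ∷ μ) j ≡ suc (conj μ j)
conj-within {s} {j} μ j≤s = cong length (List.filter-accept (j ℕ.≤?_) j≤s)

private
  h-end : ∀ t r rest → Row.h t r rest r ≡ conj rest r ℕ.+ 1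
  h-end t r rest = cong (λ x → x ℕ.+ conj rest r ℕ.+ 1) (ℕ.n∸n≡0 r)

  h-before : ∀ t k rest → Row.h t (2 ℕ.+ k) rest (suc k) ≡ suc (conj rest (suc k) ℕ.+ 1)
  h-before t k rest = cong (λ x → x ℕ.+ conj rest (suc k) ℕ.+ 1) (trans (ℕ.+-∸-assoc 1 (ℕ.≤-refl {k})) (cong suc (ℕ.n∸n≡0 k)))

row₁≤1 : ∀ k rest → rowCount 1 (suc k) rest (suc k) ℕ.≤ 1
row₁≤1 k rest = ℕ.≤-trans (Row.step-≤ 1 (suc k) rest k)
  (ℕ.≤-reflexive (cong suc (Row.no-hits 1 (suc k) rest k (ℕ.≤-reflexive (ℕ.+-comm k 1)))))

row₁-new : ∀ {k rest} → Decreasing k rest → rowCount 1 (suc k) rest (suc k) ≡ 1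
row₁-new {k} {rest} d = trans
  (Row.hit 1 (suc k) rest k (trans (h-end 1 (suc k) rest) (cong (ℕ._+ 1) (conj-beyond d ℕ.≤-refl))))
  (cong suc (Row.no-hits 1 (suc k) rest k (ℕ.≤-reflexive (ℕ.+-comm k 1))))

row₁-old : ∀ k μ → rowCount 1 (suc k) (suc k ∷ μ) (suc k) ≡ 0
row₁-old k μ = trans
  (Row.miss 1 (suc k) (suc k ∷ μ) k λ e → contradiction (ℕ.suc-injective (trans (sym (cong (ℕ._+ 1) (conj-within {suc k} μ ℕ.≤-refl))) (trans (sym (h-end 1 (suc k) (suc k ∷ μ))) e))))
  (Row.no-hits 1 (suc k) (suc k ∷ μ) k (ℕ.≤-reflexive (ℕ.+-comm k 1)))
  where
  contradiction : ∀ {n} → n ℕ.+ 1 ≡ 0 → ⊥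
  contradiction {n} e with () ← trans (ℕ.+-comm 1 n) e

row₂-new : ∀ {k rest} → Decreasing k rest → rowCount 2 (suc k) rest (suc k) ℕ.≤ 1
row₂-new {k} {rest} d = ℕ.≤-trans
  (ℕ.≤-reflexive (Row.miss 2 (suc k) rest k λ e → contradiction (trans (sym (trans (h-end 2 (suc k) rest) (cong (ℕ._+ 1) (conj-beyond d ℕ.≤-refl)))) e)))
  (before k)
  where
  contradiction : 1 ≡ 2 → ⊥
  contradiction ()
  before : ∀ k → rowCount 2 (suc k) rest k ℕ.≤ 1
  before zero    = ℕ.z≤n
  before (suc k) = ℕ.≤-trans (Row.step-≤ 2 (2 ℕ.+ k) rest k) (ℕ.≤-reflexive (cong suc (Row.no-hits 2 (2 ℕ.+ k) rest k (ℕ.≤-reflexive (ℕ.+-comm k 2)))))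

row₂-gap : ∀ {k rest} → Decreasing k rest → 1 ℕ.≤ rowCount 2 (2 ℕ.+ k) rest (2 ℕ.+ k)
row₂-gap {k} {rest} d = ℕ.≤-trans (ℕ.≤-trans (ℕ.s≤s ℕ.z≤n)
    (ℕ.≤-reflexive (sym (Row.hit 2 (2 ℕ.+ k) rest k (trans (h-before 2 k rest) (cong (λ c → suc (c ℕ.+ 1)) (conj-beyond d ℕ.≤-refl)))))))
  (Row.step-≥ 2 (2 ℕ.+ k) rest (suc k))

row₂-double : ∀ {k μ} → Decreasing k μ → 1 ℕ.≤ rowCount 2 (suc k) (suc k ∷ μ) (suc k)
row₂-double {k} {μ} d = ℕ.≤-trans (ℕ.s≤s ℕ.z≤n) (ℕ.≤-reflexive (sym (Row.hit 2 (suc k) (suc k ∷ μ) k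
  (trans (h-end 2 (suc k) (suc k ∷ μ)) (cong (ℕ._+ 1) (trans (conj-within {suc k} μ ℕ.≤-refl) (cong suc (conj-beyond d ℕ.≤-refl))))))))

gap2-∷ : ∀ {k λs} → Decreasing (suc k) λs → gap2 (suc k ∷ λs) ≡ true → Decreasing k λs × gap2 λs ≡ true
gap2-∷ []                       _ = [] , refl
gap2-∷ {k} (_∷_ {k = l} l<k d) g with suc l ℕ.+ 2 ℕ.≤ᵇ suc k in e
... | true = ℕ.≤-trans (ℕ.m≤m+n (suc l) 1) (ℕ.s≤s⁻¹ (subst (ℕ._≤ suc k) (ℕ.+-suc (suc l) 1) (ℕ.≤ᵇ⇒≤ _ _ (subst Bool.T (sym e) _)))) ∷ d , g

hookCount₁-gap2 : ∀ {m λs} → Decreasing m λs → gap2 λs ≡ true → hookCount 1 λs ≡ length λs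
hookCount₁-gap2 []       _ = refl
hookCount₁-gap2 (_ ∷ d) g = let d′ , g′ = gap2-∷ d g in cong₂ ℕ._+_ (row₁-new d′) (hookCount₁-gap2 d g′)

hookCount₂-gap2 : ∀ {m λs} → Decreasing m λs → gap2 λs ≡ true → hookCount 2 λs ℕ.≤ length λs
hookCount₂-gap2 []       _ = ℕ.z≤n
hookCount₂-gap2 (_ ∷ d) g = let d′ , g′ = gap2-∷ d g in ℕ.+-mono-≤ (row₂-new d′) (hookCount₂-gap2 d g′)

-- In a decreasing list it suffices to look at the next part: `new` marks the last row among those
-- with equal part, and `double` the last but one.
new : ℕ → List ℕ → ℕ
new r []      = 1
new r (s ∷ _) = if s ℕ.<ᵇ r then 1 else 0

double : ℕ → List ℕ → ℕ
double r []      = 0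
double r (s ∷ μ) = if s ℕ.≡ᵇ r then new r μ else 0

distinct : List ℕ → ℕ
distinct []         = 0
distinct (r ∷ rest) = new r rest ℕ.+ distinct rest

data NewCase (k : ℕ) : List ℕ → Set where
  isNew : ∀ {λs} → Decreasing k λs → new (suc k) λs ≡ 1 → NewCase k λs
  isOld : ∀ {μ} → Decreasing (suc k) μ → new (suc k) (suc k ∷ μ) ≡ 0 → NewCase k (suc k ∷ μ)

<ᵇ-true : ∀ {m n} → m ℕ.< n → (m ℕ.<ᵇ n) ≡ true
<ᵇ-true {m} {n} m<n with m ℕ.<ᵇ n | ℕ.<⇒<ᵇ m<n
... | true | _ = refl

<ᵇ-irrefl : ∀ n → (n ℕ.<ᵇ n) ≡ false
<ᵇ-irrefl zero    = refl
<ᵇ-irrefl (suc n) = <ᵇ-irrefl n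

≡ᵇ-refl : ∀ n → (n ℕ.≡ᵇ n) ≡ true
≡ᵇ-refl zero    = refl
≡ᵇ-refl (suc n) = ≡ᵇ-refl n

≡ᵇ-false : ∀ {m n} → m ℕ.< n → (m ℕ.≡ᵇ n) ≡ false
≡ᵇ-false {zero}  {suc n} _             = refl
≡ᵇ-false {suc m} {suc n} (ℕ.s≤s m<n) = ≡ᵇ-false m<n

new-Decreasing : ∀ {k λs} → Decreasing k λs → new (suc k) λs ≡ 1
new-Decreasing []       = refl
new-Decreasing (l<k ∷ _) = cong (if_then 1 else 0) (<ᵇ-true (ℕ.s≤s l<k))

new? : ∀ {k λs} → Decreasing (suc k) λs → NewCase k λs
new? [] = isNew [] refl
new? {k} (_∷_ {k = l} l<1+k d) with ℕ.m≤n⇒m<n∨m≡n (ℕ.s≤s⁻¹ l<1+k)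
... | Sum.inj₁ l<k  = isNew (l<k ∷ d) (new-Decreasing (l<k ∷ d))
... | Sum.inj₂ refl = isOld d (cong (if_then 1 else 0) (<ᵇ-irrefl k))

hookCount₁-distinct : ∀ {m λs} → Decreasing m λs → hookCount 1 λs ℕ.≤ distinct λs
hookCount₁-distinct [] = ℕ.z≤n
hookCount₁-distinct (_∷_ {k = k} _ d) = ℕ.+-mono-≤ (row (new? d)) (hookCount₁-distinct d)
  where
  row : ∀ {λs} → NewCase k λs → rowCount 1 (suc k) λs (suc k) ℕ.≤ new (suc k) λs
  row {λs} (isNew d e)     = ℕ.≤-trans (row₁≤1 k λs) (ℕ.≤-reflexive (sym e))
  row (isOld {μ} d e) = ℕ.≤-trans (ℕ.≤-reflexive (row₁-old k μ)) ℕ.z≤n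

isPart : ℕ → Bool
isPart k = (k ℕ.% 5 ℕ.≡ᵇ 1) ∨ (k ℕ.% 5 ℕ.≡ᵇ 4)

isPart-5+ : ∀ n → isPart (5 ℕ.+ n) ≡ isPart n
isPart-5+ n = cong (λ x → (x ℕ.≡ᵇ 1) ∨ (x ℕ.≡ᵇ 4)) (trans (cong (ℕ._% 5) (ℕ.+-comm 5 n)) (ℕ.[m+n]%n≡m%n n 5))

-- The residues 1 and 4 are not neighbours modulo 5. So below the last row with part r every part is
-- at most r - 2, and the last but one cell of that row, if r ≥ 2, has an arm of length 1 and no
-- leg.
isPart-gap : ∀ n → isPart n ≡ true → isPart (suc n) ≡ true → ⊥
isPart-gap 0 () _
isPart-gap 1 _ ()
isPart-gap 2 () _
isPart-gap 3 () _
isPart-gap 4 _ ()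
isPart-gap (suc (suc (suc (suc (suc n))))) p p′ =
  isPart-gap n (trans (sym (isPart-5+ n)) p) (trans (sym (isPart-5+ (suc n))) p′)

-- A row of length 1 has no cell before its last one.
big : ℕ → ℕ
big 0 = 0
big 1 = 0
big (suc (suc _)) = 1

-- The 2-hooks of a row: one if it is the last row with a part r ≥ 2 (the smaller parts then
-- being ≤ r − 2), and one if it is the last but one with its part.
twoHooks : List ℕ → ℕ
twoHooks []         = 0
twoHooks (r ∷ rest) = big r ℕ.* new r rest ℕ.+ double r rest ℕ.+ twoHooks rest

∧-true : ∀ {b c} → b ∧ c ≡ true → b ≡ true × c ≡ true
∧-true {true} {true} _ = refl , refl

double-Decreasing : ∀ {k λs} → Decreasing k λs → double (suc k) λs ≡ 0
double-Decreasing []                          = refl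
double-Decreasing {k} (_∷_ {λs = μ} l<k d) = cong (if_then new (suc k) μ else 0) (≡ᵇ-false (ℕ.s≤s l<k))

mod14-Decreasing : ∀ {k λs} → Decreasing (suc k) λs → isPart (2 ℕ.+ k) ≡ true → mod14 λs ≡ true → Decreasing k λs
mod14-Decreasing []                       _ _ = []
mod14-Decreasing {k} (_∷_ {k = l} l<1+k d) p g with ℕ.m≤n⇒m<n∨m≡n (ℕ.s≤s⁻¹ l<1+k)
... | Sum.inj₁ l<k  = l<k ∷ d
... | Sum.inj₂ refl = ⊥-elim (isPart-gap (suc k) (proj₁ (∧-true g)) p)

row₂-≥ : ∀ k {λs} → isPart (suc k) ≡ true → mod14 λs ≡ true → NewCase k λs →
         big (suc k) ℕ.* new (suc k) λs ℕ.+ double (suc k) λs ℕ.≤ rowCount 2 (suc k) λs (suc k)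
row₂-≥ zero    p g (isNew d e) = ℕ.≤-trans (ℕ.≤-reflexive (double-Decreasing d)) ℕ.z≤n
row₂-≥ (suc k) p g (isNew d e) = ℕ.≤-trans (ℕ.≤-reflexive (cong₂ (λ x y → 1 ℕ.* x ℕ.+ y) e (double-Decreasing d)))
  (row₂-gap (mod14-Decreasing d p g))
row₂-≥ k p g (isOld {μ} d e) = subst (ℕ._≤ row) (sym (trans (cong (ℕ._+ double (suc k) (suc k ∷ μ)) (trans (cong (big (suc k) ℕ.*_) e) (ℕ.*-zeroʳ (big (suc k)))))
    (cong (if_then new (suc k) μ else 0) (≡ᵇ-refl k)))) (go (new? d))
  where
  row = rowCount 2 (suc k) (suc k ∷ μ) (suc k)
  go : ∀ {μ} → NewCase k μ → new (suc k) μ ℕ.≤ rowCount 2 (suc k) (suc k ∷ μ) (suc k)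
  go (isNew d e) = ℕ.≤-trans (ℕ.≤-reflexive e) (row₂-double d)
  go (isOld d e) = ℕ.≤-trans (ℕ.≤-reflexive e) ℕ.z≤n

hookCount₂-mod14 : ∀ {m λs} → Decreasing m λs → mod14 λs ≡ true → twoHooks λs ℕ.≤ hookCount 2 λs
hookCount₂-mod14 [] _ = ℕ.z≤n
hookCount₂-mod14 (_∷_ {k = k} _ d) g = let p , g′ = ∧-true g in
  ℕ.+-mono-≤ (row₂-≥ k p g′ (new? d)) (hookCount₂-mod14 d g′)

-- Generating functions of hook numbers

restrict : (List ℕ → Bool) → (List ℕ → ℕ) → List ℕ → ℕ
restrict p w λs = if p λs then w λs else 0

private
  if-+ : ∀ b x y → (if b then x ℕ.+ y else 0) ≡ (if b then x else 0) ℕ.+ (if b then y else 0)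
  if-+ true  x y = refl
  if-+ false x y = refl

  if-0 : ∀ b → (if b then 0 else 0) ≡ 0
  if-0 true  = refl
  if-0 false = refl

  solve-geo : ∀ m {X A} → X ≈ A ⊕ q ^ suc m ⊛ X → X ≈ A ⊛ geo m
  solve-geo m {X} {A} e = by-combination (geo m · e ∔ ⊝ X · geo-rec m ∔ none)
    (solve 4 (λ X A x g → X :- A :* g := g :* (X :- (A :+ x :* X)) :+ (:- X :* (g :- (con 1ℤ :+ x :* g)) :+ con 0ℤ))
      refl X A (q ^ suc m) (geo m))

P : ℕ → Series
P zero    = one
P (suc m) = if isPart (suc m) then P m ⊛ geo m else P m

count₁₄-rec : ∀ w m → count (restrict mod14 w) (suc m) ≈ count (restrict mod14 w) m
  ⊕ q ^ suc m ⊛ (if isPart (suc m) then count (restrict mod14 (λ λs → w (suc m ∷ λs))) (suc m) else ⟪ 0ℤ ⟫)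
count₁₄-rec w m = ≈-trans (count-rec (restrict mod14 w) m)
    (+-congˡ {count (restrict mod14 w) m} (*-congˡ {q ^ suc m} (go (isPart (suc m)) refl)))
  where
  go : ∀ b → isPart (suc m) ≡ b → count (λ λs → restrict mod14 w (suc m ∷ λs)) (suc m)
     ≈ (if b then count (restrict mod14 (λ λs → w (suc m ∷ λs))) (suc m) else ⟪ 0ℤ ⟫)
  go true  e = count-cong (suc m) (λ {λs} _ → cong (λ b → if b ∧ mod14 λs then w (suc m ∷ λs) else 0) e)
  go false e = ≈-trans (count-cong (suc m) (λ {λs} _ → cong (λ b → if b ∧ mod14 λs then w (suc m ∷ λs) else 0) e)) (count-zero (suc m))

count-P : ∀ m → count (restrict mod14 (λ _ → 1)) m ≈ P m
count-P zero    = count-0 _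
count-P (suc m) = go (isPart (suc m)) (count₁₄-rec (λ _ → 1) m)
  where
  X = count (restrict mod14 (λ _ → 1)) (suc m)
  go : ∀ b → X ≈ count (restrict mod14 (λ _ → 1)) m ⊕ q ^ suc m ⊛ (if b then X else ⟪ 0ℤ ⟫) → X ≈ (if b then P m ⊛ geo m else P m)
  go true  e = solve-geo m (≈-trans e (+-congʳ {q ^ suc m ⊛ X} (count-P m)))
  go false e = ≈-trans e (≈-trans (+-congʳ {q ^ suc m ⊛ ⟪ 0ℤ ⟫} (count-P m))
    (solve 2 (λ p x → p :+ x :* con 0ℤ := p) refl (P m) (q ^ suc m)))

private
  if-const : ∀ b {x : Series} → x ≈ ⟪ 0ℤ ⟫ → (if b then x else ⟪ 0ℤ ⟫) ≈ ⟪ 0ℤ ⟫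
  if-const true  e = e
  if-const false e = ≈-refl

count-new : ∀ m → count (restrict mod14 (new (suc m))) (suc m) ≈ P m
count-new m = ≈-trans (count₁₄-rec (new (suc m)) m) (≈-trans
  (+-cong (≈-trans (count-cong m (λ {λs} d → cong (if mod14 λs then_else 0) (new-Decreasing d))) (count-P m))
    (*-congˡ {q ^ suc m} (if-const (isPart (suc m)) (≈-trans
      (count-cong (suc m) (λ {λs} _ → trans (cong (λ b → if mod14 λs then (if b then 1 else 0) else 0) (<ᵇ-irrefl m)) (if-0 (mod14 λs))))
      (count-zero (suc m))))))
  (solve 2 (λ p x → p :+ x :* con 0ℤ := p) refl (P m) (q ^ suc m)))

count-double : ∀ m → isPart (suc m) ≡ true → count (restrict mod14 (double (suc m))) (suc m) ≈ q ^ suc m ⊛ P m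
count-double m e = ≈-trans (count₁₄-rec (double (suc m)) m) (≈-trans
  (+-cong (≈-trans (count-cong m (λ {λs} d → trans (cong (if mod14 λs then_else 0) (double-Decreasing d)) (if-0 (mod14 λs)))) (count-zero m))
    (*-congˡ {q ^ suc m} (≈-trans (≈-reflexive (cong (if_then count (restrict mod14 (λ λs → double (suc m) (suc m ∷ λs))) (suc m) else ⟪ 0ℤ ⟫) e))
      (≈-trans (count-cong (suc m) (λ {λs} _ → cong (λ b → if mod14 λs then (if b then new (suc m) λs else 0) else 0) (≡ᵇ-refl m)))
        (count-new m)))))
  (+-identityˡ _))

-- The statistics divided by `P m`. Among the partitions into admissible parts up to m, those
-- containing r make up q^r `P m`, and those containing r at least twice q^(2r) `P m`.
σ τ : ℕ → Series
σ zero    = ⟪ 0ℤ ⟫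
σ (suc m) = if isPart (suc m) then σ m ⊕ q ^ suc m else σ m
τ zero    = ⟪ 0ℤ ⟫
τ (suc m) = if isPart (suc m) then τ m ⊕ q ^ suc m ⊛ (⟪ + big (suc m) ⟫ ⊕ q ^ suc m) else τ m

private
  -- When m + 1 is admissible, a further part m + 1 raises `w` by a quantity with generating
  -- function P m · S, so the count reappears on the right of its own equation. Solving for it gives
  -- the factor `geo m` of `P (suc m)`, and only the second factor gains q^(m+1) S.
  additive : ∀ w m {Y S} → count (restrict mod14 w) m ≈ P m ⊛ Y →
    (isPart (suc m) ≡ true → count (restrict mod14 (λ λs → w (suc m ∷ λs))) (suc m) ≈ P m ⊛ S ⊕ count (restrict mod14 w) (suc m)) →
    count (restrict mod14 w) (suc m) ≈ P (suc m) ⊛ (if isPart (suc m) then Y ⊕ q ^ suc m ⊛ S else Y)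
  additive w m {Y} {S} ih row = go (isPart (suc m)) row (count₁₄-rec w m)
    where
    X = count (restrict mod14 w) (suc m)
    C = count (restrict mod14 (λ λs → w (suc m ∷ λs))) (suc m)
    go : ∀ b → (b ≡ true → C ≈ P m ⊛ S ⊕ X) → X ≈ count (restrict mod14 w) m ⊕ q ^ suc m ⊛ (if b then C else ⟪ 0ℤ ⟫) →
         X ≈ (if b then P m ⊛ geo m else P m) ⊛ (if b then Y ⊕ q ^ suc m ⊛ S else Y)
    go true  row e = ≈-trans (solve-geo m {X} {P m ⊛ Y ⊕ q ^ suc m ⊛ (P m ⊛ S)}
        (by-combination (one · e ∔ one · ih ∔ q ^ suc m · row refl ∔ none)
          (solve 7 (λ X c x C p S Y → X :- (p :* Y :+ x :* (p :* S) :+ x :* X)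
              := con 1ℤ :* (X :- (c :+ x :* C)) :+ (con 1ℤ :* (c :- p :* Y) :+ (x :* (C :- (p :* S :+ X)) :+ con 0ℤ)))
            refl X (count (restrict mod14 w) m) (q ^ suc m) C (P m) S Y)))
      (solve 5 (λ p g x S Y → (p :* Y :+ x :* (p :* S)) :* g := p :* g :* (Y :+ x :* S)) refl (P m) (geo m) (q ^ suc m) S Y)
    go false row e = ≈-trans e (≈-trans (+-congʳ {q ^ suc m ⊛ ⟪ 0ℤ ⟫} ih)
      (solve 3 (λ p x Y → p :* Y :+ x :* con 0ℤ := p :* Y) refl (P m) (q ^ suc m) Y))

count-distinct : ∀ m → count (restrict mod14 distinct) m ≈ P m ⊛ σ m
count-distinct zero    = ≈-trans (count-0 _) (solve 0 (con 0ℤ := con 1ℤ :* con 0ℤ) refl)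
count-distinct (suc m) = ≈-trans
  (additive distinct m {S = one} (count-distinct m) (λ _ → ≈-trans
    (count-cong (suc m) (λ {λs} _ → if-+ (mod14 λs) (new (suc m) λs) (distinct λs)))
    (≈-trans (count-+ (restrict mod14 (new (suc m))) (restrict mod14 distinct) (suc m))
      (+-congʳ {count (restrict mod14 distinct) (suc m)} (≈-trans (count-new m) (≈-sym (*-identityʳ (P m))))))))
  (*-congˡ {P (suc m)} (go (isPart (suc m))))
  where
  go : ∀ b → (if b then σ m ⊕ q ^ suc m ⊛ one else σ m) ≈ (if b then σ m ⊕ q ^ suc m else σ m)
  go true  = +-congˡ {σ m} (*-identityʳ (q ^ suc m))
  go false = ≈-refl

count-twoHooks : ∀ m → count (restrict mod14 twoHooks) m ≈ P m ⊛ τ m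
count-twoHooks zero    = ≈-trans (count-0 _) (solve 0 (con 0ℤ := con 1ℤ :* con 0ℤ) refl)
count-twoHooks (suc m) = additive twoHooks m (count-twoHooks m) λ e → ≈-trans
    (count-cong (suc m) (λ {λs} _ → trans (if-+ (mod14 λs) (b* λs ℕ.+ double (suc m) λs) (twoHooks λs))
      (cong (ℕ._+ restrict mod14 twoHooks λs) (if-+ (mod14 λs) (b* λs) (double (suc m) λs)))))
    (≈-trans (count-+ (λ λs → restrict mod14 b* λs ℕ.+ restrict mod14 (double (suc m)) λs) (restrict mod14 twoHooks) (suc m))
      (+-congʳ {count (restrict mod14 twoHooks) (suc m)} (≈-trans (count-+ (restrict mod14 b*) (restrict mod14 (double (suc m))) (suc m))
        (≈-trans (+-cong (scaled m) (count-double m e))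
          (solve 3 (λ b p x → b :* p :+ x :* p := p :* (b :+ x)) refl ⟪ + big (suc m) ⟫ (P m) (q ^ suc m))))))
  where
  b* : List ℕ → ℕ
  b* λs = big (suc m) ℕ.* new (suc m) λs
  scaled : ∀ m → count (restrict mod14 (λ λs → big (suc m) ℕ.* new (suc m) λs)) (suc m) ≈ ⟪ + big (suc m) ⟫ ⊛ P m
  scaled zero    = ≈-trans (count-cong 1 (λ {λs} _ → if-0 (mod14 λs))) (≈-trans (count-zero 1) (≈-sym (zeroˡ one)))
  scaled (suc m) = ≈-trans (count-cong (2 ℕ.+ m) (λ {λs} _ → cong (if mod14 λs then_else 0) (ℕ.*-identityˡ (new (2 ℕ.+ m) λs))))
    (≈-trans (count-new (suc m)) (≈-sym (*-identityˡ (P (suc m)))))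

private
  gap2-head-true : ∀ {m λs} → Decreasing (m ℕ.∸ 1) λs → gap2 (suc m ∷ λs) ≡ gap2 λs
  gap2-head-true [] = refl
  gap2-head-true {suc m} (_∷_ {k = l} {λs = λs} l<m d) = cong (_∧ gap2 (suc l ∷ λs))
    (≤ᵇ-true (subst (ℕ._≤ 2 ℕ.+ m) (ℕ.+-comm 2 (suc l)) (ℕ.s≤s (ℕ.s≤s l<m))))
    where
    ≤ᵇ-true : ∀ {m n} → m ℕ.≤ n → (m ℕ.≤ᵇ n) ≡ true
    ≤ᵇ-true {m} {n} m≤n with m ℕ.≤ᵇ n | ℕ.≤⇒≤ᵇ m≤n
    ... | true | _ = refl

  gap2-head-false : ∀ {m l λs} → m ℕ.≤ suc l → gap2 (suc m ∷ suc l ∷ λs) ≡ false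
  gap2-head-false {m} {l} {λs} m≤1+l = cong (_∧ gap2 (suc l ∷ λs)) (≤ᵇ-false (λ h → ℕ.<⇒≱ (ℕ.s≤s (ℕ.s≤s m≤1+l))
      (ℕ.≤-trans (ℕ.≤-reflexive (ℕ.+-comm 2 (suc l))) h)))
    where
    ≤ᵇ-false : ∀ {m n} → (m ℕ.≤ n → ⊥) → (m ℕ.≤ᵇ n) ≡ false
    ≤ᵇ-false {m} {n} f with m ℕ.≤ᵇ n in e
    ... | true  = ⊥-elim (f (ℕ.≤ᵇ⇒≤ m n (subst Bool.T (sym e) _)))
    ... | false = refl

  count-drop : ∀ ψ m → (∀ λs → ψ (suc m ∷ λs) ≡ 0) → count ψ (suc m) ≈ count ψ m
  count-drop ψ m z = ≈-trans (count-rec ψ m) (≈-trans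
    (+-congˡ {count ψ m} (*-congˡ {q ^ suc m} (≈-trans (count-cong (suc m) (λ {λs} _ → z λs)) (count-zero (suc m)))))
    (solve 2 (λ c x → c :+ x :* con 0ℤ := c) refl (count ψ m) (q ^ suc m)))

-- Below a part m + 1 the parts are at most m - 1. The truncated subtraction is right for m = 0 as
-- well: nothing can follow a part 1.
count-gap2-row : ∀ w m → count (λ λs → if gap2 (suc m ∷ λs) then w λs else 0) (suc m) ≈ count (restrict gap2 w) (m ℕ.∸ 1)
count-gap2-row w m = ≈-trans (count-drop ψ m (far m (ℕ.n≤1+n m))) (≈-trans (lower m refl)
    (count-cong (m ℕ.∸ 1) (λ {λs} d → cong (if_then w λs else 0) (gap2-head-true d))))
  where
  ψ : List ℕ → ℕ
  ψ λs = if gap2 (suc m ∷ λs) then w λs else 0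
  far : ∀ l → m ℕ.≤ suc l → ∀ λs → ψ (suc l ∷ λs) ≡ 0
  far l m≤1+l λs = cong (if_then w (suc l ∷ λs) else 0) (gap2-head-false {m} {l} {λs} m≤1+l)
  lower : ∀ k → k ≡ m → count ψ k ≈ count ψ (k ℕ.∸ 1)
  lower zero    _ = ≈-refl
  lower (suc k) e = count-drop ψ k (far k (ℕ.≤-reflexive (sym e)))

γ ℓ : ℕ → Series
γ = count (restrict gap2 (λ _ → 1))
ℓ = count (restrict gap2 length)

γ-rec : ∀ m → γ (suc m) ≈ γ m ⊕ q ^ suc m ⊛ γ (m ℕ.∸ 1)
γ-rec m = ≈-trans (count-rec (restrict gap2 (λ _ → 1)) m) (+-congˡ {γ m} (*-congˡ {q ^ suc m} (count-gap2-row (λ _ → 1) m)))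

ℓ-rec : ∀ m → ℓ (suc m) ≈ ℓ m ⊕ q ^ suc m ⊛ (γ (m ℕ.∸ 1) ⊕ ℓ (m ℕ.∸ 1))
ℓ-rec m = ≈-trans (count-rec (restrict gap2 length) m) (+-congˡ {ℓ m} (*-congˡ {q ^ suc m} (≈-trans
  (count-cong (suc m) (λ {λs} _ → if-+ (gap2 (suc m ∷ λs)) 1 (length λs)))
  (≈-trans (count-+ (λ λs → if gap2 (suc m ∷ λs) then 1 else 0) (λ λs → if gap2 (suc m ∷ λs) then length λs else 0) (suc m))
    (+-cong (count-gap2-row (λ _ → 1) m) (count-gap2-row length m))))))

-- Cutting a partition between the parts ≤ k and the parts > k.
L-cut : ∀ k → L 0 ≈ ℓ k ⊛ G (suc k) ⊕ γ k ⊛ L (suc k)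
  ⊕ q ^ suc k ⊛ ((γ (k ℕ.∸ 1) ⊕ ℓ (k ℕ.∸ 1)) ⊛ G (2 ℕ.+ k) ⊕ γ (k ℕ.∸ 1) ⊛ L (2 ℕ.+ k))
L-cut zero    = by-combination (one · L-rec 0 ∔ ⊝ (L 1 ⊕ q ^ 1 ⊛ (G 2 ⊕ L 2)) · count-0 (restrict gap2 (λ _ → 1))
    ∔ ⊝ (G 1 ⊕ q ^ 1 ⊛ G 2) · count-0 (restrict gap2 length) ∔ none)
  (solve 8 (λ l l₁ l₂ g₁ g₂ x c d → let one = con 1ℤ in
      l :- (d :* g₁ :+ c :* l₁ :+ x :* ((c :+ d) :* g₂ :+ c :* l₂))
    := one :* (l :- (l₁ :+ x :* l₂ :+ x :* g₂)) :+ (:- (l₁ :+ x :* (g₂ :+ l₂)) :* (c :- one) :+ (:- (g₁ :+ x :* g₂) :* (d :- con 0ℤ) :+ con 0ℤ)))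
    refl (L 0) (L 1) (L 2) (G 1) (G 2) (q ^ 1) (γ 0) (ℓ 0))
L-cut (suc k) = by-combination
    ( one · L-cut k ∔ ℓ k · G-rec (suc k) ∔ γ k · L-rec (suc k)
    ∔ ⊝ L (2 ℕ.+ k) · γ-rec k ∔ ⊝ G (2 ℕ.+ k) · ℓ-rec k ∔ none)
  (solve 15 (λ l l₁ l₂ l₃ g₁ g₂ g₃ q x c c′ c₁ d d′ d₁ → let one = con 1ℤ in
      l :- (d₁ :* g₂ :+ c₁ :* l₂ :+ q :* x :* ((c :+ d) :* g₃ :+ c :* l₃))
    := one :* (l :- (d :* g₁ :+ c :* l₁ :+ x :* ((c′ :+ d′) :* g₂ :+ c′ :* l₂)))
       :+ (d :* (g₁ :- (g₂ :+ q :* x :* g₃)) :+ (c :* (l₁ :- (l₂ :+ q :* x :* l₃ :+ q :* x :* g₃))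
       :+ (:- l₂ :* (c₁ :- (c :+ x :* c′)) :+ (:- g₂ :* (d₁ :- (d :+ x :* (c′ :+ d′))) :+ con 0ℤ)))))
    refl (L 0) (L (suc k)) (L (2 ℕ.+ k)) (L (3 ℕ.+ k)) (G (suc k)) (G (2 ℕ.+ k)) (G (3 ℕ.+ k)) q (q ^ suc k)
    (γ k) (γ (k ℕ.∸ 1)) (γ (suc k)) (ℓ k) (ℓ (k ℕ.∸ 1)) (ℓ (suc k)))

ℓ-agrees : ∀ n → ℓ n ≈[ n ] L 0
ℓ-agrees n = ≈[]-sym n (≈[]-trans n (≈⇒≈[] n (L-cut n)) (≈[]-trans n
  (⊕-cong[] n (⊕-cong[] n (⊛-cong[] n (≈[]-refl n {ℓ n}) (G-lead (suc n) n (ℕ.n≤1+n n))) (⊛-cong[] n (≈[]-refl n {γ n}) (L-lead (suc n) n (ℕ.n≤1+n n))))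
    (shift-vanishes n _))
  (≈⇒≈[] n (solve 2 (λ d c → d :* con 1ℤ :+ c :* con 0ℤ :+ con 0ℤ := d) refl (ℓ n) (γ n)))))

P-step : ∀ m → P (suc m) ≈[ m ] P m
P-step m = go (isPart (suc m))
  where
  go : ∀ b → (if b then P m ⊛ geo m else P m) ≈[ m ] P m
  go false = ≈[]-refl m
  go true  = ≈[]-trans m (≈⇒≈[] m (by-combination (P m · geo-rec m ∔ none)
      (solve 3 (λ p g x → p :* g :- (p :+ x :* (p :* g)) := p :* (g :- (con 1ℤ :+ x :* g)) :+ con 0ℤ) refl (P m) (geo m) (q ^ suc m))))
    (≈[]-trans m (⊕-cong[] m (≈[]-refl m) (shift-vanishes m (P m ⊛ geo m))) (≈⇒≈[] m (+-identityʳ (P m))))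

isPart-+5 : ∀ k n → isPart (k ℕ.+ n ℕ.* 5) ≡ isPart k
isPart-+5 k n = cong (λ x → (x ℕ.≡ᵇ 1) ∨ (x ℕ.≡ᵇ 4)) (ℕ.[m+kn]%n≡m%n k n 5)

P-product₁₄ : ∀ n → P (n ℕ.* 5) ⊛ product₁₄ n ≈ one
P-product₁₄ zero    = *-identityˡ one
P-product₁₄ (suc n) = ≈-trans (*-congʳ {product₁₄ (suc n)} P≈)
  (by-combination (((one ⊖ x) ⊛ g) ⊛ ((one ⊖ y) ⊛ h) · P-product₁₄ n ∔ (one ⊖ y) ⊛ h · inverse₀ ∔ one · inverse₃ ∔ none)
    (solve 6 (λ p r x y g h → let one = con 1ℤ in
        p :* g :* h :* (r :* ((one :- x) :* (one :- y))) :- one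
      := (one :- x) :* g :* ((one :- y) :* h) :* (p :* r :- one) :+ ((one :- y) :* h :* ((one :- x) :* g :- one)
         :+ (one :* ((one :- y) :* h :- one) :+ con 0ℤ)))
      refl (P N) (product₁₄ n) x y g h))
  where
  N = n ℕ.* 5
  g = geo N
  h = geo (3 ℕ.+ N)
  x = q ⊛ Q ^ n
  y = q ^ 4 ⊛ Q ^ n
  P-suc : ∀ k → P (suc k ℕ.+ N) ≈ (if isPart (suc k) then P (k ℕ.+ N) ⊛ geo (k ℕ.+ N) else P (k ℕ.+ N))
  P-suc k = ≈-reflexive (cong (if_then P (k ℕ.+ N) ⊛ geo (k ℕ.+ N) else P (k ℕ.+ N)) (isPart-+5 (suc k) n))
  P≈ : P (5 ℕ.+ N) ≈ P N ⊛ g ⊛ h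
  P≈ = ≈-trans (P-suc 4) (≈-trans (P-suc 3) (*-congʳ {h} (≈-trans (P-suc 2) (≈-trans (P-suc 1) (P-suc 0)))))
  inverse₀ : (one ⊖ x) ⊛ g ≈ one
  inverse₀ = proj₂ (Unit-1-q N (*-congˡ {q} (≈-sym (q^5n≈ n))))
  inverse₃ : (one ⊖ y) ⊛ h ≈ one
  inverse₃ = proj₂ (Unit-1-q (3 ℕ.+ N) (≈-trans (*-congˡ {q ^ 4} (≈-sym (q^5n≈ n))) (≈-sym (^-homo-* q 4 N))))

P-agrees-G : ∀ n → P n ≈[ n ] G 0
P-agrees-G n = ≈[]-trans n (≈[]-sym n (stable P P-step n≤N))
  (≈[]-trans n (≈⇒≈[] n (≈-sym (*-identityʳ (P N))))
  (≈[]-trans n (⊛-cong[] n (≈[]-refl n {P N}) (≈[]-sym n (rogers-ramanujan n)))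
    (≈⇒≈[] n (by-combination (G 0 · P-product₁₄ k ∔ none)
      (solve 3 (λ p r g → p :* (r :* g) :- g := g :* (p :* r :- con 1ℤ) :+ con 0ℤ) refl (P N) (product₁₄ k) (G 0))))))
  where
  k = suc n ℕ.+ suc n
  N = k ℕ.* 5
  n≤N : n ℕ.≤ N
  n≤N = ℕ.≤-trans (ℕ.≤-trans (ℕ.n≤1+n n) (ℕ.m≤m+n (suc n) (suc n))) (ℕ.m≤m*n k 5)

-- The inequalities between generating functions

-- The q-integer (1 - q^k) / (1 - q). It measures the cost of dropping a power of q: S - q^k S is
-- `bracket k` times `G 0`, hence at most k times `G 0`, the difference being `brackets k` times
-- `drop`.
bracket : ℕ → Series
bracket zero    = ⟪ 0ℤ ⟫
bracket (suc k) = bracket k ⊕ q ^ k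

-- brackets k = (k − bracket k) / (1 − q)
brackets : ℕ → Series
brackets zero    = ⟪ 0ℤ ⟫
brackets (suc k) = brackets k ⊕ bracket k

Pos-bracket : ∀ k → Pos (bracket k)
Pos-bracket zero    = Pos-const 0
Pos-bracket (suc k) = Pos-⊕ (Pos-bracket k) (Pos-x k)

Pos-brackets : ∀ k → Pos (brackets k)
Pos-brackets zero    = Pos-const 0
Pos-brackets (suc k) = Pos-⊕ (Pos-brackets k) (Pos-bracket k)

private
  br brs : ∀ {n} → Expr ℤ n → ℕ → Expr ℤ n
  br q zero     = con 0ℤ
  br q (suc k)  = br q k :+ q ^ₑ k
  brs q zero    = con 0ℤ
  brs q (suc k) = brs q k :+ br q k

  infixl 7 _×′_
  _×′_ : ∀ {n} → ℕ → Expr ℤ n → Expr ℤ n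
  k ×′ e = con (+ k) :* e

infixl 7 _×_∙
_×_∙ : ℕ → Series → Series
k × f ∙ = ⟪ + k ⟫ ⊛ f

Pos-× : ∀ k {f} → Pos f → Pos (k × f ∙)
Pos-× k p = Pos-⊛ (Pos-const k) p

drop : Series
drop = (one ⊖ q) ⊛ G 0

Pos-drop : Pos drop
Pos-drop = Pos-resp (solve 2 (λ q g → let one = con 1ℤ in (one :- q) :* (g :- one) :- q :* one :+ one := (one :- q) :* g) refl q (G 0))
  (Pos-⊕ (Pos-gap 0) (Pos-const 1))

G0-G4 : Pos (G 0 ⊖ G 4)
G0-G4 = Pos-resp (by-combination (⊝ one · G-rec 0 ∔ ⊝ one · G-rec 1 ∔ ⊝ one · G-rec 2 ∔ ⊝ one · G-rec 3 ∔ none)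
    (solve 10 (λ x₁ x₂ x₃ x₄ g₀ g₁ g₂ g₃ g₄ g₅ → let m = :- con 1ℤ in
        x₁ :* g₂ :+ x₂ :* g₃ :+ x₃ :* g₄ :+ x₄ :* g₅ :- (g₀ :- g₄)
      := m :* (g₀ :- (g₁ :+ x₁ :* g₂)) :+ (m :* (g₁ :- (g₂ :+ x₂ :* g₃)) :+ (m :* (g₂ :- (g₃ :+ x₃ :* g₄)) :+ (m :* (g₃ :- (g₄ :+ x₄ :* g₅)) :+ con 0ℤ))))
      refl (q ^ 1) (q ^ 2) (q ^ 3) (q ^ 4) (G 0) (G 1) (G 2) (G 3) (G 4) (G 5)))
  (Pos-⊕ (Pos-⊕ (Pos-⊕ (term⁺ 1) (term⁺ 2)) (term⁺ 3)) (term⁺ 4))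
  where
  term⁺ : ∀ k → Pos (q ^ k ⊛ G (suc k))
  term⁺ k = Pos-⊛ (Pos-x k) (Pos-G (suc k))

G0-G5 : Pos (G 0 ⊖ G 5)
G0-G5 = Pos-resp (by-combination (⊝ one · G-rec 4 ∔ none)
    (solve 5 (λ x g₀ g₄ g₅ g₆ → g₀ :- g₄ :+ x :* g₆ :- (g₀ :- g₅) := :- con 1ℤ :* (g₄ :- (g₅ :+ x :* g₆)) :+ con 0ℤ)
      refl (q ^ 5) (G 0) (G 4) (G 5) (G 6)))
  (Pos-⊕ G0-G4 (Pos-⊛ (Pos-x 5) (Pos-G 6)))

s₅ s₁₀ U V S : Series
s₅  = geo 4
s₁₀ = geo 9
U   = s₁ ⊛ G 4
V   = s₁ ⊛ G 5
S   = s₁ ⊛ G 0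

s₁≈s₂ : s₁ ≈ bracket 2 ⊛ s₂
s₁≈s₂ = by-combination (⊝ s₁ · geo-rec 1 ∔ bracket 2 ⊛ s₂ · s₁-rec ∔ none)
  (solve 3 (λ q s t → let one = con 1ℤ in s :- br q 2 :* t := :- s :* (t :- (one :+ q ^ₑ 2 :* t)) :+ (br q 2 :* t :* (s :- (one :+ q :* s)) :+ con 0ℤ))
    refl q s₁ s₂)

s₁≈s₅ : s₁ ≈ bracket 5 ⊛ s₅
s₁≈s₅ = by-combination (⊝ s₁ · geo-rec 4 ∔ bracket 5 ⊛ s₅ · s₁-rec ∔ none)
  (solve 3 (λ q s t → let one = con 1ℤ in s :- br q 5 :* t := :- s :* (t :- (one :+ q ^ₑ 5 :* t)) :+ (br q 5 :* t :* (s :- (one :+ q :* s)) :+ con 0ℤ))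
    refl q s₁ s₅)

s₁≈s₁₀ : s₁ ≈ bracket 10 ⊛ s₁₀
s₁≈s₁₀ = by-combination (⊝ s₁ · geo-rec 9 ∔ bracket 10 ⊛ s₁₀ · s₁-rec ∔ none)
  (solve 3 (λ q s t → let one = con 1ℤ in s :- br q 10 :* t := :- s :* (t :- (one :+ q ^ₑ 10 :* t)) :+ (br q 10 :* t :* (s :- (one :+ q :* s)) :+ con 0ℤ))
    refl q s₁ s₁₀)

-- `σ̂` is the sum of q^r over r ≡ 1, 4 modulo 5 and `ρ̂` that of q^(2r). The - q in `τ̂` is the
-- exception `big 1` = 0.
σ̂ ρ̂ τ̂ : Series
σ̂ = (q ⊕ q ^ 4) ⊛ s₅
ρ̂ = (q ^ 2 ⊕ q ^ 8) ⊛ s₁₀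
τ̂ = σ̂ ⊕ ρ̂ ⊖ q

W₂ W₄ : Series
W₂ = q ⊛ (s₁ ⊛ G 2)
W₄ = q ^ 4 ⊛ (s₂ ⊛ G 4)

L-bound : Pos (L 0 ⊖ W₂ ⊖ W₄)
L-bound = Pos-resp (solve 4 (λ q l a b →
    l :- q ^ₑ 1 :* a :- q ^ₑ 2 :* q ^ₑ 2 :* b := l :- q :* a :- q ^ₑ 4 :* b) refl q (L 0) (s₁ ⊛ G 2) (s₂ ⊛ G 4)) (Pos-excess 0)

-- 2 / (1 - q²) - 1 / (1 - q) = (1 - q) / (1 - q²), and (1 - q) `G 4` is `gap 4` + 1 - q + q^5. Its
-- only negative term -q is paid for by `G 0`.
W₄-bound : Pos (2 × W₄ ∙ ⊖ q ^ 4 ⊛ U ⊕ G 0)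
W₄-bound = Pos-resp (by-combination (q ^ 4 ⊛ G 4 ⊖ q ^ 4 · s₁≈s₂ ∔ G 0 ⊖ bracket 4 · s₁-rec ∔ none)
    (solve 5 (λ q s t g h → let one = con 1ℤ in
        q ^ₑ 4 :* t :* ((one :- q) :* (h :- one) :- q ^ₑ 5 :+ one :+ q ^ₑ 5) :+ s :* ((one :- q) :* (g :- one) :- q :* one) :+ br q 4 :+ q ^ₑ 4 :* t
          :- (2 ×′ (q ^ₑ 4 :* (t :* h)) :- q ^ₑ 4 :* (s :* h) :+ g)
      := (q ^ₑ 4 :* h :- q ^ₑ 4) :* (s :- br q 2 :* t) :+ ((g :- br q 4) :* (s :- (one :+ q :* s)) :+ con 0ℤ))
      refl q s₁ s₂ (G 0) (G 4)))
  (Pos-⊕ (Pos-⊕ (Pos-⊕ (Pos-⊛ (Pos-⊛ (Pos-x 4) (Pos-geo 1)) (Pos-⊕ (Pos-⊕ (Pos-gap 4) (Pos-const 1)) (Pos-x 5)))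
    (Pos-⊛ (Pos-geo 0) (Pos-gap 0))) (Pos-bracket 4)) (Pos-⊛ (Pos-x 4) (Pos-geo 1)))

-- The first term q of `σ̂` is split off, at a cost of at most 5 `G 0`; the remaining numerator is
-- q^4 + q^6. Each of 1, q, ..., q^4 exceeds q^4 and q^6 by 1 - q times a polynomial with
-- nonnegative coefficients. So does 2 (1 + ... + q^4) exceed 5 (q^4 + q^6), and the factor 1 - q is
-- absorbed into `drop`.
σ̂-bound : Pos (2 × S ∙ ⊕ 5 × G 0 ∙ ⊖ 5 × σ̂ ⊛ G 0 ∙)
σ̂-bound = Pos-resp (by-combination (⊝ (2 × G 0 ∙) · s₁≈s₅ ∔ 5 × q ⊛ G 0 ∙ · geo-rec 4 ∔ none)
    (solve 4 (λ q s t g → let one = con 1ℤ in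
        5 ×′ ((one :- q) :* g) :+ t :* ((one :- q) :* g) :* (br q 4 :+ q :* br q 3 :+ q ^ₑ 2 :* br q 2 :+ q ^ₑ 3 :* br q 1
            :+ (br q 6 :+ q :* br q 5 :+ q ^ₑ 2 :* br q 4 :+ q ^ₑ 3 :* br q 3 :+ q ^ₑ 4 :* br q 2))
          :- (2 ×′ (s :* g) :+ 5 ×′ g :- 5 ×′ ((q :+ q ^ₑ 4) :* t :* g))
      := :- (2 ×′ g) :* (s :- br q 5 :* t) :+ (5 ×′ (q :* g) :* (t :- (one :+ q ^ₑ 5 :* t)) :+ con 0ℤ))
      refl q s₁ s₅ (G 0)))
  (Pos-⊕ (Pos-× 5 Pos-drop) (Pos-⊛ (Pos-⊛ (Pos-geo 4) Pos-drop)
    (Pos-⊕ (Pos-⊕ (Pos-⊕ (Pos-⊕ (Pos-bracket 4) (Pos-⊛ Pos-q (Pos-bracket 3))) (Pos-⊛ (Pos-x 2) (Pos-bracket 2))) (Pos-⊛ (Pos-x 3) (Pos-bracket 1)))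
      (Pos-⊕ (Pos-⊕ (Pos-⊕ (Pos-⊕ (Pos-bracket 6) (Pos-⊛ Pos-q (Pos-bracket 5))) (Pos-⊛ (Pos-x 2) (Pos-bracket 4))) (Pos-⊛ (Pos-x 3) (Pos-bracket 3))) (Pos-⊛ (Pos-x 4) (Pos-bracket 2))))))

-- Fibonacci numbers: with the powers of q replaced by 1, the recurrence gives G 0 = 2 G 2 + G 3 = 3
-- G 3 + 2 G 4 = 5 G 4 + 3 G 5. The replacement only increases the right-hand side.
S-bound : Pos (5 × U ∙ ⊕ 3 × V ∙ ⊖ S)
S-bound = Pos-resp (by-combination (s₁ · G-rec 0 ∔ s₁ · G-rec 1 ∔ s₁ ⊛ bracket 2 · G-rec 2 ∔ s₁ ⊛ bracket 3 · G-rec 3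
      ∔ ⊝ (brackets 5 ⊛ G 4 ⊕ (bracket 4 ⊕ bracket 5 ⊕ bracket 6) ⊛ G 5) · s₁-rec ∔ none)
    (solve 8 (λ q s g₀ g₁ g₂ g₃ g₄ g₅ → let one = con 1ℤ in
        brs q 5 :* g₄ :+ (br q 4 :+ br q 5 :+ br q 6) :* g₅ :- (5 ×′ (s :* g₄) :+ 3 ×′ (s :* g₅) :- s :* g₀)
      := s :* (g₀ :- (g₁ :+ q ^ₑ 1 :* g₂)) :+ (s :* (g₁ :- (g₂ :+ q ^ₑ 2 :* g₃)) :+ (s :* br q 2 :* (g₂ :- (g₃ :+ q ^ₑ 3 :* g₄))
         :+ (s :* br q 3 :* (g₃ :- (g₄ :+ q ^ₑ 4 :* g₅)) :+ (:- (brs q 5 :* g₄ :+ (br q 4 :+ br q 5 :+ br q 6) :* g₅) :* (s :- (one :+ q :* s)) :+ con 0ℤ)))))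
      refl q s₁ (G 0) (G 1) (G 2) (G 3) (G 4) (G 5)))
  (Pos-⊕ (Pos-⊛ (Pos-brackets 5) (Pos-G 4)) (Pos-⊛ (Pos-⊕ (Pos-⊕ (Pos-bracket 4) (Pos-bracket 5)) (Pos-bracket 6)) (Pos-G 5)))

V≤U : Pos (U ⊖ V)
V≤U = Pos-resp (by-combination (⊝ s₁ · G-rec 4 ∔ none)
    (solve 5 (λ s x g₄ g₅ g₆ → s :* (x :* g₆) :- (s :* g₄ :- s :* g₅) := :- s :* (g₄ :- (g₅ :+ x :* g₆)) :+ con 0ℤ)
      refl s₁ (q ^ 5) (G 4) (G 5) (G 6)))
  (Pos-⊛ (Pos-geo 0) (Pos-⊛ (Pos-x 5) (Pos-G 6)))

-- By the recurrence q `G 2` = (q + q^4) `G 4` + q^5 `G 5`. Replacing the three powers of q by 1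
-- costs at most 1 + 4 + 5 = 10 times `G 0`.
W₂-bound : Pos (W₂ ⊖ 2 × U ∙ ⊖ V ⊕ 10 × G 0 ∙)
W₂-bound = Pos-resp (by-combination (⊝ (q ⊛ s₁) · G-rec 2 ∔ ⊝ (q ⊛ s₁) · G-rec 3
      ∔ (bracket 1 ⊕ bracket 4) ⊛ G 4 ⊕ bracket 5 ⊛ G 5 · s₁-rec ∔ none)
    (solve 7 (λ q s g₀ g₂ g₃ g₄ g₅ → let one = con 1ℤ in
        (br q 1 :+ br q 4) :* (g₀ :- g₄) :+ br q 5 :* (g₀ :- g₅) :+ (brs q 4 :+ brs q 5) :* ((one :- q) :* g₀)
          :- (q :* (s :* g₂) :- 2 ×′ (s :* g₄) :- s :* g₅ :+ 10 ×′ g₀)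
      := :- (q :* s) :* (g₂ :- (g₃ :+ q ^ₑ 3 :* g₄)) :+ (:- (q :* s) :* (g₃ :- (g₄ :+ q ^ₑ 4 :* g₅))
         :+ (((br q 1 :+ br q 4) :* g₄ :+ br q 5 :* g₅) :* (s :- (one :+ q :* s)) :+ con 0ℤ)))
      refl q s₁ (G 0) (G 2) (G 3) (G 4) (G 5)))
  (Pos-⊕ (Pos-⊕ (Pos-⊛ (Pos-⊕ (Pos-bracket 1) (Pos-bracket 4)) G0-G4) (Pos-⊛ (Pos-bracket 5) G0-G5))
    (Pos-⊛ (Pos-⊕ (Pos-brackets 4) (Pos-brackets 5)) Pos-drop))

U-shift : Pos (q ^ 4 ⊛ U ⊖ U ⊕ 4 × G 0 ∙)
U-shift = Pos-resp (by-combination (bracket 4 ⊛ G 4 · s₁-rec ∔ none)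
    (solve 4 (λ q s g₀ g₄ → let one = con 1ℤ in
        br q 4 :* (g₀ :- g₄) :+ brs q 4 :* ((one :- q) :* g₀) :- (q ^ₑ 4 :* (s :* g₄) :- s :* g₄ :+ 4 ×′ g₀)
      := br q 4 :* g₄ :* (s :- (one :+ q :* s)) :+ con 0ℤ) refl q s₁ (G 0) (G 4)))
  (Pos-⊕ (Pos-⊛ (Pos-bracket 4) G0-G4) (Pos-⊛ (Pos-brackets 4) Pos-drop))

-- Up to multiples of G 0, L 0 ≥ 2 U + V + U/2 and 5 σ̂ G 0 ≤ 2 S ≤ 10 U + 6 V with V ≤ U.
parts-exceed : Pos (80 × L 0 ∙ ⊖ 80 × σ̂ ⊛ G 0 ∙ ⊖ 3 × S ∙ ⊕ 1080 × G 0 ∙)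
parts-exceed = Pos-resp
  (solve 9 (λ l w₂ w₄ x u v s p g →
      -- The multipliers come from 80 (2 U + V + U/2) = 35 (5 U + 3 V) + 25 (U - V) ≥ 35 S, while 80
      -- `σ̂ ⊛ G 0` is at most 32 S up to `G 0`; this leaves 3 S. The errors add up to 40 + 80 + 800
      -- + 160 = 1080.
      80 ×′ (l :- w₂ :- w₄) :+ 40 ×′ (2 ×′ w₄ :- x :+ g) :+ 16 ×′ (2 ×′ s :+ 5 ×′ g :- 5 ×′ p) :+ 35 ×′ (5 ×′ u :+ 3 ×′ v :- s)
        :+ 25 ×′ (u :- v) :+ 80 ×′ (w₂ :- 2 ×′ u :- v :+ 10 ×′ g) :+ 40 ×′ (x :- u :+ 4 ×′ g)
    := 80 ×′ l :- 80 ×′ p :- 3 ×′ s :+ 1080 ×′ g)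
    refl (L 0) W₂ W₄ (q ^ 4 ⊛ U) U V S (σ̂ ⊛ G 0) (G 0))
  (Pos-⊕ (Pos-⊕ (Pos-⊕ (Pos-⊕ (Pos-⊕ (Pos-⊕ (Pos-× 80 L-bound) (Pos-× 40 W₄-bound)) (Pos-× 16 σ̂-bound)) (Pos-× 35 S-bound)) (Pos-× 25 V≤U)) (Pos-× 80 W₂-bound)) (Pos-× 40 U-shift))

-- This is `slack` at i = 0, where the factor 1 - q^0 removes `G 1`; adding 2 + q cancels the
-- constants.
parts-bounded : Pos (S ⊕ 2 × G 0 ∙ ⊖ 2 × L 0 ∙)
parts-bounded = Pos-resp
  (solve 5 (λ q s g h l → let one = con 1ℤ; two = con (+ 2) in
      s :* (g :- (one :- one) :* h) :+ two :* (g :- one) :- q :* one :- two :* l :+ two :+ q := s :* g :+ 2 ×′ g :- 2 ×′ l)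
    refl q s₁ (G 0) (G 1) (L 0))
  (Pos-⊕ (Pos-⊕ (Pos-slack 0) (Pos-const 2)) Pos-q)

-- Up to `G 0`, the series 10 `σ̂` and 10 `ρ̂` contribute 4 S and 2 S, while 10 L takes away 5 S;
-- one S remains. The constant 40 is 2 (1 + 4) for the powers in `σ̂`, 2 + 8 for those in `ρ̂`, 10
-- for - q, and 10 from `parts-bounded`.
twoHooks-exceed : Pos (10 × τ̂ ⊛ G 0 ∙ ⊖ 10 × L 0 ∙ ⊖ S ⊕ 40 × G 0 ∙)
twoHooks-exceed = Pos-resp (by-combination
    ( (2 × q ∙ ⊕ 2 × q ^ 4 ∙) ⊛ G 0 · s₁≈s₅
    ∔ (q ^ 2 ⊕ q ^ 8) ⊛ G 0 · s₁≈s₁₀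
    ∔ (2 × bracket 1 ∙ ⊕ 2 × bracket 4 ∙ ⊕ bracket 2 ⊕ bracket 8) ⊛ G 0 · s₁-rec ∔ none)
    (solve 6 (λ q s t r g l → let one = con 1ℤ; d = (one :- q) :* g in
        2 ×′ (t :* d :* (q :+ q ^ₑ 4) :* brs q 5) :+ r :* d :* (q ^ₑ 2 :+ q ^ₑ 8) :* brs q 10
          :+ (2 ×′ brs q 4 :+ brs q 2 :+ brs q 8) :* d :+ 10 ×′ d :+ 5 ×′ (s :* g :+ 2 ×′ g :- 2 ×′ l)
          :- (10 ×′ (((q :+ q ^ₑ 4) :* t :+ (q ^ₑ 2 :+ q ^ₑ 8) :* r :- q) :* g) :- 10 ×′ l :- s :* g :+ 40 ×′ g)
      := (2 ×′ q :+ 2 ×′ q ^ₑ 4) :* g :* (s :- br q 5 :* t)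
         :+ ((q ^ₑ 2 :+ q ^ₑ 8) :* g :* (s :- br q 10 :* r)
         :+ ((2 ×′ br q 1 :+ 2 ×′ br q 4 :+ br q 2 :+ br q 8) :* g :* (s :- (one :+ q :* s)) :+ con 0ℤ)))
      refl q s₁ s₅ s₁₀ (G 0) (L 0)))
  (Pos-⊕ (Pos-⊕ (Pos-⊕ (Pos-⊕
    (Pos-× 2 (Pos-⊛ (Pos-⊛ (Pos-⊛ (Pos-geo 4) Pos-drop) (Pos-⊕ Pos-q (Pos-x 4))) (Pos-brackets 5)))
    (Pos-⊛ (Pos-⊛ (Pos-⊛ (Pos-geo 9) Pos-drop) (Pos-⊕ (Pos-x 2) (Pos-x 8))) (Pos-brackets 10)))
    (Pos-⊛ (Pos-⊕ (Pos-⊕ (Pos-× 2 (Pos-brackets 4)) (Pos-brackets 2)) (Pos-brackets 8)) Pos-drop))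
    (Pos-× 10 Pos-drop)) (Pos-× 5 parts-bounded))

-- The limits of `σ` and `τ`

private
  vanish : ∀ n f → Q ^ suc n ⊛ f ≈[ n ] ⟪ 0ℤ ⟫
  vanish n f = multiple-vanishes n (q ^ (4 ℕ.* suc n) ⊛ f)
    (≈-trans (*-congʳ {f} (Q^-factor (suc n))) (*-assoc (q ^ suc n) (q ^ (4 ℕ.* suc n)) f))

σ-agrees : ∀ n → σ n ≈[ n ] σ̂
σ-agrees n = ≈[]-trans n (≈[]-sym n (stable σ step n≤N))
    (≈[]-sym n (≈[]-trans n (≈⇒≈[] n (tail (suc n))) (≈[]-trans n (⊕-cong[] n (≈[]-refl n) (vanish n σ̂)) (≈⇒≈[] n (+-identityʳ _)))))
  where
  n≤N : n ℕ.≤ suc n ℕ.* 5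
  n≤N = ℕ.≤-trans (ℕ.n≤1+n n) (ℕ.m≤m*n (suc n) 5)
  step : ∀ m → σ (suc m) ≈[ m ] σ m
  step m = go (isPart (suc m))
    where
    go : ∀ b → (if b then σ m ⊕ q ^ suc m else σ m) ≈[ m ] σ m
    go false = ≈[]-refl m
    go true  = ≈[]-trans m (⊕-cong[] m (≈[]-refl m) (multiple-vanishes m one (≈-sym (*-identityʳ (q ^ suc m))))) (≈⇒≈[] m (+-identityʳ (σ m)))
  tail : ∀ k → σ̂ ≈ σ (k ℕ.* 5) ⊕ Q ^ k ⊛ σ̂
  tail zero    = solve 1 (λ s → s := con 0ℤ :+ con 1ℤ :* s) refl σ̂
  tail (suc k) = by-combination (one · tail k ∔ (q ⊕ q ^ 4) ⊛ Q ^ k · geo-rec 4 ∔ ⊝ one · σ≈ ∔ ⊝ (q ⊕ q ^ 4) · q^5n≈ k ∔ none)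
      (solve 6 (λ q s x y t u → let one = con 1ℤ; h = (q :+ q ^ₑ 4) :* s in
          h :- (u :+ q ^ₑ 5 :* x :* h)
        := one :* (h :- (t :+ x :* h)) :+ ((q :+ q ^ₑ 4) :* x :* (s :- (one :+ q ^ₑ 5 :* s))
           :+ (:- one :* (u :- (t :+ q :* y :+ q ^ₑ 4 :* y)) :+ (:- (q :+ q ^ₑ 4) :* (y :- x) :+ con 0ℤ))))
        refl q s₅ (Q ^ k) (q ^ N) (σ N) (σ (5 ℕ.+ N)))
    where
    N = k ℕ.* 5
    σ-suc : ∀ i → σ (suc i ℕ.+ N) ≈ (if isPart (suc i) then σ (i ℕ.+ N) ⊕ q ^ (suc i ℕ.+ N) else σ (i ℕ.+ N))
    σ-suc i = ≈-reflexive (cong (if_then σ (i ℕ.+ N) ⊕ q ^ (suc i ℕ.+ N) else σ (i ℕ.+ N)) (isPart-+5 (suc i) k))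
    σ≈ : σ (5 ℕ.+ N) ≈ σ N ⊕ q ⊛ q ^ N ⊕ q ^ 4 ⊛ q ^ N
    σ≈ = ≈-trans (σ-suc 4) (≈-trans (σ-suc 3) (+-cong (≈-trans (σ-suc 2) (≈-trans (σ-suc 1) (σ-suc 0))) (^-homo-* q 4 N)))

τ-agrees : ∀ n → τ n ≈[ n ] τ̂
τ-agrees n = ≈[]-trans n (≈[]-sym n (stable τ step n≤N))
    (≈[]-sym n (≈[]-trans n (≈⇒≈[] n (tail n)) (≈[]-trans n (⊕-cong[] n (≈[]-refl n) (vanish n _)) (≈⇒≈[] n (+-identityʳ _)))))
  where
  n≤N : n ℕ.≤ suc n ℕ.* 5
  n≤N = ℕ.≤-trans (ℕ.n≤1+n n) (ℕ.m≤m*n (suc n) 5)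
  step : ∀ m → τ (suc m) ≈[ m ] τ m
  step m = go (isPart (suc m))
    where
    go : ∀ b → (if b then τ m ⊕ q ^ suc m ⊛ (⟪ + big (suc m) ⟫ ⊕ q ^ suc m) else τ m) ≈[ m ] τ m
    go false = ≈[]-refl m
    go true  = ≈[]-trans m (⊕-cong[] m (≈[]-refl m) (shift-vanishes m _)) (≈⇒≈[] m (+-identityʳ (τ m)))
  τ≈ : ∀ k → let N = k ℕ.* 5; x = Q ^ k in
       τ (5 ℕ.+ N) ≈ τ N ⊕ q ⊛ x ⊛ (⟪ + big (suc N) ⟫ ⊕ q ⊛ x) ⊕ q ^ 4 ⊛ x ⊛ (one ⊕ q ^ 4 ⊛ x)
  τ≈ k = ≈-trans (τ-suc 4) (≈-trans (τ-suc 3) (+-cong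
      (≈-trans (τ-suc 2) (≈-trans (τ-suc 1) (≈-trans (τ-suc 0) (+-congˡ {τ N} (*-cong x≈₁ (+-congˡ {⟪ + big (suc N) ⟫} x≈₁))))))
      (*-cong x≈₄ (+-congˡ {one} x≈₄))))
    where
    N = k ℕ.* 5
    τ-suc : ∀ i → τ (suc i ℕ.+ N) ≈ (if isPart (suc i) then τ (i ℕ.+ N) ⊕ q ^ (suc i ℕ.+ N) ⊛ (⟪ + big (suc i ℕ.+ N) ⟫ ⊕ q ^ (suc i ℕ.+ N)) else τ (i ℕ.+ N))
    τ-suc i = ≈-reflexive (cong (if_then τ (i ℕ.+ N) ⊕ q ^ (suc i ℕ.+ N) ⊛ (⟪ + big (suc i ℕ.+ N) ⟫ ⊕ q ^ (suc i ℕ.+ N)) else τ (i ℕ.+ N)) (isPart-+5 (suc i) k))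
    x≈₁ : q ^ (1 ℕ.+ N) ≈ q ⊛ Q ^ k
    x≈₁ = *-congˡ {q} (q^5n≈ k)
    x≈₄ : q ^ (4 ℕ.+ N) ≈ q ^ 4 ⊛ Q ^ k
    x≈₄ = ≈-trans (^-homo-* q 4 N) (*-congˡ {q ^ 4} (q^5n≈ k))
  -- The induction begins after the first period of five, which contains the exceptional part 1;
  -- from then on `big` is always 1.
  tail : ∀ k → τ̂ ≈ τ (suc k ℕ.* 5) ⊕ Q ^ suc k ⊛ (σ̂ ⊕ Q ^ suc k ⊛ ρ̂)
  tail zero    = by-combination (q ⊕ q ^ 4 · geo-rec 4 ∔ q ^ 2 ⊕ q ^ 8 · geo-rec 9 ∔ ⊝ one · τ≈ 0 ∔ none)
    (solve 4 (λ q s r t → let one = con 1ℤ; h = (q :+ q ^ₑ 4) :* s; h′ = (q ^ₑ 2 :+ q ^ₑ 8) :* r; Q = q ^ₑ 5 :* one in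
        h :+ h′ :- q :- (t :+ Q :* (h :+ Q :* h′))
      := (q :+ q ^ₑ 4) :* (s :- (one :+ q ^ₑ 5 :* s)) :+ ((q ^ₑ 2 :+ q ^ₑ 8) :* (r :- (one :+ q ^ₑ 10 :* r))
         :+ (:- one :* (t :- (con 0ℤ :+ q :* one :* (con 0ℤ :+ q :* one) :+ q ^ₑ 4 :* one :* (one :+ q ^ₑ 4 :* one))) :+ con 0ℤ)))
      refl q s₅ s₁₀ (τ 5))
  tail (suc k) = by-combination (one · tail k ∔ (q ⊕ q ^ 4) ⊛ x · geo-rec 4 ∔ (q ^ 2 ⊕ q ^ 8) ⊛ x ⊛ x · geo-rec 9 ∔ ⊝ one · τ≈ (suc k) ∔ none)
    (solve 6 (λ q x s r t u → let one = con 1ℤ; h = (q :+ q ^ₑ 4) :* s; h′ = (q ^ₑ 2 :+ q ^ₑ 8) :* r; Q = q ^ₑ 5 in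
        h :+ h′ :- q :- (u :+ Q :* x :* (h :+ Q :* x :* h′))
      := one :* (h :+ h′ :- q :- (t :+ x :* (h :+ x :* h′)))
         :+ ((q :+ q ^ₑ 4) :* x :* (s :- (one :+ q ^ₑ 5 :* s)) :+ ((q ^ₑ 2 :+ q ^ₑ 8) :* x :* x :* (r :- (one :+ q ^ₑ 10 :* r))
         :+ (:- one :* (u :- (t :+ q :* x :* (one :+ q :* x) :+ q ^ₑ 4 :* x :* (one :+ q ^ₑ 4 :* x))) :+ con 0ℤ))))
      refl q x s₅ s₁₀ (τ (suc k ℕ.* 5)) (τ (5 ℕ.+ suc k ℕ.* 5)))
    where
    x = Q ^ suc k

-- From generating functions to hook numbers

private
  sum-filter : ∀ b w λss → sum (map w (filter (λ λs → b λs Bool.≟ true) λss)) ≡ sum (map (restrict b w) λss)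
  sum-filter b w []         = refl
  sum-filter b w (λs ∷ λss) with b λs
  ... | true  = cong (w λs ℕ.+_) (sum-filter b w λss)
  ... | false = sum-filter b w λss

  restrict-≤ : ∀ b {x y} → (b ≡ true → x ℕ.≤ y) → (if b then x else 0) ℕ.≤ (if b then y else 0)
  restrict-≤ true  le = le refl
  restrict-≤ false le = ℕ.z≤n

r₁≡ : ∀ t n → r₁ t n ≡ total (restrict gap2 (numHooks t)) n n n
r₁≡ t n = sum-filter gap2 (numHooks t) (partitions n)

r₂≡ : ∀ t n → r₂ t n ≡ total (restrict mod14 (numHooks t)) n n n
r₂≡ t n = sum-filter mod14 (numHooks t) (partitions n)

r₁-1 : ∀ n → at (L 0) n ℤ.≤ + r₁ 1 n
r₁-1 n = begin
  at (L 0) n ≡⟨ (ℓ-agrees n ‼[]) n ℕ.≤-refl ⟨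
  at (ℓ n) n ≤⟨ ℤ.+≤+ (total-mono n n n λ {λs} d → restrict-≤ (gap2 λs) λ g →
                  ℕ.≤-reflexive (sym (trans (numHooks-rows 1 d) (hookCount₁-gap2 d g)))) ⟩
  + total (restrict gap2 (numHooks 1)) n n n ≡⟨ cong +_ (r₁≡ 1 n) ⟨
  + r₁ 1 n ∎
  where open ℤ.≤-Reasoning

r₁-2 : ∀ n → + r₁ 2 n ℤ.≤ at (L 0) n
r₁-2 n = begin
  + r₁ 2 n ≡⟨ cong +_ (r₁≡ 2 n) ⟩
  + total (restrict gap2 (numHooks 2)) n n n ≤⟨ ℤ.+≤+ (total-mono n n n λ {λs} d → restrict-≤ (gap2 λs) λ g →
                  ℕ.≤-trans (ℕ.≤-reflexive (numHooks-rows 2 d)) (hookCount₂-gap2 d g)) ⟩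
  at (ℓ n) n ≡⟨ (ℓ-agrees n ‼[]) n ℕ.≤-refl ⟩
  at (L 0) n ∎
  where open ℤ.≤-Reasoning

r₂-1 : ∀ n → + r₂ 1 n ℤ.≤ at (σ̂ ⊛ G 0) n
r₂-1 n = begin
  + r₂ 1 n ≡⟨ cong +_ (r₂≡ 1 n) ⟩
  + total (restrict mod14 (numHooks 1)) n n n ≤⟨ ℤ.+≤+ (total-mono n n n λ {λs} d → restrict-≤ (mod14 λs) λ _ →
                  ℕ.≤-trans (ℕ.≤-reflexive (numHooks-rows 1 d)) (hookCount₁-distinct d)) ⟩
  at (count (restrict mod14 distinct) n) n ≡⟨ count-distinct n ‼ n ⟩
  at (P n ⊛ σ n) n ≡⟨ (⊛-cong[] n (P-agrees-G n) (σ-agrees n) ‼[]) n ℕ.≤-refl ⟩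
  at (G 0 ⊛ σ̂) n ≡⟨ *-comm (G 0) σ̂ ‼ n ⟩
  at (σ̂ ⊛ G 0) n ∎
  where open ℤ.≤-Reasoning

r₂-2 : ∀ n → at (τ̂ ⊛ G 0) n ℤ.≤ + r₂ 2 n
r₂-2 n = begin
  at (τ̂ ⊛ G 0) n ≡⟨ *-comm τ̂ (G 0) ‼ n ⟩
  at (G 0 ⊛ τ̂) n ≡⟨ (⊛-cong[] n (P-agrees-G n) (τ-agrees n) ‼[]) n ℕ.≤-refl ⟨
  at (P n ⊛ τ n) n ≡⟨ count-twoHooks n ‼ n ⟨
  at (count (restrict mod14 twoHooks) n) n ≤⟨ ℤ.+≤+ (total-mono n n n λ {λs} d → restrict-≤ (mod14 λs) λ g →
                  ℕ.≤-trans (hookCount₂-mod14 d g) (ℕ.≤-reflexive (sym (numHooks-rows 2 d)))) ⟩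
  + total (restrict mod14 (numHooks 2)) n n n ≡⟨ cong +_ (r₂≡ 2 n) ⟨
  + r₂ 2 n ∎
  where open ℤ.≤-Reasoning

G-positive : ∀ n → 1ℤ ℤ.≤ at (G 0) n
G-positive n = ℤ.≤-trans (ℤ.≤-reflexive (sym (s₁≡1 n))) (ℤ.0≤i-j⇒j≤i ((s₁≤G ≥0) n))
  where
  s₁≡1 : ∀ n → at s₁ n ≡ 1ℤ
  s₁≡1 zero    = refl
  s₁≡1 (suc n) = trans (s₁-rec ‼ suc n) (trans (ℤ.+-identityˡ _) (trans (*-congʳ {s₁} (≈-sym (*-identityʳ q)) ‼ suc n) (trans (q^⊛-+ 1 s₁ n) (s₁≡1 n))))
  s₁≤G : Pos (G 0 ⊖ s₁)
  s₁≤G = Pos-resp (by-combination (G 0 · s₁-rec ∔ none)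
    (solve 3 (λ q s g → let one = con 1ℤ in
        s :* ((one :- q) :* (g :- one) :- q :* one) :- (g :- s) := g :* (s :- (one :+ q :* s)) :+ con 0ℤ) refl q s₁ (G 0)))
    (Pos-⊛ (Pos-geo 0) (Pos-gap 0))

private
  infixl 8 _×ᶻ_
  _×ᶻ_ : ∀ {n} → ℕ → ℤS.Polynomial n → ℤS.Polynomial n
  k ×ᶻ x = ℤS.con (+ k) ℤS.:* x

theorem1p2 : ∃[ N ] (∀ n → n ≥ N → (r₁ 1 n > r₂ 1 n) × (r₁ 2 n < r₂ 2 n))
-- The constant 182 makes 3 (2 · 182 − 2) larger than 1080.
theorem1p2 = let N , many = many-parts 182 in N , λ n N≤n →
  let l = at (L 0) n; g = at (G 0) n; s = at S n; c = at (σ̂ ⊛ G 0) n; d = at (τ̂ ⊛ G 0) n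
      × = const-⊛
      exceed = subst (0ℤ ℤ.≤_) (cong₂ ℤ._+_ (cong₂ ℤ._-_ (cong₂ ℤ._-_ (× (+ 80) (L 0) n) (× (+ 80) (σ̂ ⊛ G 0) n)) (× (+ 3) S n)) (× (+ 1080) (G 0) n)) ((parts-exceed ≥0) n)
      bounded = subst (0ℤ ℤ.≤_) (cong₂ ℤ._-_ (cong (λ x → s ℤ.+ x) (× (+ 2) (G 0) n)) (× (+ 2) (L 0) n)) ((parts-bounded ≥0) n)
      twos = subst (0ℤ ℤ.≤_) (cong₂ ℤ._+_ (cong (ℤ._- s) (cong₂ ℤ._-_ (× (+ 10) (τ̂ ⊛ G 0) n) (× (+ 10) (L 0) n))) (× (+ 40) (G 0) n)) ((twoHooks-exceed ≥0) n)
      mny = ℤ.i≤j⇒0≤j-i (many n N≤n)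
      g≥1 = ℤ.i≤j⇒0≤j-i (G-positive n)
  in ℤ.drop‿+<+ (ℤ.≤-<-trans (r₂-1 n) (ℤ.<-≤-trans (lemma₁ l g s c exceed bounded mny g≥1) (r₁-1 n)))
   , ℤ.drop‿+<+ (ℤ.≤-<-trans (r₁-2 n) (ℤ.<-≤-trans (lemma₂ l g s d twos bounded mny g≥1) (r₂-2 n)))
  where
  strict : ∀ k e x y {z} → 0ℤ ℤ.≤ z → + suc k ℤ.* y ℤ.- (+ suc k ℤ.* x ℤ.+ + suc e) ≡ z → x ℤ.< y
  strict k e x y p eq = ℤ.*-cancelˡ-<-nonNeg (+ suc k) (ℤ.<-≤-trans
    (subst (ℤ._< + suc k ℤ.* x ℤ.+ + suc e) (ℤ.+-identityʳ (+ suc k ℤ.* x)) (ℤ.+-monoʳ-< (+ suc k ℤ.* x) (ℤ.+<+ (ℕ.s≤s (ℕ.z≤n {e})))))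
    (≤-by p eq))
  module _ (l g s : ℤ) where
    scale : ∀ k {x} → 0ℤ ℤ.≤ x → 0ℤ ℤ.≤ + k ℤ.* x
    scale k p = ℤ.≤-trans (ℤ.≤-reflexive (sym (ℤ.*-zeroʳ (+ k)))) (ℤ.*-monoˡ-≤-nonNeg (+ k) p)
    lemma₁ : ∀ c → 0ℤ ℤ.≤ + 80 ℤ.* l ℤ.- + 80 ℤ.* c ℤ.- + 3 ℤ.* s ℤ.+ + 1080 ℤ.* g → 0ℤ ℤ.≤ s ℤ.+ + 2 ℤ.* g ℤ.- + 2 ℤ.* l →
             0ℤ ℤ.≤ l ℤ.- + 182 ℤ.* g → 0ℤ ℤ.≤ g ℤ.- 1ℤ → c ℤ.< l
    -- 80 (l - c) ≥ 3 s - 1080 g ≥ 6 l - 1086 g ≥ 6 g ≥ 6, since 6 · 182 = 1092. The argument 5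
    -- stands for this 6.
    lemma₁ c h₁ h₂ h₃ h₄ = strict 79 5 c l
      (ℤ.+-mono-≤ (ℤ.+-mono-≤ (ℤ.+-mono-≤ h₁ (scale 3 h₂)) (scale 6 h₃)) (scale 6 h₄))
      (ℤS.solve 4 (λ l g s c →
            80 ×ᶻ l ℤS.:- (80 ×ᶻ c ℤS.:+ ℤS.con (+ 6))
          ℤS.:= 80 ×ᶻ l ℤS.:- 80 ×ᶻ c ℤS.:- 3 ×ᶻ s ℤS.:+ 1080 ×ᶻ g ℤS.:+ 3 ×ᶻ (s ℤS.:+ 2 ×ᶻ g ℤS.:- 2 ×ᶻ l) ℤS.:+ 6 ×ᶻ (l ℤS.:- 182 ×ᶻ g) ℤS.:+ 6 ×ᶻ (g ℤS.:- ℤS.con 1ℤ))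
          refl l g s c)
    lemma₂ : ∀ d → 0ℤ ℤ.≤ + 10 ℤ.* d ℤ.- + 10 ℤ.* l ℤ.- s ℤ.+ + 40 ℤ.* g → 0ℤ ℤ.≤ s ℤ.+ + 2 ℤ.* g ℤ.- + 2 ℤ.* l →
             0ℤ ℤ.≤ l ℤ.- + 182 ℤ.* g → 0ℤ ℤ.≤ g ℤ.- 1ℤ → l ℤ.< d
    -- 10 (d - l) ≥ s - 40 g ≥ 2 l - 42 g ≥ 322 g ≥ 322, since 2 · 182 = 364.
    lemma₂ d h₁ h₂ h₃ h₄ = strict 9 321 l d
      (ℤ.+-mono-≤ (ℤ.+-mono-≤ (ℤ.+-mono-≤ h₁ (scale 1 h₂)) (scale 2 h₃)) (scale 322 h₄))
      (ℤS.solve 4 (λ l g s d →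
            10 ×ᶻ d ℤS.:- (10 ×ᶻ l ℤS.:+ ℤS.con (+ 322))
          ℤS.:= 10 ×ᶻ d ℤS.:- 10 ×ᶻ l ℤS.:- s ℤS.:+ 40 ×ᶻ g ℤS.:+ 1 ×ᶻ (s ℤS.:+ 2 ×ᶻ g ℤS.:- 2 ×ᶻ l) ℤS.:+ 2 ×ᶻ (l ℤS.:- 182 ×ᶻ g) ℤS.:+ 322 ×ᶻ (g ℤS.:- ℤS.con 1ℤ))
          refl l g s d)
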